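{- For undirected unweighted graphs $G=(V,E)$ with $n=|V|$ and $m=|E|$, there is a distance oracle that uses $\tilde{O}(n^{4/3})$ space and that, given two query vertices $u,v\in V$, computes in $\tilde{O}(n^{1/3})$ time a distance estimation $\hat{d}(u,v)$ satisfying $$d(u,v)\le \hat{d}(u,v) \le 3d(u,v) + 2\cdot (d(u,v) \bmod 2).$$ The distance oracle is constructed in $\tilde{O}(mn^{1/3})$ expected time.
   Context: $d(u,v)$ is the length of a shortest path between $u$ and $v$ in $G$. A distance oracle is a data structure obtained by preprocessing $G$ (possibly with a randomized algorithm); a query algorithm, given any pair $u,v\in V$ and access only to the data structure, returns an estimate $\hat d(u,v)$. The space of the oracle is the size of the data structure; the construction time is the running time of the preprocessing. $\tilde{O}(\cdot)$ hides factors polylogarithmic in $n$. -}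

module Defs where

open import Data.Bool.Base using (Bool; true; false; if_then_else_)
open import Data.Fin.Base using (Fin; toℕ) renaming (_<_ to _<ᶠ_)
open import Data.List.Base using (List; []; _∷_; length; _++_; concatMap; applyUpTo)
open import Data.List.Membership.Propositional using (_∈_)
open import Data.List.Relation.Unary.All using (All)
open import Data.List.Relation.Unary.Unique.Propositional using (Unique)
open import Data.Maybe.Base using (Maybe; just; nothing)
open import Data.Nat.Base
  using (ℕ; zero; suc; _+_; _*_; _∸_; _^_; _/_; _%_; _≤_; _≡ᵇ_; _<ᵇ_)
open import Data.Nat.Logarithm using (⌈log₂_⌉)
open import Data.Nat.Properties using (m^n≢0)
open import Data.Product.Base using (_×_; _,_; ∃-syntax; proj₁; proj₂)
open import Data.Sum.Base using (_⊎_)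
open import Data.Vec.Base using (Vec; []; _∷_)
open import Relation.Binary.PropositionalEquality.Core using (_≡_)
open import Relation.Nullary.Negation.Core using (¬_)

------------------------------------------------------------------------
-- Graphs and distances

-- A finite simple undirected graph on Fin n.  The edge {u , v} is listed
-- exactly once, as its increasing pair; the order of the list is arbitrary.

record Graph (n : ℕ) : Set where
  field
    edges      : List (Fin n × Fin n)
    increasing : All (λ e → proj₁ e <ᶠ proj₂ e) edges
    distinct   : Unique edges

open Graph public

∣E_∣ : ∀ {n} → Graph n → ℕ
∣E G ∣ = length (edges G)

Adjacent : ∀ {n} → Graph n → Fin n → Fin n → Set
Adjacent G u v = (u , v) ∈ edges G ⊎ (v , u) ∈ edges G

-- Vertices may repeat; a shortest path has no repetition.

data Path {n : ℕ} (G : Graph n) : Fin n → Fin n → ℕ → Set where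
  stop : ∀ {u} → Path G u u 0
  step : ∀ {u v w ℓ} → Adjacent G u v → Path G v w ℓ → Path G u w (suc ℓ)

IsDistance : ∀ {n} → Graph n → Fin n → Fin n → ℕ → Set
IsDistance G u v d = Path G u v d × (∀ ℓ → Path G u v ℓ → d ≤ ℓ)

-- d ≤ d̂ ≤ 3 d + 2 (d mod 2), where d is the distance of u and v and
-- nothing stands for ∞.  If d = ∞, the lower bound says that d̂ = ∞; if d
-- is finite, the upper bound says that d̂ is finite.

GoodEstimate : ∀ {n} → Graph n → Fin n → Fin n → Maybe ℕ → Set
GoodEstimate G u v (just d̂) =
  ∃[ d ] IsDistance G u v d × d ≤ d̂ × d̂ ≤ 3 * d + 2 * (d % 2)
GoodEstimate G u v nothing  = ∀ ℓ → ¬ Path G u v ℓ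

------------------------------------------------------------------------
-- Bounds of the form Õ(b n^(e/3))

-- The shift makes this positive for every n, and gives n < 2 ^ log n.

log : ℕ → ℕ
log n = ⌈log₂ (2 + n) ⌉

record Polylog : Set where
  field
    constant exponent : ℕ

_⟨_⟩ : Polylog → ℕ → ℕ
p ⟨ n ⟩ = Polylog.constant p * log n ^ Polylog.exponent p

-- x ≤ b n^(e/3), with both sides cubed.

infix 4 _≤_·_^[_/3]

_≤_·_^[_/3] : ℕ → ℕ → ℕ → ℕ → Set
x ≤ b · n ^[ e /3] = x ^ 3 ≤ b ^ 3 * n ^ e

------------------------------------------------------------------------
-- Word RAM programs

-- A store has registers and arrays.  Programs name registers and arrays by
-- fixed numbers; only the index of an array cell is computed.

data Operator : Set where
  add sub mul div mod less equal : Operator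

data Expr : Set where
  const : ℕ → Expr
  reg   : ℕ → Expr
  cell  : ℕ → Expr → Expr
  _⟪_⟫_ : Expr → Operator → Expr → Expr

data Cmd : Set where
  setReg  : ℕ → Expr → Cmd
  setCell : ℕ → Expr → Expr → Cmd
  coin    : ℕ → Cmd
  ite     : Expr → List Cmd → List Cmd → Cmd
  while   : Expr → List Cmd → Cmd

Program : Set
Program = List Cmd

record Store : Set where
  constructor ⟨_,_⟩
  field
    regs   : ℕ → ℕ
    arrays : ℕ → ℕ → ℕ

open Store public

infixl 10 _[_↦_]

_[_↦_] : {A : Set} → (ℕ → A) → ℕ → A → ℕ → A
(f [ i ↦ x ]) j = if i ≡ᵇ j then x else f j

bit : Bool → ℕ
bit false = 0
bit true  = 1

-- sub is truncated subtraction; div and mod by 0 return 0.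

⟦_⟧ : Operator → ℕ → ℕ → ℕ
⟦ add   ⟧ x y       = x + y
⟦ sub   ⟧ x y       = x ∸ y
⟦ mul   ⟧ x y       = x * y
⟦ div   ⟧ x zero    = 0
⟦ div   ⟧ x (suc y) = x / suc y
⟦ mod   ⟧ x zero    = 0
⟦ mod   ⟧ x (suc y) = x % suc y
⟦ less  ⟧ x y       = bit (x <ᵇ y)
⟦ equal ⟧ x y       = bit (x ≡ᵇ y)

truncate : ℕ → ℕ → ℕ
truncate w x = _%_ x (2 ^ w) {{m^n≢0 2 w}}

-- All arithmetic is on w-bit words.

eval : (w : ℕ) → Store → Expr → ℕ
eval w σ (const k)     = truncate w k
eval w σ (reg x)       = regs σ x
eval w σ (cell a e)    = arrays σ a (eval w σ e)
eval w σ (e₁ ⟪ o ⟫ e₂) = truncate w (⟦ o ⟧ (eval w σ e₁) (eval w σ e₂))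

-- The commands still to be executed, and the current store.

Config : Set
Config = List Cmd × Store

-- One unit of time.  A program is fixed independently of the input, so the
-- expressions in it have bounded size and are evaluated in constant time.
-- Each step is handed a fresh random bit, which only coin looks at.

next : (w : ℕ) → Bool → Config → Config
next w b ([] , σ) = [] , σ
next w b (setReg x e ∷ cs , σ) =
  cs , ⟨ regs σ [ x ↦ eval w σ e ] , arrays σ ⟩
next w b (setCell a i e ∷ cs , σ) =
  cs , ⟨ regs σ
       , arrays σ [ a ↦ arrays σ a [ eval w σ i ↦ eval w σ e ] ] ⟩
next w b (coin x ∷ cs , σ) =
  cs , ⟨ regs σ [ x ↦ truncate w (bit b) ] , arrays σ ⟩
next w b (ite e ps qs ∷ cs , σ) with eval w σ e
... | zero  = qs ++ cs , σ
... | suc _ = ps ++ cs , σ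
next w b (while e ps ∷ cs , σ) with eval w σ e
... | zero  = cs , σ
... | suc _ = ps ++ (while e ps ∷ cs) , σ

run : ∀ {t} → (w : ℕ) → Vec Bool t → Config → Config
run w []      κ = κ
run w (b ∷ ω) κ = run w ω (next w b κ)

-- For ω of length t this is min(T , t), where T is the halting time.

steps : ∀ {t} → (w : ℕ) → Vec Bool t → Config → ℕ
steps w []      κ               = 0
steps w (b ∷ ω) ([]     , σ)    = 0
steps w (b ∷ ω) (c ∷ cs , σ)    = suc (steps w ω (next w b (c ∷ cs , σ)))

-- The sum of f over all 2 ^ t sequences of t bits.

∑ : ∀ t → (Vec Bool t → ℕ) → ℕ
∑ zero    f = f []
∑ (suc t) f = ∑ t (λ ω → f (false ∷ ω)) + ∑ t (λ ω → f (true ∷ ω))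

-- The expected halting time T is at most b n^(e/3).  By monotone
-- convergence E[T] is the supremum over t of E[min(T , t)], and
-- 2 ^ t * E[min(T , t)] is the sum below.

ExpectedTime_≤_·_^[_/3] : (ℕ × Config) → ℕ → ℕ → ℕ → Set
ExpectedTime (w , κ) ≤ b · n ^[ e /3] =
  ∀ t → ∑ t (λ ω → steps w ω κ) ≤ 2 ^ t * b · n ^[ e /3]

------------------------------------------------------------------------
-- Distance oracles

nth : List ℕ → ℕ → ℕ
nth []       _       = 0
nth (x ∷ xs) zero    = x
nth (x ∷ xs) (suc i) = nth xs i

-- Registers 0 and 1 hold x and y, array 0 holds the list, and everything
-- else is 0.

initial : ℕ → ℕ → List ℕ → Store
initial x y xs =
  ⟨ (λ _ → 0) [ 0 ↦ x ] [ 1 ↦ y ] , (λ _ _ → 0) [ 0 ↦ nth xs ] ⟩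

-- A word has wordFactor * log n bits, at least 2 log n: every vertex, the
-- number of edges and every index into the list of endpoints fit in a word.

record DistanceOracle : Set where
  field
    preprocessing : Program
    query         : Program
    extraFactor   : ℕ

  wordFactor : ℕ
  wordFactor = 2 + extraFactor

  wordLength : ℕ → ℕ
  wordLength n = wordFactor * log n

endpoints : ∀ {n} → Graph n → List ℕ
endpoints G = concatMap (λ e → toℕ (proj₁ e) ∷ toℕ (proj₂ e) ∷ []) (edges G)

module _ (O : DistanceOracle) where
  open DistanceOracle O

  preprocess : ∀ {n} → Graph n → ℕ × Config
  preprocess {n} G =
    wordLength n , preprocessing , initial n ∣E G ∣ (endpoints G)

  -- The data structure is a list of words: its length is left in register
  -- 0, its content in array 1.

  Builds : ∀ {n} → Graph n → List ℕ → Set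
  Builds G D =
    ∃[ t ] ∃[ ω ] ∃[ σ ]
      run {t} (proj₁ (preprocess G)) ω (proj₂ (preprocess G)) ≡ ([] , σ) ×
      D ≡ applyUpTo (arrays σ 1) (regs σ 0)

  decode : ℕ → Maybe ℕ
  decode zero    = nothing
  decode (suc k) = just k

  -- From D, u and v alone, whatever random bits are drawn, the query halts
  -- within t steps with answer d̂ in register 0: 0 for ∞, 1 + k for k.

  Answers : ∀ {n} → List ℕ → Fin n → Fin n → ℕ → Maybe ℕ → Set
  Answers {n} D u v t d̂ =
    ∀ (ω : Vec Bool t) → ∃[ σ ]
      run (wordLength n) ω (query , initial (toℕ u) (toℕ v) D) ≡ ([] , σ) ×
      decode (regs σ 0) ≡ d̂

-- A vertex u stores labels (h , d(u,h)) for certain hubs h, and the estimate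
-- for u and v is the least d(u,h) + d(h,v) over their common hubs.  Put
-- K = ⌈n^(1/3)⌉.  There are sets A₁ and A₂ of Õ(n^(2/3)) and Õ(n^(1/3))
-- vertices such that the hubs of u are
--   * the vertices of A₂,
--   * the K vertices of A₁ nearest to u, one of which is in A₂ unless fewer
--     than K vertices of A₁ are reachable from u,
--   * Õ(K) vertices such that every other w has d(w,A₁) ≤ d(w,u).
-- Take the midpoint w of a shortest u-v-path.  Either w is a hub of both, or
-- some q in A₁ is within ⌈d/2⌉ of w; then q is a hub of both, or some vertex
-- of A₂ is within d + d mod 2 of u or of v.
--
-- The lists of nearest vertices come from a multi-source breadth-first search
-- that visits every vertex at most k times, and the hitting sets from a greedy
-- choice with falling thresholds, so nothing is random.  For the third kind of
-- hub let W be all non-isolated vertices and k = K.  Compute for every w its k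
-- nearest vertices in W and put a hitting set of the full lists into A₁.  If
-- u in W occurs in at most K lists, their owners become hubs of u; the other
-- vertices of W form the next W, which has at most n k / K elements.  Then
-- halve k and repeat; A₁ also receives the last W.

module Submission where

open import Data.Bool.Base using (Bool; true; false; if_then_else_; _∧_; not; T)
open import Data.Empty using (⊥; ⊥-elim)
open import Data.Fin.Base using (Fin; toℕ)
import Data.Fin.Properties as Fin
open import Data.Fin.Properties using (toℕ-injective; toℕ<n; any?)
open import Data.List.Base
  using (List; []; _∷_; _++_; length; map; _ʳ++_; reverse; downFrom; foldr; concatMap; applyUpTo)
open import Data.List.Membership.Propositional using (_∈_)
open import Data.List.Membership.Propositional.Properties using (∈-map⁺; ∈-map⁻; ∈-++⁺ʳ; ∈-++⁺ˡ; ∈-++⁻)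
open import Data.List.Properties using (++-assoc; length-map; length-downFrom; length-ʳ++)
open import Data.List.Relation.Unary.All using ([]; _∷_; lookup)
open import Data.List.Relation.Unary.Any using (here; there)
open import Data.List.Relation.Unary.Any.Properties using (reverse⁺; reverse⁻)
open import Data.Nat.Base
open import Data.Nat.Logarithm using (⌈log₂_⌉; ⌈log₂⌈n/2⌉⌉≡⌈log₂n⌉∸1; ⌈log₂⌉-mono-≤)
open import Data.Nat.Properties
open import Data.Nat.Tactic.RingSolver using (solve-∀)
open import Data.Product.Base using (_×_; _,_; proj₁; proj₂; ∃-syntax; Σ-syntax)
open import Data.Product.Properties using (≡-dec)
open import Data.Sum.Base using (_⊎_; inj₁; inj₂)
open import Data.Unit.Base using (⊤; tt)
open import Data.Vec.Base using (Vec; []; _∷_)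
open import Relation.Binary.Definitions using (tri<; tri≈; tri>)
open import Relation.Binary.PropositionalEquality
open import Relation.Nullary using (¬_; Dec; yes; no)
open import Defs

-- The hubs of the third kind have to be inverted lists. Closeness of A₁ is needed at the midpoint
-- w, so what counts is whether u is among the vertices nearest to w, and then w has to be stored at
-- u. A list has bounded length, an inverted list has not, and this obstacle is what the rounds
-- remove.
--
-- Their balance is as follows. A hitting set of the full lists of length k has Õ(|W| / k) vertices.
-- The lists have at most n k entries in total, which limits the sources that occur in more than K
-- of them. So after k is halved, |W| / k is again O(n / K), and every round adds Õ(n / K) =
-- Õ(n^(2/3)) vertices to A₁, however short the lists have become. When k reaches 0, the last W has
-- itself at most n / K elements. The same hitting set bound, for lists of length K filled from A₁,
-- gives Õ(|A₁| / K) = Õ(n / K²) = Õ(n^(1/3)) vertices in A₂.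

-- Idealised execution: arithmetic on ℕ without truncation.

ev : Store → Expr → ℕ
ev σ (const k)     = k
ev σ (reg x)       = regs σ x
ev σ (cell a e)    = arrays σ a (ev σ e)
ev σ (e₁ ⟪ o ⟫ e₂) = ⟦ o ⟧ (ev σ e₁) (ev σ e₂)

setR : Store → ℕ → ℕ → Store
setR σ x v = ⟨ regs σ [ x ↦ v ] , arrays σ ⟩

setA : Store → ℕ → ℕ → ℕ → Store
setA σ a i v = ⟨ regs σ , arrays σ [ a ↦ arrays σ a [ i ↦ v ] ] ⟩

-- With the tested number as an argument, the same conditional describes the programs and the lists
-- that they compute, so deciding the number decides both.
branch : {A : Set} → ℕ → A → A → A
branch zero    x y = y
branch (suc _) x y = x

data Exec : Program → Store → ℕ → Store → Set where
  halt  : ∀ {σ} → Exec [] σ 0 σ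
  assign : ∀ {x e cs σ t τ} → Exec cs (setR σ x (ev σ e)) t τ →
          Exec (setReg x e ∷ cs) σ (suc t) τ
  store : ∀ {a i e cs σ t τ} → Exec cs (setA σ a (ev σ i) (ev σ e)) t τ →
          Exec (setCell a i e ∷ cs) σ (suc t) τ
  ite   : ∀ {e ps qs cs σ t t′ ρ τ} → Exec (branch (ev σ e) ps qs) σ t ρ →
          Exec cs ρ t′ τ → Exec (ite e ps qs ∷ cs) σ (suc (t + t′)) τ
  exit  : ∀ {e ps cs σ t τ} → ev σ e ≡ 0 → Exec cs σ t τ →
          Exec (while e ps ∷ cs) σ (suc t) τ
  again : ∀ {e ps cs σ t t′ ρ τ} → ev σ e ≢ 0 → Exec ps σ t ρ →
          Exec (while e ps ∷ cs) ρ t′ τ →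
          Exec (while e ps ∷ cs) σ (suc (t + t′)) τ

exec-time : ∀ {p σ s t τ} → s ≡ t → Exec p σ s τ → Exec p σ t τ
exec-time refl d = d

exec-++ : ∀ {p q σ t ρ t′ τ} → Exec p σ t ρ → Exec q ρ t′ τ →
          Exec (p ++ q) σ (t + t′) τ
exec-++ halt       r = r
exec-++ (assign d)   r = assign (exec-++ d r)
exec-++ (store d)   r = store (exec-++ d r)
exec-++ {t′ = t″} (ite {t = t} {t′} d d′) r =
  exec-time (cong suc (sym (+-assoc t t′ t″))) (ite d (exec-++ d′ r))
exec-++ (exit c d) r = exit c (exec-++ d r)
exec-++ {t′ = t″} (again {t = t} {t′} c d d′) r =
  exec-time (cong suc (sym (+-assoc t t′ t″))) (again c d (exec-++ d′ r))

-- Syntactic frame conditions.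

keepsReg keepsArr : ℕ → Program → Bool
keepsReg x []                   = true
keepsReg x (setReg y e ∷ cs)    = not (y ≡ᵇ x) ∧ keepsReg x cs
keepsReg x (setCell a i e ∷ cs) = keepsReg x cs
keepsReg x (coin y ∷ cs)        = not (y ≡ᵇ x) ∧ keepsReg x cs
keepsReg x (ite e ps qs ∷ cs)   = keepsReg x ps ∧ keepsReg x qs ∧ keepsReg x cs
keepsReg x (while e ps ∷ cs)    = keepsReg x ps ∧ keepsReg x cs
keepsArr a []                   = true
keepsArr a (setReg y e ∷ cs)    = keepsArr a cs
keepsArr a (setCell b i e ∷ cs) = not (b ≡ᵇ a) ∧ keepsArr a cs
keepsArr a (coin y ∷ cs)        = keepsArr a cs
keepsArr a (ite e ps qs ∷ cs)   = keepsArr a ps ∧ keepsArr a qs ∧ keepsArr a cs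
keepsArr a (while e ps ∷ cs)    = keepsArr a ps ∧ keepsArr a cs

∧-true : ∀ {x y} → x ∧ y ≡ true → x ≡ true × y ≡ true
∧-true {true} {true} _ = refl , refl

upd-off : ∀ {A : Set} (f : ℕ → A) i v j → not (i ≡ᵇ j) ≡ true → (f [ i ↦ v ]) j ≡ f j
upd-off f i v j p with i ≡ᵇ j
... | false = refl

branch-keeps : ∀ (P : Program → Bool) k {ps qs} → P ps ≡ true → P qs ≡ true →
               P (branch k ps qs) ≡ true
branch-keeps P zero    a b = b
branch-keeps P (suc _) a b = a

exec-reg : ∀ {p σ t τ} x → Exec p σ t τ → keepsReg x p ≡ true → regs τ x ≡ regs σ x
exec-reg x halt k = refl
exec-reg x (assign {y} {e} {σ = σ} d) k = let (k₁ , k₂) = ∧-true k in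
  trans (exec-reg x d k₂) (upd-off (regs σ) y (ev σ e) x k₁)
exec-reg x (store d) k = exec-reg x d k
exec-reg x (ite {e} {σ = σ} d d′) k =
  let (k₁ , k′) = ∧-true k ; (k₂ , k₃) = ∧-true k′ in
  trans (exec-reg x d′ k₃) (exec-reg x d (branch-keeps (keepsReg x) (ev σ e) k₁ k₂))
exec-reg x (exit c d) k = exec-reg x d (proj₂ (∧-true k))
exec-reg x (again c d d′) k =
  trans (exec-reg x d′ k) (exec-reg x d (proj₁ (∧-true k)))

exec-arr : ∀ {p σ t τ} a → Exec p σ t τ → keepsArr a p ≡ true → arrays τ a ≡ arrays σ a
exec-arr a halt k = refl
exec-arr a (assign d) k = exec-arr a d k
exec-arr a (store {b} {i} {e} {σ = σ} d) k = let (k₁ , k₂) = ∧-true k in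
  trans (exec-arr a d k₂) (upd-off (arrays σ) b _ a k₁)
exec-arr a (ite {e} {σ = σ} d d′) k =
  let (k₁ , k′) = ∧-true k ; (k₂ , k₃) = ∧-true k′ in
  trans (exec-arr a d′ k₃) (exec-arr a d (branch-keeps (keepsArr a) (ev σ e) k₁ k₂))
exec-arr a (exit c d) k = exec-arr a d (proj₂ (∧-true k))
exec-arr a (again c d d′) k =
  trans (exec-arr a d′ k) (exec-arr a d (proj₁ (∧-true k)))

-- Every value that a tame program stores exceeds the values present before
-- by at most 3, so a time bound is also a bound on all values.

leaves : Expr → ℕ
leaves (const k)     = 1
leaves (reg x)       = 1
leaves (cell a e)    = leaves e
leaves (e₁ ⟪ o ⟫ e₂) = leaves e₁ + leaves e₂

smallConsts : Expr → Bool
smallConsts (const k)     = k ≤ᵇ 3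
smallConsts (reg x)       = true
smallConsts (cell a e)    = smallConsts e
smallConsts (e₁ ⟪ o ⟫ e₂) = smallConsts e₁ ∧ smallConsts e₂

-- Sums and products of two variables are excluded, because storing them repeatedly makes values
-- grow exponentially or faster. They may still occur in guards and indices.
storable : Expr → Bool
storable (const k)                     = true
storable (reg x)                       = true
storable (cell a e)                    = true
storable (reg x ⟪ add ⟫ const k)       = true
storable (cell a e ⟪ add ⟫ const k)    = true
storable (reg x ⟪ div ⟫ const k)       = true
storable _                             = false

fits : ℕ → Expr → Bool
fits Z e = smallConsts e ∧ (leaves e ≤ᵇ Z)

tame : ℕ → Program → Bool
tame Z []                   = true
tame Z (setReg y e ∷ cs)    = storable e ∧ fits Z e ∧ tame Z cs
tame Z (setCell b i e ∷ cs) = storable e ∧ fits Z e ∧ fits Z i ∧ tame Z cs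
tame Z (coin y ∷ cs)        = false
tame Z (ite e ps qs ∷ cs)   = fits Z e ∧ tame Z ps ∧ tame Z qs ∧ tame Z cs
tame Z (while e ps ∷ cs)    = fits Z e ∧ tame Z ps ∧ tame Z cs

record Bounded (b : ℕ) (σ : Store) : Set where
  constructor bounded
  field
    reg≤ : ∀ x → regs σ x ≤ b
    arr≤ : ∀ a i → arrays σ a i ≤ b
open Bounded public

bounded-mono : ∀ {b c σ} → b ≤ c → Bounded b σ → Bounded c σ
bounded-mono b≤c (bounded p q) = bounded (λ x → ≤-trans (p x) b≤c) (λ a i → ≤-trans (q a i) b≤c)

upd-≤ : ∀ {b} (f : ℕ → ℕ) i v j → (∀ j → f j ≤ b) → v ≤ b → (f [ i ↦ v ]) j ≤ b
upd-≤ f i v j p q with i ≡ᵇ j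
... | true  = q
... | false = p j

bounded-setR : ∀ {b σ} x {v} → Bounded b σ → v ≤ b → Bounded b (setR σ x v)
bounded-setR {σ = σ} x {v} (bounded p q) v≤ = bounded (λ y → upd-≤ (regs σ) x v y p v≤) q

bounded-setA : ∀ {b σ} a i {v} → Bounded b σ → v ≤ b → Bounded b (setA σ a i v)
bounded-setA {b} {σ} a i {v} (bounded p q) v≤ = bounded p go
  where
  go : ∀ c j → arrays (setA σ a i v) c j ≤ b
  go c j with a ≡ᵇ c
  ... | true  = upd-≤ (arrays σ a) i v j (q a) v≤
  ... | false = q c j

≤ᵇ-true : ∀ {m n} → (m ≤ᵇ n) ≡ true → m ≤ n
≤ᵇ-true {m} {n} p = ≤ᵇ⇒≤ m n (subst T (sym p) tt)

bit≤1 : ∀ b → bit b ≤ 1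
bit≤1 false = z≤n
bit≤1 true  = s≤s z≤n

m+n≤m*n : ∀ {m n} → 2 ≤ m → 2 ≤ n → m + n ≤ m * n
m+n≤m*n {suc (suc m)} {suc (suc n)} (s≤s (s≤s _)) (s≤s (s≤s _)) = begin
  2 + m + (2 + n)                     ≡⟨ +-comm (2 + m) (2 + n) ⟩
  (2 + n) + (2 + m)                   ≤⟨ +-monoʳ-≤ (2 + n) (+-mono-≤ (s≤s (s≤s (z≤n {n}))) (m≤m*n m (2 + n))) ⟩
  (2 + n) + ((2 + n) + m * (2 + n))   ∎
  where open ≤-Reasoning

div≤ : ∀ x y → ⟦ div ⟧ x y ≤ x
div≤ x zero    = z≤n
div≤ x (suc y) = m/n≤m x (suc y)
  where open import Data.Nat.DivMod using (m/n≤m)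

mod≤ : ∀ x y → ⟦ mod ⟧ x y ≤ x
mod≤ x zero    = z≤n
mod≤ x (suc y) = m%n≤m x (suc y)
  where open import Data.Nat.DivMod using (m%n≤m)

op≤ : ∀ o {x y m n} → 2 ≤ m → 2 ≤ n → x ≤ m → y ≤ n → ⟦ o ⟧ x y ≤ m * n
op≤ o {x} {y} {m} {n} 2≤m 2≤n x≤m y≤n = go o
  where
  instance
    _ : NonZero m
    _ = >-nonZero (≤-trans (s≤s z≤n) 2≤m)
    _ : NonZero n
    _ = >-nonZero (≤-trans (s≤s z≤n) 2≤n)
  x≤ : x ≤ m * n
  x≤ = ≤-trans x≤m (m≤m*n m n)
  1≤ : ∀ b → bit b ≤ m * n
  1≤ b = ≤-trans (bit≤1 b) (≤-trans (≤-trans (s≤s z≤n) 2≤m) (m≤m*n m n))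
  go : ∀ o → ⟦ o ⟧ x y ≤ m * n
  go add   = ≤-trans (+-mono-≤ x≤m y≤n) (m+n≤m*n 2≤m 2≤n)
  go sub   = ≤-trans (m∸n≤m x y) x≤
  go mul   = *-mono-≤ x≤m y≤n
  go div   = ≤-trans (div≤ x y) x≤
  go mod   = ≤-trans (mod≤ x y) x≤
  go less  = 1≤ (x <ᵇ y)
  go equal = 1≤ (x ≡ᵇ y)

leaves≥1 : ∀ e → 1 ≤ leaves e
leaves≥1 (const k)     = s≤s z≤n
leaves≥1 (reg x)       = s≤s z≤n
leaves≥1 (cell a e)    = leaves≥1 e
leaves≥1 (e₁ ⟪ o ⟫ e₂) = ≤-trans (leaves≥1 e₁) (m≤m+n _ _)

module _ {b : ℕ} where

  X : ℕ
  X = b + 3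

  3≤X : 3 ≤ X
  3≤X = m≤n+m 3 b

  instance
    X-nonZero : NonZero X
    X-nonZero = >-nonZero (≤-trans (s≤s z≤n) 3≤X)

  X≤^ : ∀ e → X ≤ X ^ leaves e
  X≤^ e = subst (_≤ X ^ leaves e) (^-identityʳ X) (^-monoʳ-≤ X (leaves≥1 e))

  -- Once both bounds are at least 2, every operator is dominated by multiplication, so an
  -- expression is at most a power whose exponent is its number of leaves. The base `b + 3` is at
  -- least 2 and also dominates the constants, which are at most 3.
  ev≤ : ∀ {σ} e → Bounded b σ → smallConsts e ≡ true → ev σ e ≤ X ^ leaves e
  ev≤ (const k) B s = ≤-trans (≤-trans (≤ᵇ-true s) 3≤X) (X≤^ (const k))
  ev≤ (reg x) B s = ≤-trans (≤-trans (reg≤ B x) (m≤m+n b 3)) (X≤^ (reg x))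
  ev≤ (cell a e) B s = ≤-trans (≤-trans (arr≤ B a _) (m≤m+n b 3)) (X≤^ e)
  ev≤ {σ} (e₁ ⟪ o ⟫ e₂) B s = let (s₁ , s₂) = ∧-true s in
    subst (ev σ (e₁ ⟪ o ⟫ e₂) ≤_) (sym (^-distribˡ-+-* X (leaves e₁) (leaves e₂)))
      (op≤ o (two e₁) (two e₂) (ev≤ e₁ B s₁) (ev≤ e₂ B s₂))
    where
    two : ∀ e → 2 ≤ X ^ leaves e
    two e = ≤-trans (≤-trans (s≤s (s≤s z≤n)) 3≤X) (X≤^ e)

  truncate-id : ∀ w {x} → x < 2 ^ w → truncate w x ≡ x
  truncate-id w x< = m<n⇒m%n≡m {{m^n≢0 2 w}} x<
    where open import Data.Nat.DivMod using (m<n⇒m%n≡m)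

  eval≡ev : ∀ w {σ} e → Bounded b σ → smallConsts e ≡ true → X ^ leaves e < 2 ^ w →
            eval w σ e ≡ ev σ e
  eval≡ev w (const k) B s f = truncate-id w (≤-<-trans (ev≤ {⟨ (λ _ → 0) , (λ _ _ → 0) ⟩} (const k) (bounded (λ _ → z≤n) (λ _ _ → z≤n)) s) f)
  eval≡ev w (reg x) B s f = refl
  eval≡ev w {σ} (cell a e) B s f = cong (arrays σ a) (eval≡ev w e B s f)
  eval≡ev w {σ} (e₁ ⟪ o ⟫ e₂) B s f =
    trans (cong (truncate w) (cong₂ ⟦ o ⟧ (eval≡ev w e₁ B s₁ (≤-<-trans (^-monoʳ-≤ X (m≤m+n (leaves e₁) (leaves e₂))) f))
                                           (eval≡ev w e₂ B s₂ (≤-<-trans (^-monoʳ-≤ X (m≤n+m (leaves e₂) (leaves e₁))) f))))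
          (truncate-id w (≤-<-trans (ev≤ {σ} (e₁ ⟪ o ⟫ e₂) B s) f))
    where
    s₁ = proj₁ (∧-true s)
    s₂ = proj₂ (∧-true {smallConsts e₁} s)

  stored≤ : ∀ {σ} e → Bounded b σ → smallConsts e ≡ true → storable e ≡ true → ev σ e ≤ 3 + b
  stored≤ (const k) B s _ = ≤-trans (≤ᵇ-true s) (m≤m+n 3 b)
  stored≤ (reg x) B s _ = ≤-trans (reg≤ B x) (m≤n+m b 3)
  stored≤ (cell a e) B s _ = ≤-trans (arr≤ B a _) (m≤n+m b 3)
  stored≤ {σ} (reg x ⟪ add ⟫ const k) B s _ =
    subst (_≤ 3 + b) (+-comm k (regs σ x)) (+-mono-≤ (≤ᵇ-true s) (reg≤ B x))
  stored≤ {σ} (cell a e ⟪ add ⟫ const k) B s _ =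
    subst (_≤ 3 + b) (+-comm k (ev σ (cell a e))) (+-mono-≤ (≤ᵇ-true (proj₂ (∧-true {smallConsts e} s))) (arr≤ B a _))
  stored≤ {σ} (reg x ⟪ div ⟫ const k) B s _ =
    ≤-trans (div≤ (regs σ x) k) (≤-trans (reg≤ B x) (m≤n+m b 3))

-- Simulation of idealised executions by the word RAM.

iter : ℕ → ℕ → Config → Config
iter w zero    κ = κ
iter w (suc t) κ = iter w t (next w false κ)

iter-+ : ∀ w t t′ κ → iter w (t + t′) κ ≡ iter w t′ (iter w t κ)
iter-+ w zero    t′ κ = refl
iter-+ w (suc t) t′ κ = iter-+ w t t′ (next w false κ)

next-ite : ∀ w e ps qs cs σ → next w false (ite e ps qs ∷ cs , σ) ≡ (branch (eval w σ e) ps qs ++ cs , σ)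
next-ite w e ps qs cs σ with eval w σ e
... | zero  = refl
... | suc _ = refl

next-exit : ∀ w e ps cs σ → eval w σ e ≡ 0 → next w false (while e ps ∷ cs , σ) ≡ (cs , σ)
next-exit w e ps cs σ p with eval w σ e
next-exit w e ps cs σ refl | zero = refl

next-again : ∀ w e ps cs σ → eval w σ e ≢ 0 → next w false (while e ps ∷ cs , σ) ≡ (ps ++ (while e ps ∷ cs) , σ)
next-again w e ps cs σ p with eval w σ e
... | zero  = ⊥-elim (p refl)
... | suc _ = refl

-- `B` bounds every stored value during the whole run and `Z` the leaves of every expression, so the
-- single inequality `fit` makes all truncations trivial.
module Simulation (w Z B : ℕ) (fit : (B + 3) ^ Z < 2 ^ w) where

  eval-ok : ∀ {σ} e → Bounded B σ → fits Z e ≡ true → eval w σ e ≡ ev σ e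
  eval-ok e bd f = eval≡ev {B} w e bd (proj₁ (∧-true f))
    (≤-<-trans (^-monoʳ-≤ (B + 3) {{X-nonZero {B}}} (≤ᵇ-true {leaves e} {Z} (proj₂ (∧-true {smallConsts e} f)))) fit)

  -- The continuation `cs` is arbitrary because the machine unfolds branches and loop bodies in
  -- front of the pending commands. The bound `b` grows by 3 per unit of time, the most that one
  -- assignment can add.
  exec⇒iter : ∀ {p σ t τ b} → Exec p σ t τ → tame Z p ≡ true → Bounded b σ → b + t * 3 ≤ B →
              (∀ cs → iter w t (p ++ cs , σ) ≡ (cs , τ)) × Bounded (b + t * 3) τ
  exec⇒iter {b = b} halt k bd ≤B = (λ cs → refl) , bounded-mono (≤-reflexive (sym (+-identityʳ b))) bd
  exec⇒iter {σ = σ} {b = b} (assign {x} {e} {t = t} d) k bd ≤B =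
    let (k₁ , k′) = ∧-true {storable e} k ; (k₂ , k₃) = ∧-true {fits Z e} k′
        eq = trans (sym (+-assoc b 3 (t * 3))) (cong (_+ t * 3) (+-comm b 3))
        (r , bd′) = exec⇒iter d k₃
          (bounded-setR x (bounded-mono (m≤n+m b 3) bd) (stored≤ {b} {σ} e bd (proj₁ (∧-true k₂)) k₁))
          (subst (_≤ B) eq ≤B)
    in (λ cs → trans (cong (λ v → iter w t (_ ++ cs , setR σ x v)) (eval-ok e (bounded-mono (≤-trans (m≤m+n b _) ≤B) bd) k₂)) (r cs))
     , bounded-mono (≤-reflexive (sym eq)) bd′
  exec⇒iter {σ = σ} {b = b} (store {a} {i} {e} {t = t} d) k bd ≤B =
    let (k₁ , k′) = ∧-true {storable e} k ; (k₂ , k″) = ∧-true {fits Z e} k′ ; (k₃ , k₄) = ∧-true {fits Z i} k″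
        eq = trans (sym (+-assoc b 3 (t * 3))) (cong (_+ t * 3) (+-comm b 3))
        bdB = bounded-mono (≤-trans (m≤m+n b _) ≤B) bd
        (r , bd′) = exec⇒iter d k₄
          (bounded-setA a (ev σ i) (bounded-mono (m≤n+m b 3) bd) (stored≤ {b} {σ} e bd (proj₁ (∧-true k₂)) k₁))
          (subst (_≤ B) eq ≤B)
    in (λ cs → trans (cong₂ (λ u v → iter w t (_ ++ cs , setA σ a u v)) (eval-ok i bdB k₃) (eval-ok e bdB k₂)) (r cs))
     , bounded-mono (≤-reflexive (sym eq)) bd′
  exec⇒iter {σ = σ} {b = b} (ite {e} {ps} {qs} {cs₀} {t = t} {t′} {ρ} d d′) k bd ≤B =
    let (k₁ , k′) = ∧-true {fits Z e} k ; (k₂ , k″) = ∧-true {tame Z ps} k′ ; (k₃ , k₄) = ∧-true {tame Z qs} k″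
        bdB = bounded-mono (≤-trans (m≤m+n b _) ≤B) bd
        (r , bd₁) = exec⇒iter d (branch-keeps (tame Z) (ev σ e) k₂ k₃) bd (≤-trans t≤ ≤B)
        (r′ , bd₂) = exec⇒iter d′ k₄ bd₁ (≤-trans tt′≤ ≤B)
    in (λ cs → trans (cong (iter w (t + t′)) (trans (next-ite w e ps qs (cs₀ ++ cs) σ) (cong (λ v → (branch v ps qs ++ cs₀ ++ cs , σ)) (eval-ok e bdB k₁))))
               (trans (iter-+ w t t′ _) (trans (cong (iter w t′) (r (cs₀ ++ cs))) (r′ cs))))
     , bounded-mono tt′≤ bd₂
    where
    t≤ : b + t * 3 ≤ b + suc (t + t′) * 3
    t≤ = +-monoʳ-≤ b (*-monoˡ-≤ 3 (≤-trans (m≤m+n t t′) (n≤1+n _)))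
    tt′≤ : b + t * 3 + t′ * 3 ≤ b + suc (t + t′) * 3
    tt′≤ = subst (_≤ b + suc (t + t′) * 3) (sym (trans (+-assoc b _ _) (cong (b +_) (sym (*-distribʳ-+ 3 t t′)))))
             (+-monoʳ-≤ b (m≤n+m ((t + t′) * 3) 3))
  exec⇒iter {b = b} (exit {e} {ps} {cs₀} {σ} {t} c d) k bd ≤B =
    let (k₁ , k′) = ∧-true {fits Z e} k ; (k₂ , k₃) = ∧-true {tame Z ps} k′
        bdB = bounded-mono (≤-trans (m≤m+n b _) ≤B) bd
        (r , bd′) = exec⇒iter d k₃ bd (≤-trans t≤ ≤B)
    in (λ cs → trans (cong (iter w t) (next-exit w e ps (cs₀ ++ cs) σ (trans (eval-ok e bdB k₁) c))) (r cs))
     , bounded-mono t≤ bd′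
    where
    t≤ : b + t * 3 ≤ b + suc t * 3
    t≤ = +-monoʳ-≤ b (m≤n+m (t * 3) 3)
  exec⇒iter {b = b} (again {e} {ps} {cs₀} {σ} {t} {t′} c d d′) k bd ≤B =
    let (k₁ , k′) = ∧-true {fits Z e} k ; (k₂ , k₃) = ∧-true {tame Z ps} k′
        bdB = bounded-mono (≤-trans (m≤m+n b _) ≤B) bd
        (r , bd₁) = exec⇒iter d k₂ bd (≤-trans t≤ ≤B)
        (r′ , bd₂) = exec⇒iter d′ k bd₁ (≤-trans tt′≤ ≤B)
    in (λ cs → trans (cong (iter w (t + t′)) (next-again w e ps (cs₀ ++ cs) σ (λ z → c (trans (sym (eval-ok e bdB k₁)) z))))
               (trans (iter-+ w t t′ _) (trans (cong (iter w t′) (r (while e ps ∷ cs₀ ++ cs))) (r′ cs))))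
     , bounded-mono tt′≤ bd₂
    where
    t≤ : b + t * 3 ≤ b + suc (t + t′) * 3
    t≤ = +-monoʳ-≤ b (*-monoˡ-≤ 3 (≤-trans (m≤m+n t t′) (n≤1+n _)))
    tt′≤ : b + t * 3 + t′ * 3 ≤ b + suc (t + t′) * 3
    tt′≤ = subst (_≤ b + suc (t + t′) * 3) (sym (trans (+-assoc b _ _) (cong (b +_) (sym (*-distribʳ-+ 3 t t′)))))
             (+-monoʳ-≤ b (m≤n+m ((t + t′) * 3) 3))

-- Programs without coins: independence of the random bits.

coinFree : Program → Bool
coinFree []                   = true
coinFree (setReg y e ∷ cs)    = coinFree cs
coinFree (setCell b i e ∷ cs) = coinFree cs
coinFree (coin y ∷ cs)        = false
coinFree (ite e ps qs ∷ cs)   = coinFree ps ∧ coinFree qs ∧ coinFree cs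
coinFree (while e ps ∷ cs)    = coinFree ps ∧ coinFree cs

coinFree-++ : ∀ p {q} → coinFree p ≡ true → coinFree q ≡ true → coinFree (p ++ q) ≡ true
coinFree-++ []                   a b = b
coinFree-++ (setReg y e ∷ p)     a b = coinFree-++ p a b
coinFree-++ (setCell c i e ∷ p)  a b = coinFree-++ p a b
coinFree-++ (ite e ps qs ∷ p)    a b with coinFree ps | coinFree qs
... | true | true = coinFree-++ p a b
coinFree-++ (while e ps ∷ p)     a b with coinFree ps
... | true = coinFree-++ p a b

next-coinFree : ∀ w b cs σ → coinFree cs ≡ true →
                next w b (cs , σ) ≡ next w false (cs , σ) × coinFree (proj₁ (next w false (cs , σ))) ≡ true
next-coinFree w b [] σ c = refl , refl
next-coinFree w b (setReg x e ∷ cs) σ c = refl , c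
next-coinFree w b (setCell a i e ∷ cs) σ c = refl , c
next-coinFree w b (ite e ps qs ∷ cs) σ c with eval w σ e
... | zero  = refl , let (_ , c′) = ∧-true {coinFree ps} c ; (c₁ , c₂) = ∧-true {coinFree qs} c′ in coinFree-++ qs c₁ c₂
... | suc _ = refl , let (c₀ , c′) = ∧-true {coinFree ps} c ; (c₁ , c₂) = ∧-true {coinFree qs} c′ in coinFree-++ ps c₀ c₂
next-coinFree w b (while e ps ∷ cs) σ c with eval w σ e
... | zero  = refl , proj₂ (∧-true {coinFree ps} c)
... | suc _ = refl , coinFree-++ ps (proj₁ (∧-true {coinFree ps} c)) c

run≡iter : ∀ w {t} (ω : Vec Bool t) cs σ → coinFree cs ≡ true → run w ω (cs , σ) ≡ iter w t (cs , σ)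
run≡iter w [] cs σ c = refl
run≡iter w (b ∷ ω) cs σ c with next-coinFree w b cs σ c
... | eq , c′ rewrite eq = run≡iter w ω _ _ c′

steps≤ : ∀ w {t} (ω : Vec Bool t) T cs σ → coinFree cs ≡ true → proj₁ (iter w T (cs , σ)) ≡ [] → steps w ω (cs , σ) ≤ T
steps≤ w [] T cs σ c h = z≤n
steps≤ w (b ∷ ω) T [] σ c h = z≤n
steps≤ w (b ∷ ω) zero (x ∷ cs) σ c ()
steps≤ w (b ∷ ω) (suc T) (x ∷ cs) σ c h with next-coinFree w b (x ∷ cs) σ c
... | eq , c′ rewrite eq = s≤s (steps≤ w ω T _ _ c′ h)

iter-halted : ∀ w t σ → iter w t ([] , σ) ≡ ([] , σ)
iter-halted w zero    σ = refl
iter-halted w (suc t) σ = iter-halted w t σ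

-- Total correctness with a time bound.

Ex : Program → Store → ℕ → (Store → Set) → Set
Ex p σ T Q = ∃[ t ] ∃[ τ ] Exec p σ t τ × t ≤ T × Q τ

ex-halt : ∀ {σ T Q} → Q σ → Ex [] σ T Q
ex-halt q = 0 , _ , halt , z≤n , q

ex-setR : ∀ {x e cs σ T Q} → Ex cs (setR σ x (ev σ e)) T Q → Ex (setReg x e ∷ cs) σ (suc T) Q
ex-setR (t , τ , d , t≤ , q) = suc t , τ , assign d , s≤s t≤ , q

ex-setA : ∀ {a i e cs σ T Q} → Ex cs (setA σ a (ev σ i) (ev σ e)) T Q → Ex (setCell a i e ∷ cs) σ (suc T) Q
ex-setA (t , τ , d , t≤ , q) = suc t , τ , store d , s≤s t≤ , q

ex-++ : ∀ {p q σ T T′} {P Q : Store → Set} → Ex p σ T P → (∀ τ → P τ → Ex q τ T′ Q) → Ex (p ++ q) σ (T + T′) Q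
ex-++ (t , ρ , d , t≤ , pρ) f with f ρ pρ
... | t′ , τ , d′ , t′≤ , qτ = t + t′ , τ , exec-++ d d′ , +-mono-≤ t≤ t′≤ , qτ

ex-weaken : ∀ {p σ T T′} {P Q : Store → Set} → T ≤ T′ → (∀ τ → P τ → Q τ) → Ex p σ T P → Ex p σ T′ Q
ex-weaken T≤ f (t , τ , d , t≤ , q) = t , τ , d , ≤-trans t≤ T≤ , f τ q

ex-ite₁ : ∀ {e ps qs cs σ T T′} {P Q : Store → Set} → ev σ e ≢ 0 →
          Ex ps σ T P → (∀ τ → P τ → Ex cs τ T′ Q) → Ex (ite e ps qs ∷ cs) σ (suc (T + T′)) Q
ex-ite₁ {e} {ps} {qs} {σ = σ} c (t , ρ , d , t≤ , pρ) f with f ρ pρ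
... | t′ , τ , d′ , t′≤ , qτ = suc (t + t′) , τ , ite (subst (λ p → Exec p σ t ρ) (lem (ev σ e) c) d) d′ , s≤s (+-mono-≤ t≤ t′≤) , qτ
  where
  lem : ∀ k → k ≢ 0 → ps ≡ branch k ps qs
  lem zero    z = ⊥-elim (z refl)
  lem (suc _) z = refl

ex-ite₀ : ∀ {e ps qs cs σ T T′} {P Q : Store → Set} → ev σ e ≡ 0 →
          Ex qs σ T P → (∀ τ → P τ → Ex cs τ T′ Q) → Ex (ite e ps qs ∷ cs) σ (suc (T + T′)) Q
ex-ite₀ {e} {ps} {qs} {σ = σ} c (t , ρ , d , t≤ , pρ) f with f ρ pρ
... | t′ , τ , d′ , t′≤ , qτ = suc (t + t′) , τ , ite (subst (λ k → Exec (branch k ps qs) σ t ρ) (sym c) d) d′ , s≤s (+-mono-≤ t≤ t′≤) , qτ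

ex-exit : ∀ {e ps σ T} {Q : Store → Set} → ev σ e ≡ 0 → Q σ → Ex (while e ps ∷ []) σ (suc T) Q
ex-exit c q = 1 , _ , exit c halt , s≤s z≤n , q

ex-again : ∀ {e ps cs σ T T′} {P Q : Store → Set} → ev σ e ≢ 0 →
           Ex ps σ T P → (∀ τ → P τ → Ex (while e ps ∷ cs) τ T′ Q) → Ex (while e ps ∷ cs) σ (suc (T + T′)) Q
ex-again c (t , ρ , d , t≤ , pρ) f with f ρ pρ
... | t′ , τ , d′ , t′≤ , qτ = suc (t + t′) , τ , again c d d′ , s≤s (+-mono-≤ t≤ t′≤) , qτ

-- The conditions are Boolean computations on the program text, so for a concrete program each of
-- them holds by `refl`.
record Frame (p : Program) (σ τ : Store) : Set where
  field
    reg≡ : ∀ x → keepsReg x p ≡ true → regs τ x ≡ regs σ x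
    arr≡ : ∀ a → keepsArr a p ≡ true → arrays τ a ≡ arrays σ a
open Frame public

ex-frame : ∀ {p σ T} {Q : Store → Set} → Ex p σ T Q → Ex p σ T (λ τ → Q τ × Frame p σ τ)
ex-frame (t , τ , d , t≤ , q) = t , τ , d , t≤ , q , record
  { reg≡ = λ x → exec-reg x d ; arr≡ = λ a → exec-arr a d }

≡ᵇ-refl : ∀ n → (n ≡ᵇ n) ≡ true
≡ᵇ-refl zero    = refl
≡ᵇ-refl (suc n) = ≡ᵇ-refl n

≡ᵇ-≢ : ∀ {m n} → m ≢ n → (m ≡ᵇ n) ≡ false
≡ᵇ-≢ {m} {n} m≢n with m ≡ᵇ n in eq
... | false = refl
... | true  = ⊥-elim (m≢n (≡ᵇ⇒≡ m n (subst T (sym eq) tt)))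

module _ {A : Set} (f : ℕ → A) where

  upd-same : ∀ i v → (f [ i ↦ v ]) i ≡ v
  upd-same i v rewrite ≡ᵇ-refl i = refl

  upd-other : ∀ {i j} v → i ≢ j → (f [ i ↦ v ]) j ≡ f j
  upd-other v i≢j rewrite ≡ᵇ-≢ i≢j = refl

-- Arrays with several indices are addressed through this pairing, which is
-- injective without any bound on its arguments.
pair : ℕ → ℕ → ℕ
pair x y = (x + y) * (x + y) + y

-- Pairs with coordinate sum z are sent into the interval from z² to z² + z, which ends before (z +
-- 1)².
pair-< : ∀ {x y x′ y′} → x + y < x′ + y′ → pair x y < pair x′ y′
pair-< {x} {y} {x′} {y′} lt = begin-strict
  z * z + y              ≤⟨ +-monoʳ-≤ (z * z) (m≤n+m y x) ⟩
  z * z + z              <⟨ m≤m+n _ z ⟩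
  suc (z * z + z) + z    ≡⟨ lem z ⟩
  suc z * suc z          ≤⟨ *-mono-≤ lt lt ⟩
  z′ * z′                ≤⟨ m≤m+n (z′ * z′) y′ ⟩
  z′ * z′ + y′           ∎
  where
  open ≤-Reasoning
  z = x + y
  z′ = x′ + y′
  lem : ∀ z → suc (z * z + z) + z ≡ suc z * suc z
  lem = solve-∀

pair-injective : ∀ {x y x′ y′} → pair x y ≡ pair x′ y′ → x ≡ x′ × y ≡ y′
pair-injective {x} {y} {x′} {y′} eq with <-cmp (x + y) (x′ + y′)
... | tri< lt _ _ = ⊥-elim (<-irrefl eq (pair-< {x} {y} {x′} {y′} lt))
... | tri> _ _ gt = ⊥-elim (<-irrefl (sym eq) (pair-< {x′} {y′} {x} {y} gt))
... | tri≈ _ z≡ _ = +-cancelʳ-≡ y x x′ (trans z≡ (cong (x′ +_) (sym y≡))) , y≡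
  where
  y≡ : y ≡ y′
  y≡ = +-cancelˡ-≡ ((x + y) * (x + y)) y y′ (trans eq (cong (λ z → z * z + y′) (sym z≡)))

pair-≢ˡ : ∀ {x y x′ y′} → x ≢ x′ → pair x y ≢ pair x′ y′
pair-≢ˡ {x} {y} {x′} {y′} ne eq = ne (proj₁ (pair-injective {x} {y} {x′} {y′} eq))

pair-≢ʳ : ∀ {x y x′ y′} → y ≢ y′ → pair x y ≢ pair x′ y′
pair-≢ʳ {x} {y} {x′} {y′} ne eq = ne (proj₂ (pair-injective {x} {y} {x′} {y′} eq))

pairE : Expr → Expr → Expr
pairE e f = ((e ⟪ add ⟫ f) ⟪ mul ⟫ (e ⟪ add ⟫ f)) ⟪ add ⟫ f

-- Finite sums and double counting.

Sum : ∀ {A : Set} → (A → ℕ) → List A → ℕ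
Sum f []       = 0
Sum f (x ∷ xs) = f x + Sum f xs

module _ {A : Set} where

  Sum-mono : ∀ {f g : A → ℕ} xs → (∀ x → x ∈ xs → f x ≤ g x) → Sum f xs ≤ Sum g xs
  Sum-mono []       h = z≤n
  Sum-mono (x ∷ xs) h = +-mono-≤ (h x (here refl)) (Sum-mono xs λ y y∈ → h y (there y∈))

  Sum-cong : ∀ {f g : A → ℕ} xs → (∀ x → f x ≡ g x) → Sum f xs ≡ Sum g xs
  Sum-cong []       h = refl
  Sum-cong (x ∷ xs) h = cong₂ _+_ (h x) (Sum-cong xs h)

  Sum-+ : ∀ (f g : A → ℕ) xs → Sum (λ x → f x + g x) xs ≡ Sum f xs + Sum g xs
  Sum-+ f g []       = refl
  Sum-+ f g (x ∷ xs) rewrite Sum-+ f g xs = lem (f x) (g x) (Sum f xs) (Sum g xs)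
    where
    lem : ∀ a b c d → a + b + (c + d) ≡ a + c + (b + d)
    lem = solve-∀

  Sum-*ˡ : ∀ c (f : A → ℕ) xs → Sum (λ x → c * f x) xs ≡ c * Sum f xs
  Sum-*ˡ c f []       = sym (*-zeroʳ c)
  Sum-*ˡ c f (x ∷ xs) = trans (cong (c * f x +_) (Sum-*ˡ c f xs)) (sym (*-distribˡ-+ c (f x) _))

  Sum-const : ∀ c (xs : List A) → Sum (λ _ → c) xs ≡ length xs * c
  Sum-const c []       = refl
  Sum-const c (x ∷ xs) = cong (c +_) (Sum-const c xs)

  Sum-1 : ∀ (xs : List A) → Sum (λ _ → 1) xs ≡ length xs
  Sum-1 xs = trans (Sum-const 1 xs) (*-identityʳ _)

  Sum-≤-const : ∀ {f : A → ℕ} c xs → (∀ x → x ∈ xs → f x ≤ c) → Sum f xs ≤ length xs * c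
  Sum-≤-const c xs h = subst (_ ≤_) (Sum-const c xs) (Sum-mono xs h)

  Sum-ʳ++ : ∀ (f : A → ℕ) xs ys → Sum f (xs ʳ++ ys) ≡ Sum f xs + Sum f ys
  Sum-ʳ++ f []       ys = refl
  Sum-ʳ++ f (x ∷ xs) ys = trans (Sum-ʳ++ f xs (x ∷ ys)) (lem (Sum f xs) (f x) (Sum f ys))
    where
    lem : ∀ a b c → a + (b + c) ≡ b + a + c
    lem = solve-∀

  Sum-map : ∀ {B : Set} (f : B → ℕ) (g : A → B) xs → Sum f (map g xs) ≡ Sum (λ x → f (g x)) xs
  Sum-map f g []       = refl
  Sum-map f g (x ∷ xs) = cong (f (g x) +_) (Sum-map f g xs)

same : ℕ → ℕ → ℕ
same x y = bit (x ≡ᵇ y)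

mult : ℕ → List ℕ → ℕ
mult z = Sum (same z)

sel : ℕ → List (ℕ × ℕ) → List ℕ
sel a []             = []
sel a ((x , y) ∷ ps) = if x ≡ᵇ a then y ∷ sel a ps else sel a ps

Distinct : List ℕ → Set
Distinct xs = ∀ z → mult z xs ≤ 1

same-refl : ∀ x → same x x ≡ 1
same-refl x rewrite ≡ᵇ-refl x = refl

same-≢ : ∀ {x y} → x ≢ y → same x y ≡ 0
same-≢ ne rewrite ≡ᵇ-≢ ne = refl

sel-yes : ∀ x y ps → sel x ((x , y) ∷ ps) ≡ y ∷ sel x ps
sel-yes x y ps rewrite ≡ᵇ-refl x = refl

sel-no : ∀ {a x} y ps → x ≢ a → sel a ((x , y) ∷ ps) ≡ sel a ps
sel-no y ps ne rewrite ≡ᵇ-≢ ne = refl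

∈-mult : ∀ {z xs} → z ∈ xs → 1 ≤ mult z xs
∈-mult {z} {xs = x ∷ xs} (here refl) = subst (λ b → 1 ≤ b + mult z xs) (sym (same-refl z)) (s≤s z≤n)
∈-mult {z} {xs = x ∷ xs} (there z∈)  = ≤-trans (∈-mult z∈) (m≤n+m _ (same z x))

mult-∈ : ∀ {z} xs → mult z xs ≢ 0 → z ∈ xs
mult-∈ []       p = ⊥-elim (p refl)
mult-∈ {z} (x ∷ xs) p with z ≟ x
... | yes refl = here refl
... | no ne    = there (mult-∈ xs λ q → p (trans (cong (_+ mult z xs) (same-≢ ne)) q))

∈-sel : ∀ {a y} ps → y ∈ sel a ps → (a , y) ∈ ps
∈-sel {a} ((x , z) ∷ ps) y∈ with x ≟ a
... | no ne = there (∈-sel ps (subst (_ ∈_) (sel-no z ps ne) y∈))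
... | yes refl with subst (_ ∈_) (sel-yes x z ps) y∈
...   | here refl = here refl
...   | there y∈′ = there (∈-sel ps y∈′)

sel-∈ : ∀ {a y} {ps} → (a , y) ∈ ps → y ∈ sel a ps
sel-∈ {a} {y} {_ ∷ ps} (here refl) = subst (y ∈_) (sym (sel-yes a y ps)) (here refl)
sel-∈ {a} {y} {(x , z) ∷ ps} (there p) with x ≟ a
... | yes refl = subst (y ∈_) (sym (sel-yes x z ps)) (there (sel-∈ p))
... | no ne    = subst (y ∈_) (sym (sel-no z ps ne)) (sel-∈ p)

Sum-sel : ∀ (f : ℕ → ℕ) a x y ps → Sum f (sel a ((x , y) ∷ ps)) ≡ same x a * f y + Sum f (sel a ps)
Sum-sel f a x y ps with x ≟ a
... | yes refl rewrite ≡ᵇ-refl x = cong (_+ Sum f (sel a ps)) (sym (+-identityʳ (f y)))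
... | no ne    rewrite ≡ᵇ-≢ ne   = refl

Sum-same : ∀ x (h : ℕ → ℕ) as → Sum (λ a → same x a * h a) as ≡ mult x as * h x
Sum-same x h []       = refl
Sum-same x h (a ∷ as) =
  trans (cong₂ _+_ lem (Sum-same x h as)) (sym (*-distribʳ-+ (h x) (same x a) (mult x as)))
  where
  lem : same x a * h a ≡ same x a * h x
  lem with x ≟ a
  ... | yes refl = refl
  ... | no ne rewrite ≡ᵇ-≢ ne = refl

-- Exchange of the order of summation. Keys may repeat in `as`, which the multiplicity records.
double-count : ∀ (g : ℕ → ℕ → ℕ) as ps →
               Sum (λ a → Sum (g a) (sel a ps)) as ≡ Sum (λ p → mult (proj₁ p) as * g (proj₁ p) (proj₂ p)) ps
double-count g as []             = trans (Sum-const 0 as) (*-zeroʳ (length as))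
double-count g as ((x , y) ∷ ps) = begin
  Sum (λ a → Sum (g a) (sel a ((x , y) ∷ ps))) as                ≡⟨ Sum-cong as (λ a → Sum-sel (g a) a x y ps) ⟩
  Sum (λ a → same x a * g a y + Sum (g a) (sel a ps)) as         ≡⟨ Sum-+ _ _ as ⟩
  Sum (λ a → same x a * g a y) as + Sum (λ a → Sum (g a) (sel a ps)) as
    ≡⟨ cong₂ _+_ (Sum-same x (λ a → g a y) as) (double-count g as ps) ⟩
  _ ∎
  where open ≡-Reasoning

double-count-length : ∀ as ps → Sum (λ a → length (sel a ps)) as ≡ Sum (λ p → mult (proj₁ p) as) ps
double-count-length as ps = begin
  Sum (λ a → length (sel a ps)) as                ≡⟨ Sum-cong as (λ a → sym (Sum-1 (sel a ps))) ⟩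
  Sum (λ a → Sum (λ _ → 1) (sel a ps)) as         ≡⟨ double-count (λ _ _ → 1) as ps ⟩
  Sum (λ p → mult (proj₁ p) as * 1) ps            ≡⟨ Sum-cong ps (λ p → *-identityʳ _) ⟩
  Sum (λ p → mult (proj₁ p) as) ps                ∎
  where open ≡-Reasoning

-- Pairing each element with itself turns `sel` into a multiplicity count, so that double counting
-- applies to plain lists too.
diagonal : List ℕ → List (ℕ × ℕ)
diagonal = map (λ x → x , x)

length-sel-diagonal : ∀ a xs → length (sel a (diagonal xs)) ≡ mult a xs
length-sel-diagonal a []       = refl
length-sel-diagonal a (x ∷ xs) with x ≟ a
... | yes refl rewrite ≡ᵇ-refl x = cong suc (length-sel-diagonal x xs)
... | no ne    rewrite ≡ᵇ-≢ ne | ≡ᵇ-≢ (λ e → ne (sym e)) = length-sel-diagonal a xs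

-- Double counting of the pairs of equal elements, one from each list.
pigeonhole : ∀ xs ys → Distinct xs → (∀ x → x ∈ xs → x ∈ ys) → length xs ≤ length ys
pigeonhole xs ys dis incl = begin
  length xs                                         ≡⟨ Sum-1 xs ⟨
  Sum (λ _ → 1) xs                                  ≤⟨ Sum-mono xs (λ x x∈ → ∈-mult (incl x x∈)) ⟩
  Sum (λ x → mult x ys) xs                          ≡⟨ Sum-map (λ p → mult (proj₁ p) ys) (λ x → x , x) xs ⟨
  Sum (λ p → mult (proj₁ p) ys) (diagonal xs)       ≡⟨ double-count-length ys (diagonal xs) ⟨
  Sum (λ y → length (sel y (diagonal xs))) ys       ≡⟨ Sum-cong ys (λ y → length-sel-diagonal y xs) ⟩
  Sum (λ y → mult y xs) ys                          ≤⟨ Sum-mono ys (λ y _ → dis y) ⟩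
  Sum (λ _ → 1) ys                                  ≡⟨ Sum-1 ys ⟩
  length ys                                         ∎
  where open ≤-Reasoning

∈-downFrom : ∀ {n x} → x < n → x ∈ downFrom n
∈-downFrom {suc n} {x} x<n with x ≟ n
... | yes refl = here refl
... | no ne    = there (∈-downFrom (≤∧≢⇒< (≤-pred x<n) ne))

downFrom-< : ∀ n {x} → x ∈ downFrom n → x < n
downFrom-< (suc n) (here refl) = n<1+n n
downFrom-< (suc n) (there x∈)  = m<n⇒m<1+n (downFrom-< n x∈)

Distinct-∷ : ∀ {x xs} → mult x xs ≡ 0 → Distinct xs → Distinct (x ∷ xs)
Distinct-∷ {x} {xs} ∉ dis z with z ≟ x
... | yes refl rewrite ∉ = ≤-reflexive (trans (+-identityʳ _) (same-refl x))
... | no ne rewrite ≡ᵇ-≢ ne = dis z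

Distinct-tail : ∀ {x xs} → Distinct (x ∷ xs) → Distinct xs
Distinct-tail {x} {xs} dis z = ≤-trans (m≤n+m _ (same z x)) (dis z)

mult-∉ : ∀ {z} xs → (∀ x → x ∈ xs → z ≢ x) → mult z xs ≡ 0
mult-∉ []       h = refl
mult-∉ {z} (x ∷ xs) h rewrite ≡ᵇ-≢ (h x (here refl)) = mult-∉ xs λ y y∈ → h y (there y∈)

downFrom-distinct : ∀ n → Distinct (downFrom n)
downFrom-distinct zero    z = z≤n
downFrom-distinct (suc n) = Distinct-∷ {n} {downFrom n} (mult-∉ (downFrom n) λ x x∈ e → <-irrefl (sym e) (downFrom-< n x∈)) (downFrom-distinct n)

distinct-length≤ : ∀ n xs → Distinct xs → (∀ x → x ∈ xs → x < n) → length xs ≤ n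
distinct-length≤ n xs dis h = subst (length xs ≤_) (length-downFrom n)
  (pigeonhole xs (downFrom n) dis λ x x∈ → ∈-downFrom (h x x∈))

-- Lists in arrays, newest element first: the element at distance i from the
-- end of the list is in cell i.

Stored : (ℕ → ℕ) → List ℕ → Set
Stored f []       = ⊤
Stored f (x ∷ xs) = f (length xs) ≡ x × Stored f xs

stored-cong : ∀ {f g} xs → (∀ i → i < length xs → f i ≡ g i) → Stored f xs → Stored g xs
stored-cong []       h st        = tt
stored-cong (x ∷ xs) h (p , st) = trans (sym (h _ ≤-refl)) p , stored-cong xs (λ i i< → h i (m<n⇒m<1+n i<)) st

stored-push : ∀ {f} i x xs → i ≡ length xs → Stored f xs → Stored (f [ i ↦ x ]) (x ∷ xs)
stored-push {f} i x xs refl st = upd-same f _ x , stored-cong xs (λ j j< → sym (upd-other f x λ e → <-irrefl (sym e) j<)) st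

stored-ʳ++ : ∀ {f} xs ys → Stored f (xs ʳ++ ys) → Stored f ys
stored-ʳ++ []       ys st = st
stored-ʳ++ (x ∷ xs) ys st = proj₂ (stored-ʳ++ xs (x ∷ ys) st)

stored-++ : ∀ {f} xs ys → Stored f (xs ++ ys) → Stored f ys
stored-++ []       ys st        = st
stored-++ (x ∷ xs) ys (_ , st) = stored-++ xs ys st

stored-at : ∀ {f} xs y ys → Stored f (xs ʳ++ (y ∷ ys)) → f (length ys) ≡ y
stored-at xs y ys st = proj₁ (stored-ʳ++ xs (y ∷ ys) st)

-- The list with a given key: array c holds its length, array d its elements.

Row : (ℕ → ℕ) → (ℕ → ℕ) → ℕ → List ℕ → Set
Row c d key xs = c key ≡ length xs × Stored (λ j → d (pair key j)) xs

module _ {c d : ℕ → ℕ} (key x : ℕ) where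

  row-push : ∀ {xs} → Row c d key xs →
             Row (c [ key ↦ c key + 1 ]) (d [ pair key (c key) ↦ x ]) key (x ∷ xs)
  row-push {xs} (len , st) =
      trans (upd-same c key _) (trans (cong (_+ 1) len) (+-comm _ 1))
    , trans (cong (λ l → (d [ pair key (c key) ↦ x ]) (pair key l)) (sym len)) (upd-same d _ x)
    , stored-cong xs (λ i i< → sym (upd-other d x (pair-≢ʳ {key} {c key} {key} λ e → <-irrefl (trans (sym e) len) i<))) st

  row-other : ∀ {k xs} → key ≢ k → Row c d k xs →
              Row (c [ key ↦ c key + 1 ]) (d [ pair key (c key) ↦ x ]) k xs
  row-other {k} {xs} ne (len , st) =
      trans (upd-other c _ ne) len
    , stored-cong xs (λ i i< → sym (upd-other d x (pair-≢ˡ {key} {c key} {k} {i} ne))) st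

row-cong : ∀ {c d c′ d′ key xs} → c′ ≡ c → d′ ≡ d → Row c d key xs → Row c′ d′ key xs
row-cong refl refl row = row

<ᵇ-true : ∀ {m n} → m < n → (m <ᵇ n) ≡ true
<ᵇ-true {m} {n} lt with m <ᵇ n | <⇒<ᵇ {m} {n} lt
... | true | _ = refl

<ᵇ-false : ∀ {m n} → n ≤ m → (m <ᵇ n) ≡ false
<ᵇ-false {m} {n} le with m <ᵇ n in eq
... | false = refl
... | true  = ⊥-elim (<-irrefl refl (<-≤-trans (<ᵇ⇒< m n (subst T (sym eq) tt)) le))

less-true : ∀ {m n} → m < n → ⟦ less ⟧ m n ≢ 0
less-true lt rewrite <ᵇ-true lt = λ ()

less-false : ∀ {m n} → n ≤ m → ⟦ less ⟧ m n ≡ 0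
less-false le rewrite <ᵇ-false le = refl

frame-refl : ∀ {p σ} → Frame p σ σ
frame-refl = record { reg≡ = λ _ _ → refl ; arr≡ = λ _ _ → refl }

frame-trans : ∀ {p σ ρ τ} → Frame p σ ρ → Frame p ρ τ → Frame p σ τ
frame-trans f g = record
  { reg≡ = λ x k → trans (reg≡ g x k) (reg≡ f x k)
  ; arr≡ = λ a k → trans (arr≡ g a k) (arr≡ f a k) }

-- The first argument of I lists the elements already visited.

loop : ℕ → Expr → Program → Program
loop j bound body = while (reg j ⟪ less ⟫ bound) body ∷ []

ex-loop : ∀ {A : Set} j bound body (xs : List A) (I : List A → Store → Set) (c : A → ℕ) σ₀ →
  (∀ done σ → Frame body σ₀ σ → I done σ → ev σ bound ≡ length xs) →
  (∀ x todo done σ → (x ∷ todo) ʳ++ done ≡ xs → Frame body σ₀ σ → regs σ j ≡ length done → I done σ →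
     Ex body σ (c x) (λ τ → regs τ j ≡ suc (length done) × I (x ∷ done) τ)) →
  regs σ₀ j ≡ 0 → I [] σ₀ →
  Ex (loop j bound body) σ₀ (suc (Sum (λ x → suc (c x)) xs)) (I xs)
ex-loop {A} j bound body xs I c σ₀ len iterate j0 i0 =
  -- The last element of `xs` is in cell 0, so the program meets the elements in the order of
  -- `reverse xs`, and the visited ones always form a suffix of `xs` whose length is the counter.
  subst (λ T → Ex (loop j bound body) σ₀ (suc T) (I xs)) time (go (reverse xs) [] σ₀ (reverse-involutive xs) frame-refl j0 i0)
  where
  open import Data.List.Properties using (reverse-involutive)
  time : Sum (λ x → suc (c x)) (reverse xs) ≡ Sum (λ x → suc (c x)) xs
  time = trans (Sum-ʳ++ (λ x → suc (c x)) xs []) (+-identityʳ _)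
  go : ∀ todo done σ → todo ʳ++ done ≡ xs → Frame body σ₀ σ → regs σ j ≡ length done → I done σ →
       Ex (loop j bound body) σ (suc (Sum (λ x → suc (c x)) todo)) (I xs)
  go [] done σ refl fr j≡ i = ex-exit (less-false (≤-reflexive (trans (len done σ fr i) (sym j≡)))) i
  go (x ∷ todo) done σ eq fr j≡ i = ex-weaken (≤-reflexive (cong suc (lem (c x) (Sum (λ x → suc (c x)) todo)))) (λ _ q → q)
    (ex-again (less-true (subst₂ _<_ (sym j≡) (sym (len done σ fr i)) lt)) (ex-frame (iterate x todo done σ eq fr j≡ i))
      λ τ ((j≡′ , i′) , fr′) → go todo (x ∷ done) τ eq (frame-trans fr fr′) j≡′ i′)
    where
    lt : length done < length xs
    lt = subst (λ l → length done < length l) eq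
           (subst (length done <_) (sym (length-ʳ++ todo)) (m≤n+m _ (length todo)))
    lem : ∀ a b → a + suc b ≡ suc (a + b)
    lem = solve-∀

-- Walks and truncated multi-source breadth-first search.

data Walk (H : List (ℕ × ℕ)) : ℕ → ℕ → ℕ → Set where
  nil  : ∀ {u} → Walk H u u 0
  snoc : ∀ {u v w ℓ} → Walk H u v ℓ → (v , w) ∈ H → Walk H u w (suc ℓ)

record Entry : Set where
  constructor entry
  field
    vertex source dist : ℕ
open Entry public

vs sv : Entry → ℕ × ℕ
vs q = vertex q , source q
sv q = source q , vertex q

VS SV : List Entry → List (ℕ × ℕ)
VS = map vs
SV = map sv

at : ℕ → List Entry → List ℕ
at x Q = sel x (VS Q)

-- Written with `branch` on the same numbers that `pushP` tests, so that the program and the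
-- function fall into the same case.
push : ℕ → Entry → List Entry → List Entry
push k q Q = branch (mult (source q) (at (vertex q) Q)) Q
               (branch (⟦ less ⟧ (length (at (vertex q) Q)) k) (q ∷ Q) Q)

data Push (k : ℕ) (q : Entry) (Q : List Entry) : List Entry → Set where
  seen : mult (source q) (at (vertex q) Q) ≢ 0 → Push k q Q Q
  full : mult (source q) (at (vertex q) Q) ≡ 0 → k ≤ length (at (vertex q) Q) → Push k q Q Q
  new  : mult (source q) (at (vertex q) Q) ≡ 0 → length (at (vertex q) Q) < k → Push k q Q (q ∷ Q)

push-cases : ∀ k q Q → Push k q Q (push k q Q)
push-cases k q Q with mult (source q) (at (vertex q) Q) in eq
... | suc _ = seen λ e → 0≢1+n (trans (sym e) eq)
... | zero with length (at (vertex q) Q) <? k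
...   | yes lt rewrite <ᵇ-true lt = new eq lt
...   | no ≮ rewrite <ᵇ-false (≮⇒≥ ≮) = full eq (≮⇒≥ ≮)

at-∈ : ∀ {Q q} → q ∈ Q → source q ∈ at (vertex q) Q
at-∈ q∈ = sel-∈ (∈-map⁺ vs q∈)

∈-at : ∀ {Q x s} → s ∈ at x Q → ∃[ d ] entry x s d ∈ Q
∈-at {Q} s∈ with ∈-map⁻ vs (∈-sel (VS Q) s∈)
... | q , q∈ , refl = dist q , q∈

push-⊆ : ∀ {k q Q p} → p ∈ Q → p ∈ push k q Q
push-⊆ {k} {q} {Q} p∈ with push k q Q | push-cases k q Q
... | _ | seen _   = p∈
... | _ | full _ _ = p∈
... | _ | new _ _  = there p∈

∈-push : ∀ {k q Q p} → p ∈ push k q Q → p ≡ q ⊎ p ∈ Q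
∈-push {k} {q} {Q} p∈ with push k q Q | push-cases k q Q
... | _ | seen _   = inj₂ p∈
... | _ | full _ _ = inj₂ p∈
∈-push (here e)   | _ | new _ _ = inj₁ e
∈-push (there p∈) | _ | new _ _ = inj₂ p∈

record Table (k : ℕ) (Q : List Entry) : Set where
  field
    distinct-at : ∀ x → Distinct (at x Q)
    length-at   : ∀ x → length (at x Q) ≤ k
open Table public

table-[] : ∀ {k} → Table k []
table-[] = record { distinct-at = λ x z → z≤n ; length-at = λ x → z≤n }

table-push : ∀ {k q Q} → Table k Q → Table k (push k q Q)
table-push {k} {q} {Q} t with push k q Q | push-cases k q Q
... | _ | seen _   = t
... | _ | full _ _ = t
... | _ | new ∉ lt = record { distinct-at = d ; length-at = l }
  where
  d : ∀ x → Distinct (at x (q ∷ Q))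
  d x with vertex q ≟ x
  ... | yes refl rewrite ≡ᵇ-refl x = Distinct-∷ {source q} {at x Q} ∉ (distinct-at t x)
  ... | no ne rewrite ≡ᵇ-≢ ne = distinct-at t x
  l : ∀ x → length (at x (q ∷ Q)) ≤ k
  l x with vertex q ≟ x
  ... | yes refl rewrite ≡ᵇ-refl x = lt
  ... | no ne rewrite ≡ᵇ-≢ ne = length-at t x

entry-unique : ∀ Q {x s d d′} → Distinct (at x Q) → entry x s d ∈ Q → entry x s d′ ∈ Q → d ≡ d′
entry-unique (q ∷ Q) dis (here refl) (here refl) = refl
entry-unique (q ∷ Q) {x} {s} dis (here refl) (there e′) =
  ⊥-elim (<-irrefl refl (≤-trans (+-mono-≤ (≤-reflexive (sym (same-refl s))) (∈-mult (at-∈ e′)))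
    (subst (λ l → mult s l ≤ 1) (sel-yes x s (VS Q)) (dis s))))
entry-unique (q ∷ Q) {x} {s} dis (there e) (here refl) =
  ⊥-elim (<-irrefl refl (≤-trans (+-mono-≤ (≤-reflexive (sym (same-refl s))) (∈-mult (at-∈ e)))
    (subst (λ l → mult s l ≤ 1) (sel-yes x s (VS Q)) (dis s))))
entry-unique (q ∷ Q) {x} dis (there e) (there e′) = entry-unique Q dis′ e e′
  where
  dis′ : Distinct (at x Q)
  dis′ with vertex q ≟ x
  ... | yes refl = Distinct-tail {source q} {at x Q} (subst Distinct (sel-yes x (source q) (VS Q)) dis)
  ... | no ne    = subst Distinct (sel-no (source q) (VS Q) ne) dis

Near : List Entry → ℕ → ℕ → ℕ → Set
Near Q x s ℓ = ∃[ d ] d ≤ ℓ × entry x s d ∈ Q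

Full : ℕ → List Entry → ℕ → ℕ → Set
Full k Q x ℓ = k ≤ length (at x Q) × (∀ s d → entry x s d ∈ Q → d ≤ ℓ)

-- What a truncated search can promise for a source `s` within ℓ of `x`: it is recorded, or it was
-- crowded out by k sources that are themselves within ℓ.
Covered : ℕ → List Entry → ℕ → ℕ → ℕ → Set
Covered k Q x s ℓ = Near Q x s ℓ ⊎ Full k Q x ℓ

full-push : ∀ {k q Q x ℓ} → Full k Q x ℓ → Full k (push k q Q) x ℓ
full-push {k} {q} {Q} {x} (l , h) with push k q Q | push-cases k q Q
... | _ | seen _   = l , h
... | _ | full _ _ = l , h
... | _ | new _ lt with vertex q ≟ x
...   | yes refl = ⊥-elim (<-irrefl refl (<-≤-trans lt l))
...   | no ne    = subst (λ xs → k ≤ length xs) (sym (sel-no (source q) (VS Q) ne)) l , h′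
  where
  h′ : ∀ s d → entry x s d ∈ q ∷ Q → d ≤ _
  h′ s d (here refl) = ⊥-elim (ne refl)
  h′ s d (there e)   = h s d e

covered-push : ∀ {k q Q x s ℓ} → Covered k Q x s ℓ → Covered k (push k q Q) x s ℓ
covered-push {k} {q} (inj₁ (d , d≤ , e)) = inj₁ (d , d≤ , push-⊆ {k} {q} e)
covered-push {k} {q} {Q} (inj₂ f) = inj₂ (full-push {k} {q} {Q} f)

covered-pushes : ∀ {k Q x s ℓ} es → Covered k Q x s ℓ → Covered k (foldr (push k) Q es) x s ℓ
covered-pushes []       c = c
covered-pushes {k} (e ∷ es) c = covered-push {k} {e} (covered-pushes es c)

-- Entries arrive in order of distance. So whatever makes `push` refuse `q`, an older entry of the
-- same source or a full list, is at least as close as `q`.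
pushed-covered : ∀ {k q Q} → (∀ p → p ∈ Q → dist p ≤ dist q) → Covered k (push k q Q) (vertex q) (source q) (dist q)
pushed-covered {k} {q} {Q} h with push k q Q | push-cases k q Q
... | _ | full _ l = inj₂ (l , λ s d e → h _ e)
... | _ | new _ _  = inj₁ (dist q , ≤-refl , here refl)
... | _ | seen m   with ∈-at {Q} (mult-∈ (at (vertex q) Q) m)
...   | d , e = inj₁ (d , h _ e , e)

∈-pushes : ∀ {k Q p} es → p ∈ foldr (push k) Q es → p ∈ es ⊎ p ∈ Q
∈-pushes []       p∈ = inj₂ p∈
∈-pushes {k} (e ∷ es) p∈ with ∈-push {k} {e} p∈
... | inj₁ refl = inj₁ (here refl)
... | inj₂ p∈′ with ∈-pushes {k} es p∈′
...   | inj₁ i = inj₁ (there i)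
...   | inj₂ i = inj₂ i

pushes-covered : ∀ {k Q q} es → q ∈ es → (∀ e → e ∈ es → dist e ≡ dist q) → (∀ p → p ∈ Q → dist p ≤ dist q) →
                 Covered k (foldr (push k) Q es) (vertex q) (source q) (dist q)
pushes-covered {k} {Q} (e ∷ es) (here refl) eq h = pushed-covered {k} {e} bnd
  where
  bnd : ∀ p → p ∈ foldr (push k) Q es → dist p ≤ dist e
  bnd p p∈ with ∈-pushes {k} es p∈
  ... | inj₁ i = ≤-reflexive (eq p (there i))
  ... | inj₂ i = h p i
pushes-covered {k} (e ∷ es) (there q∈) eq h = covered-push {k} {e} (pushes-covered es q∈ (λ e e∈ → eq e (there e∈)) h)

table-pushes : ∀ {k Q} es → Table k Q → Table k (foldr (push k) Q es)
table-pushes []       t = t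
table-pushes (e ∷ es) t = table-push {q = e} (table-pushes es t)

Descending : List Entry → Set
Descending []      = ⊤
Descending (q ∷ Q) = (∀ p → p ∈ Q → dist p ≤ dist q) × Descending Q

descending-ʳ++ : ∀ xs {ys} → Descending (xs ʳ++ ys) → Descending ys
descending-ʳ++ []       d = d
descending-ʳ++ (x ∷ xs) d = proj₂ (descending-ʳ++ xs d)

descending-todo : ∀ q todo done → Descending (todo ʳ++ done) → q ∈ done → ∀ t → t ∈ todo → dist q ≤ dist t
descending-todo q (t ∷ todo) done d q∈ .t (here refl) = proj₁ (descending-ʳ++ todo d) q q∈
descending-todo q (t ∷ todo) done d q∈ u (there u∈)   = descending-todo q todo (t ∷ done) d (there q∈) u u∈

descending-pushes : ∀ {k Q} d es → (∀ e → e ∈ es → dist e ≡ d) → (∀ p → p ∈ Q → dist p ≤ d) → Descending Q →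
                    Descending (foldr (push k) Q es)
descending-pushes d [] eq h desc = desc
descending-pushes {k} {Q} d (e ∷ es) eq h desc
  with descending-pushes {k} {Q} d es (λ e e∈ → eq e (there e∈)) h desc
... | rec with push k e (foldr (push k) Q es) | push-cases k e (foldr (push k) Q es)
...   | _ | seen _   = rec
...   | _ | full _ _ = rec
...   | _ | new _ _  = bnd , rec
  where
  bnd : ∀ p → p ∈ foldr (push k) Q es → dist p ≤ dist e
  bnd p p∈ with ∈-pushes {k} es p∈
  ... | inj₁ i = ≤-reflexive (trans (eq p (there i)) (sym (eq e (here refl))))
  ... | inj₂ i = ≤-trans (h p i) (≤-reflexive (sym (eq e (here refl))))

∷-ʳ++ : ∀ {A : Set} (z : A) xs ys → z ∷ (xs ʳ++ ys) ≡ (xs ++ z ∷ []) ʳ++ ys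
∷-ʳ++ z []       ys = refl
∷-ʳ++ z (x ∷ xs) ys = ∷-ʳ++ z xs (x ∷ ys)

pushes-ʳ++ : ∀ k es todo done → ∃[ ext ] foldr (push k) (todo ʳ++ done) es ≡ (todo ++ ext) ʳ++ done
                                       × (∀ e → e ∈ ext → e ∈ es)
pushes-ʳ++ k [] todo done = [] , cong (_ʳ++ done) (sym (++-identityʳ todo)) , λ e ()
  where open import Data.List.Properties using (++-identityʳ)
pushes-ʳ++ k (e ∷ es) todo done with pushes-ʳ++ k es todo done
... | ext , eq , ext⊆ with push k e (foldr (push k) (todo ʳ++ done) es) | push-cases k e (foldr (push k) (todo ʳ++ done) es)
...   | _ | seen _   = ext , eq , λ e e∈ → there (ext⊆ e e∈)
...   | _ | full _ _ = ext , eq , λ e e∈ → there (ext⊆ e e∈)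
...   | _ | new _ _  = ext ++ e ∷ [] , trans (cong (e ∷_) eq) (trans (∷-ʳ++ e (todo ++ ext) done) (cong (_ʳ++ done) (++-assoc todo ext _))) , sub′
  where
  sub′ : ∀ f → f ∈ ext ++ e ∷ [] → f ∈ e ∷ es
  sub′ f f∈ with ∈-++⁻ ext f∈
  ... | inj₁ i = there (ext⊆ f i)
  ... | inj₂ (here refl) = here refl

pushes-++ : ∀ k es Q → ∃[ ext ] foldr (push k) Q es ≡ ext ++ Q
pushes-++ k [] Q = [] , refl
pushes-++ k (e ∷ es) Q with pushes-++ k es Q
... | ext , eq with push k e (foldr (push k) Q es) | push-cases k e (foldr (push k) Q es)
...   | _ | seen _   = ext , eq
...   | _ | full _ _ = ext , eq
...   | _ | new _ _  = e ∷ ext , cong (e ∷_) eq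

∈-ʳ++ʳ : ∀ {A : Set} {x : A} xs {ys} → x ∈ ys → x ∈ xs ʳ++ ys
∈-ʳ++ʳ []       i = i
∈-ʳ++ʳ (y ∷ xs) i = ∈-ʳ++ʳ xs (there i)

seed : ℕ → Entry
seed w = entry w w 0

-- For k ≥ 1 this removes the repetitions from `W` and loses nothing else, so
-- `map source (seeds k W)` is the list of sources without repetition.
seeds : ℕ → List ℕ → List Entry
seeds k W = foldr (push k) [] (map seed W)

module _ (H : List (ℕ × ℕ)) where

  relax : Entry → List Entry
  relax q = map (λ x → entry x (source q) (suc (dist q))) (sel (vertex q) H)

  -- `desc` and `window` are the monotone queue of breadth-first search. `suffix` says that the
  -- seeds stay in the oldest cells of the queue, where the program later finds the sources without
  -- repetition.
  record Search (W : List ℕ) (k : ℕ) (todo done : List Entry) : Set where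
    Q : List Entry
    Q = todo ʳ++ done
    field
      table   : Table k Q
      desc    : Descending Q
      window  : ∀ p t → p ∈ Q → t ∈ todo → dist p ≤ suc (dist t)
      walk    : ∀ q → q ∈ Q → Walk H (source q) (vertex q) (dist q)
      sourced : ∀ q → q ∈ Q → source q ∈ map source (seeds k W)
      closed  : ∀ q x → q ∈ done → (vertex q , x) ∈ H → Covered k Q x (source q) (suc (dist q))
      start   : ∀ w → w ∈ W → Covered k Q w w 0
      suffix  : ∃[ ext ] Q ≡ ext ++ seeds k W

  search-step : ∀ {W k q todo done} → Search W k (q ∷ todo) done →
    ∃[ todo′ ] foldr (push k) ((q ∷ todo) ʳ++ done) (relax q) ≡ todo′ ʳ++ (q ∷ done) × Search W k todo′ (q ∷ done)
  search-step {W} {k} {q} {todo} {done} S with pushes-ʳ++ k (relax q) todo (q ∷ done)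
  ... | ext , eq , ext⊆ = todo ++ ext , eq , good
    where
    open Search S
    Q′ = foldr (push k) Q (relax q)
    relax-dist : ∀ e → e ∈ relax q → dist e ≡ suc (dist q)
    relax-dist e e∈ with ∈-map⁻ _ e∈
    ... | _ , _ , refl = refl
    q∈Q : q ∈ Q
    q∈Q = ∈-ʳ++ʳ todo (here refl)
    bound : ∀ p → p ∈ Q → dist p ≤ suc (dist q)
    bound p p∈ = window p q p∈ (here refl)
    good : Search W k (todo ++ ext) (q ∷ done)
    good = record
      { table   = conv (Table k) (table-pushes {k} (relax q) table)
      ; desc    = conv Descending (descending-pushes {k} (suc (dist q)) (relax q) relax-dist bound desc)
      ; window  = λ p t p∈ t∈ → win p t (subst (p ∈_) (sym eq) p∈) (∈-++⁻ todo t∈)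
      ; walk    = λ p p∈ → wlk p (∈-pushes {k} (relax q) (subst (p ∈_) (sym eq) p∈))
      ; sourced = λ p p∈ → src p (∈-pushes {k} (relax q) (subst (p ∈_) (sym eq) p∈))
      ; closed  = λ p x p∈ e → conv (λ R → Covered k R x (source p) (suc (dist p))) (cls p x p∈ e)
      ; start   = λ w w∈ → conv (λ R → Covered k R w w 0) (covered-pushes {k} (relax q) (start w w∈))
      ; suffix  = conv (λ R → ∃[ ext ] R ≡ ext ++ seeds k W) suf
      }
      where
      conv : (P : List Entry → Set) → P Q′ → P ((todo ++ ext) ʳ++ (q ∷ done))
      conv P p = subst P eq p
      win : ∀ p t → p ∈ Q′ → t ∈ todo ⊎ t ∈ ext → dist p ≤ suc (dist t)
      win p t p∈ t∈ = ≤-trans (p≤ (∈-pushes {k} (relax q) p∈)) (s≤s (t≥ t∈))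
        where
        p≤ : p ∈ relax q ⊎ p ∈ Q → dist p ≤ suc (dist q)
        p≤ (inj₁ i) = ≤-reflexive (relax-dist p i)
        p≤ (inj₂ i) = bound p i
        t≥ : t ∈ todo ⊎ t ∈ ext → dist q ≤ dist t
        t≥ (inj₁ i) = descending-todo q todo (q ∷ done) desc (here refl) t i
        t≥ (inj₂ i) = ≤-trans (n≤1+n _) (≤-reflexive (sym (relax-dist t (ext⊆ t i))))
      wlk : ∀ p → p ∈ relax q ⊎ p ∈ Q → Walk H (source p) (vertex p) (dist p)
      wlk p (inj₂ i) = walk p i
      wlk p (inj₁ i) with ∈-map⁻ _ i
      ... | x , x∈ , refl = snoc (walk q q∈Q) (∈-sel H x∈)
      src : ∀ p → p ∈ relax q ⊎ p ∈ Q → source p ∈ map source (seeds k W)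
      src p (inj₂ i) = sourced p i
      src p (inj₁ i) with ∈-map⁻ _ i
      ... | x , x∈ , refl = sourced q q∈Q
      cls : ∀ p x → p ∈ q ∷ done → (vertex p , x) ∈ H → Covered k Q′ x (source p) (suc (dist p))
      cls p x (there i) e = covered-pushes {k} (relax q) (closed p x i e)
      cls p x (here refl) e = pushes-covered {k} {Q} (relax q) (∈-map⁺ _ (sel-∈ e)) relax-dist bound
      suf : ∃[ ext ] Q′ ≡ ext ++ seeds k W
      suf with suffix | pushes-++ k (relax q) Q
      ... | e₁ , eq₁ | e₂ , eq₂ = e₂ ++ e₁ , trans eq₂ (trans (cong (e₂ ++_) eq₁) (sym (++-assoc e₂ e₁ _)))

  seed-∈ : ∀ {k W q} → q ∈ seeds k W → vertex q ∈ W × vertex q ≡ source q × dist q ≡ 0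
  seed-∈ {k} {W} q∈ with ∈-pushes {k} (map seed W) q∈
  ... | inj₁ i with ∈-map⁻ seed i
  ...   | w , w∈ , refl = w∈ , refl , refl

  search-start : ∀ W k → ∃[ todo ] seeds k W ≡ todo ʳ++ [] × Search W k todo []
  search-start W k with pushes-ʳ++ k (map seed W) [] []
  ... | ext , eq , ext⊆ = ext , eq , record
    { table   = subst (Table k) eq (table-pushes (map seed W) table-[])
    ; desc    = subst Descending eq (descending-pushes {k} 0 (map seed W) zeros (λ p ()) tt)
    ; window  = λ p t p∈ t∈ → ≤-trans (≤-reflexive (proj₂ (proj₂ (seed-∈ {k} {W} (back p∈))))) z≤n
    ; walk    = λ q q∈ → wlk q (seed-∈ {k} {W} (back q∈))
    ; sourced = λ q q∈ → ∈-map⁺ source (back q∈)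
    ; closed  = λ q x ()
    ; start   = λ w w∈ → subst (λ R → Covered k R w w 0) eq (pushes-covered {k} {[]} {seed w} (map seed W) (∈-map⁺ seed w∈) zeros (λ p ()))
    ; suffix  = [] , sym eq
    }
    where
    back : ∀ {p} → p ∈ ext ʳ++ [] → p ∈ seeds k W
    back {p} = subst (p ∈_) (sym eq)
    zeros : ∀ e → e ∈ map seed W → dist e ≡ 0
    zeros e e∈ with ∈-map⁻ seed e∈
    ... | _ , _ , refl = refl
    wlk : ∀ q → vertex q ∈ W × vertex q ≡ source q × dist q ≡ 0 → Walk H (source q) (vertex q) (dist q)
    wlk (entry v .v .0) (_ , refl , refl) = nil

all-or : ∀ {P : ℕ → Set} {R : Set} xs → (∀ x → x ∈ xs → P x ⊎ R) → (∀ x → x ∈ xs → P x) ⊎ R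
all-or []       h = inj₁ λ x ()
all-or {P} (x ∷ xs) h with h x (here refl) | all-or xs (λ y y∈ → h y (there y∈))
... | inj₂ r | _      = inj₂ r
... | inj₁ p | inj₂ r = inj₂ r
... | inj₁ p | inj₁ f = inj₁ g
  where
  g : ∀ y → y ∈ x ∷ xs → P y
  g y (here refl) = p
  g y (there i)   = f y i

-- If y is full within ℓ then so is a neighbour x within ℓ + 1: either x is
-- full already, or each of the k sources of y has reached x.
full-step : ∀ {k Q y x ℓ} → Table k Q → Full k Q y ℓ →
            (∀ s d → entry y s d ∈ Q → Covered k Q x s (suc d)) → Full k Q x (suc ℓ)
full-step {k} {Q} {y} {x} {ℓ} t (k≤ , h) cov with all-or (at y Q) each
  where
  each : ∀ s → s ∈ at y Q → Near Q x s (suc ℓ) ⊎ Full k Q x (suc ℓ)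
  each s s∈ with ∈-at {Q} s∈
  ... | d , e with cov s d e
  ...   | inj₁ (d′ , d′≤ , e′) = inj₁ (d′ , ≤-trans d′≤ (s≤s (h s d e)) , e′)
  ...   | inj₂ (k≤′ , h′)      = inj₂ (k≤′ , λ s′ d′ e′ → ≤-trans (h′ s′ d′ e′) (s≤s (h s d e)))
... | inj₂ f    = f
... | inj₁ near = ≤-trans k≤ (pigeonhole (at y Q) (at x Q) (distinct-at t y) incl) , close
  where
  incl : ∀ s → s ∈ at y Q → s ∈ at x Q
  incl s s∈ with near s s∈
  ... | d , _ , e = at-∈ e
  close : ∀ s d → entry x s d ∈ Q → d ≤ suc ℓ
  close s d e with d ≤? suc ℓ
  ... | yes le = le
  ... | no ≰   = ⊥-elim (<-irrefl refl (≤-trans (≤-trans (s≤s k≤) more) (length-at t x)))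
    where
    s∉ : ∀ z → z ∈ at y Q → s ≢ z
    s∉ z z∈ refl with near z z∈
    ... | d′ , d′≤ , e′ = ≰ (subst (_≤ suc ℓ) (entry-unique Q (distinct-at t x) e′ e) d′≤)
    incl′ : ∀ z → z ∈ s ∷ at y Q → z ∈ at x Q
    incl′ z (here refl) = at-∈ e
    incl′ z (there i)   = incl z i
    more : suc (length (at y Q)) ≤ length (at x Q)
    more = pigeonhole (s ∷ at y Q) (at x Q) (Distinct-∷ {s} {at y Q} (mult-∉ (at y Q) s∉) (distinct-at t y)) incl′

record Nearest (H : List (ℕ × ℕ)) (W : List ℕ) (k : ℕ) (Q : List Entry) : Set where
  field
    table    : Table k Q
    walk     : ∀ {q} → q ∈ Q → Walk H (source q) (vertex q) (dist q)
    complete : ∀ {s x ℓ} → s ∈ W → Walk H s x ℓ → Covered k Q x s ℓ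
    sourced  : ∀ {q} → q ∈ Q → source q ∈ map source (seeds k W)

  -- In the full case all entries of the list are within ℓ, and `q` is one of them.
  shortest : ∀ {q ℓ} → q ∈ Q → source q ∈ W → Walk H (source q) (vertex q) ℓ → dist q ≤ ℓ
  shortest {q} q∈ s∈ w with complete s∈ w
  ... | inj₁ (d , d≤ , e) = subst (_≤ _) (entry-unique Q (distinct-at table (vertex q)) e q∈) d≤
  ... | inj₂ (_ , h)      = h (source q) (dist q) q∈

search-end : ∀ {H W k done} → Search H W k [] done → Nearest H W k done
search-end {H} {W} {k} {done} S = record
  { table = table ; walk = λ {q} → walk q ; complete = cpl ; sourced = λ {q} → sourced q }
  where
  open Search S
  raise : ∀ {x s d ℓ} → d ≤ ℓ → Covered k done x s d → Covered k done x s ℓ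
  raise d≤ (inj₁ (d′ , d′≤ , e)) = inj₁ (d′ , ≤-trans d′≤ d≤ , e)
  raise d≤ (inj₂ (l , h))        = inj₂ (l , λ s d e → ≤-trans (h s d e) d≤)
  -- Induction on the walk: a recorded source is passed on when its entry is processed, and fullness
  -- is passed on by `full-step`.
  cpl : ∀ {s x ℓ} → s ∈ W → Walk H s x ℓ → Covered k done x s ℓ
  cpl s∈ nil = start _ s∈
  cpl {x = x} s∈ (snoc w e) with cpl s∈ w
  ... | inj₁ (d , d≤ , q∈) = raise (s≤s d≤) (closed _ x q∈ e)
  ... | inj₂ f = inj₂ (full-step table f λ s d q∈ → closed _ x q∈ e)

seeds-⊆ : ∀ k W {s} → s ∈ map source (seeds k W) → s ∈ W
seeds-⊆ k W s∈ with ∈-map⁻ source s∈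
... | q , q∈ , refl with seed-∈ [] {k} {W} q∈
...   | v∈ , eq , _ = subst (_∈ W) eq v∈

pushes-length : ∀ k es Q → length (foldr (push k) Q es) ≤ length es + length Q
pushes-length k [] Q = ≤-refl
pushes-length k (e ∷ es) Q with push k e (foldr (push k) Q es) | push-cases k e (foldr (push k) Q es)
... | _ | seen _   = m≤n⇒m≤1+n (pushes-length k es Q)
... | _ | full _ _ = m≤n⇒m≤1+n (pushes-length k es Q)
... | _ | new _ _  = s≤s (pushes-length k es Q)

seeds-length : ∀ k W → length (map source (seeds k W)) ≤ length W
seeds-length k W = subst₂ _≤_ (sym (length-map source (seeds k W)))
  (trans (+-identityʳ _) (length-map seed W)) (pushes-length k (map seed W) [])

seeds-distinct : ∀ k W → Distinct (map source (seeds k W))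
seeds-distinct k W z = subst (_≤ 1) (go (seeds k W) (λ q q∈ → proj₁ (proj₂ (seed-∈ [] {k} {W} q∈))))
                         (distinct-at (table-pushes {k} (map seed W) table-[]) z z)
  where
  go : ∀ Q → (∀ q → q ∈ Q → vertex q ≡ source q) → mult z (at z Q) ≡ mult z (map source Q)
  go []      h = refl
  go (q ∷ Q) h with vertex q ≟ z
  ... | yes refl = trans (cong (mult z) (sel-yes z (source q) (VS Q))) (cong (same z (source q) +_) (go Q λ p p∈ → h p (there p∈)))
  ... | no ne    = trans (cong (mult z) (sel-no (source q) (VS Q) ne))
                     (trans (go Q λ p p∈ → h p (there p∈))
                       (sym (cong (_+ mult z (map source Q)) (same-≢ λ e → ne (trans (h q (here refl)) (sym e))))))

-- The preprocessing program.  Names in # are registers, names in $ arrays.  The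
-- search with tag r starts from the list with key r; tags 3, 4, … are the rounds
-- that build A₁, and A₁ and A₂ are the lists 0 and 1.  Since memory is initially
-- zero, a fresh tag gives fresh tables.

#tail #n #K #k #r #out #end #head #x #s #d #v #j #i #θ #c #src : ℕ
#tail = 0
#n    = 2
#K    = 3
#k    = 4
#r    = 5
#out  = 6
#end  = 7
#head = 8
#x    = 9
#s    = 10
#d    = 11
#v    = 12
#j    = 13
#i    = 14
#θ    = 15
#c    = 16
#src  = 17

$in $D $deg $adj $len $lst $cnt $inv $seen $size $hit $qv $qs $qd : ℕ
$in   = 0
$D    = 1
$deg  = 2
$adj  = 3
$len  = 4
$lst  = 5
$cnt  = 6
$inv  = 7
$seen = 8
$size = 9
$hit  = 10
$qv   = 11
$qs   = 12
$qd   = 13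

rowPush : ℕ → ℕ → Expr → Expr → Program
rowPush c d key val =
  setCell d (pairE key (cell c key)) val ∷
  setCell c key (cell c key ⟪ add ⟫ const 1) ∷ []

increment : ℕ → Cmd
increment x = setReg x (reg x ⟪ add ⟫ const 1)

pushP : Program
pushP =
  ite (cell $seen (pairE (pairE (reg #r) (reg #x)) (reg #s))) []
    (ite (cell $size (pairE (reg #r) (reg #x)) ⟪ less ⟫ reg #k)
      (setCell $seen (pairE (pairE (reg #r) (reg #x)) (reg #s)) (const 1) ∷
       setCell $size (pairE (reg #r) (reg #x)) (cell $size (pairE (reg #r) (reg #x)) ⟪ add ⟫ const 1) ∷
       rowPush $cnt $inv (pairE (reg #r) (reg #s)) (reg #x) ++
       setCell $qv (reg #end) (reg #x) ∷
       setCell $qs (reg #end) (reg #s) ∷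
       setCell $qd (reg #end) (reg #d) ∷
       increment #end ∷ [])
      [] ∷ []) ∷ []

-- The variables of the search with tag r: the queue is Q.

record Tagged (σ : Store) (r : ℕ) (Q : List Entry) : Set where
  field
    seen≡ : ∀ x s → arrays σ $seen (pair (pair r x) s) ≡ mult s (at x Q)
    size≡ : ∀ x → arrays σ $size (pair r x) ≡ length (at x Q)
    inv≡  : ∀ s → Row (arrays σ $cnt) (arrays σ $inv) (pair r s) (sel s (SV Q))
open Tagged public

record Queue (σ : Store) (Q : List Entry) : Set where
  field
    end≡ : regs σ #end ≡ length Q
    qv≡  : Stored (arrays σ $qv) (map vertex Q)
    qs≡  : Stored (arrays σ $qs) (map source Q)
    qd≡  : Stored (arrays σ $qd) (map dist Q)
open Queue public

-- `F` is the set of tags reserved for later searches, whose tables must still be empty.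
record Searching (F : ℕ → Set) (σ : Store) (r : ℕ) (Q : List Entry) : Set where
  field
    tagged : Tagged σ r Q
    others : ∀ r′ → F r′ → r′ ≢ r → Tagged σ r′ []
    queue  : Queue σ Q
open Searching public

module _ {σ τ : Store} (e : arrays τ ≡ arrays σ) where

  tagged-regs : ∀ {r Q} → Tagged σ r Q → Tagged τ r Q
  tagged-regs {r} {Q} t = record
    { seen≡ = λ x s → trans (cong (λ f → f $seen (pair (pair r x) s)) e) (seen≡ t x s)
    ; size≡ = λ x → trans (cong (λ f → f $size (pair r x)) e) (size≡ t x)
    ; inv≡  = λ s → row-cong (cong (λ f → f $cnt) e) (cong (λ f → f $inv) e) (inv≡ t s) }

  searching-regs : ∀ {F r Q} → regs τ #end ≡ regs σ #end → Searching F σ r Q → Searching F τ r Q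
  searching-regs {F} {r} {Q} e′ S = record
    { tagged = tagged-regs (tagged S)
    ; others = λ r′ f ne → tagged-regs (others S r′ f ne)
    ; queue  = record
      { end≡ = trans e′ (end≡ (queue S))
      ; qv≡  = subst (λ f → Stored (f $qv) _) (sym e) (qv≡ (queue S))
      ; qs≡  = subst (λ f → Stored (f $qs) _) (sym e) (qs≡ (queue S))
      ; qd≡  = subst (λ f → Stored (f $qd) _) (sym e) (qd≡ (queue S)) } }

module PushStep (σ : Store) where

  r = regs σ #r
  x₀ = regs σ #x
  s₀ = regs σ #s
  d₀ = regs σ #d
  k = regs σ #k
  q = entry x₀ s₀ d₀

  seen′ = arrays σ $seen [ pair (pair r x₀) s₀ ↦ 1 ]
  size′ = arrays σ $size [ pair r x₀ ↦ arrays σ $size (pair r x₀) + 1 ]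
  cnt′ = arrays σ $cnt [ pair r s₀ ↦ arrays σ $cnt (pair r s₀) + 1 ]
  inv′ = arrays σ $inv [ pair (pair r s₀) (arrays σ $cnt (pair r s₀)) ↦ x₀ ]

  τ : Store
  τ = setR (setA (setA (setA (setA (setA (setA (setA σ
        $seen (pair (pair r x₀) s₀) 1)
        $size (pair r x₀) (arrays σ $size (pair r x₀) + 1))
        $inv (pair (pair r s₀) (arrays σ $cnt (pair r s₀))) x₀)
        $cnt (pair r s₀) (arrays σ $cnt (pair r s₀) + 1))
        $qv (regs σ #end) x₀) $qs (regs σ #end) s₀) $qd (regs σ #end) d₀)
        #end (regs σ #end + 1)

  module _ {Q : List Entry} (fresh : mult s₀ (at x₀ Q) ≡ 0) (t : Tagged σ r Q) where

    seen-new : ∀ x s → seen′ (pair (pair r x) s) ≡ mult s (at x (q ∷ Q))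
    seen-new x s with x₀ ≟ x
    ... | no ne = trans (upd-other (arrays σ $seen) {pair (pair r x₀) s₀} {pair (pair r x) s} 1 (pair-≢ˡ {pair r x₀} {s₀} {pair r x} {s} (pair-≢ʳ {r} {x₀} {r} {x} ne)))
                    (trans (seen≡ t x s) (sym (cong (mult s) (sel-no s₀ (VS Q) ne))))
    ... | yes refl with s₀ ≟ s
    ...   | no ne = trans (upd-other (arrays σ $seen) {pair (pair r x₀) s₀} {pair (pair r x) s} 1 (pair-≢ʳ {pair r x₀} {s₀} {pair r x} {s} ne))
                    (trans (seen≡ t x s) (sym (trans (cong (mult s) (sel-yes x₀ s₀ (VS Q))) (cong (_+ mult s (at x₀ Q)) (same-≢ λ e → ne (sym e))))))
    ...   | yes refl = trans (upd-same (arrays σ $seen) (pair (pair r x₀) s₀) 1)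
                    (sym (trans (cong (mult s) (sel-yes x₀ s₀ (VS Q))) (cong₂ _+_ (same-refl s₀) fresh)))

    size-new : ∀ x → size′ (pair r x) ≡ length (at x (q ∷ Q))
    size-new x with x₀ ≟ x
    ... | no ne = trans (upd-other (arrays σ $size) {pair r x₀} {pair r x} _ (pair-≢ʳ {r} {x₀} {r} {x} ne))
                    (trans (size≡ t x) (sym (cong length (sel-no s₀ (VS Q) ne))))
    ... | yes refl = trans (upd-same (arrays σ $size) (pair r x₀) _)
                    (trans (cong (_+ 1) (size≡ t x₀)) (trans (+-comm _ 1) (sym (cong length (sel-yes x₀ s₀ (VS Q))))))

    inv-new : ∀ s → Row cnt′ inv′ (pair r s) (sel s (SV (q ∷ Q)))
    inv-new s with s₀ ≟ s
    ... | no ne = subst (Row cnt′ inv′ (pair r s)) (sym (sel-no x₀ (SV Q) ne))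
                    (row-other {arrays σ $cnt} {arrays σ $inv} (pair r s₀) x₀ (pair-≢ʳ {r} {s₀} {r} {s} ne) (inv≡ t s))
    ... | yes refl = subst (Row cnt′ inv′ (pair r s)) (sym (sel-yes s₀ x₀ (SV Q)))
                    (row-push {arrays σ $cnt} {arrays σ $inv} (pair r s₀) x₀ (inv≡ t s₀))

    tagged-new : Tagged τ r (q ∷ Q)
    tagged-new = record { seen≡ = seen-new ; size≡ = size-new ; inv≡ = inv-new }

  tagged-other : ∀ {r′ Q} → r′ ≢ r → Tagged σ r′ Q → Tagged τ r′ Q
  tagged-other {r′} ne t = record
    { seen≡ = λ x s → trans (upd-other (arrays σ $seen) {pair (pair r x₀) s₀} {pair (pair r′ x) s} 1
                (pair-≢ˡ {pair r x₀} {s₀} {pair r′ x} {s} (pair-≢ˡ {r} {x₀} {r′} {x} ne′))) (seen≡ t x s)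
    ; size≡ = λ x → trans (upd-other (arrays σ $size) {pair r x₀} {pair r′ x} _ (pair-≢ˡ {r} {x₀} {r′} {x} ne′)) (size≡ t x)
    ; inv≡  = λ s → row-other {arrays σ $cnt} {arrays σ $inv} (pair r s₀) x₀ (pair-≢ˡ {r} {s₀} {r′} {s} ne′) (inv≡ t s) }
    where
    ne′ : r ≢ r′
    ne′ e = ne (sym e)

  queue-new : ∀ {Q} → Queue σ Q → Queue τ (q ∷ Q)
  queue-new {Q} u = record
    { end≡ = trans (cong (_+ 1) (end≡ u)) (+-comm _ 1)
    ; qv≡  = stored-push (regs σ #end) x₀ (map vertex Q) (trans (end≡ u) (sym (length-map vertex Q))) (qv≡ u)
    ; qs≡  = stored-push (regs σ #end) s₀ (map source Q) (trans (end≡ u) (sym (length-map source Q))) (qs≡ u)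
    ; qd≡  = stored-push (regs σ #end) d₀ (map dist Q) (trans (end≡ u) (sym (length-map dist Q))) (qd≡ u) }

  ex-push : ∀ {F Q} → Searching F σ r Q → Ex pushP σ 12 (λ τ → Searching F τ r (push k q Q))
  ex-push {F} {Q} S with push k q Q | push-cases k q Q
  ... | _ | seen m = ex-weaken (m≤m+n 1 11) (λ _ z → z)
        (ex-ite₁ {P = λ ρ → ρ ≡ σ} (λ e → m (trans (sym (seen≡ (tagged S) x₀ s₀)) e)) (ex-halt {T = 0} refl) λ { ρ refl → ex-halt {T = 0} S })
  ... | _ | full m l = ex-weaken (m≤m+n 2 10) (λ _ z → z)
        (ex-ite₀ {P = λ ρ → ρ ≡ σ} (trans (seen≡ (tagged S) x₀ s₀) m)
          (ex-ite₀ {P = λ ρ → ρ ≡ σ} (less-false (≤-trans l (≤-reflexive (sym (size≡ (tagged S) x₀))))) (ex-halt {T = 0} refl) λ { ρ refl → ex-halt {T = 0} refl })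
          λ { ρ refl → ex-halt {T = 0} S })
  ... | _ | new m lt = ex-weaken (m≤m+n 10 2) (λ _ z → z)
        (ex-ite₀ {P = λ ρ → ρ ≡ τ} (trans (seen≡ (tagged S) x₀ s₀) m)
          (ex-ite₁ {P = λ ρ → ρ ≡ τ} (less-true (≤-trans (s≤s (≤-reflexive (size≡ (tagged S) x₀))) lt))
            (ex-setA (ex-setA (ex-setA (ex-setA (ex-setA (ex-setA (ex-setA (ex-setR (ex-halt {T = 0} refl)))))))))
            λ { ρ refl → ex-halt {T = 0} refl })
          λ { ρ refl → ex-halt {T = 0} (record
            { tagged = tagged-new m (tagged S)
            ; others = λ r′ f ne → tagged-other ne (others S r′ f ne)
            ; queue  = queue-new (queue S) }) })

ex-push′ : ∀ σ {F Q r k x s d} → regs σ #r ≡ r → regs σ #k ≡ k → regs σ #x ≡ x → regs σ #s ≡ s → regs σ #d ≡ d →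
           Searching F σ r Q → Ex pushP σ 12 (λ τ → Searching F τ r (push k (entry x s d) Q))
ex-push′ σ refl refl refl refl refl S = PushStep.ex-push σ S

-- The search program and its running time.

seedBody relaxBody searchBody nearP : Program
seedBody =
  setReg #x (cell $lst (pairE (reg #r) (reg #i))) ∷
  setReg #s (reg #x) ∷
  setReg #d (const 0) ∷
  pushP ++ increment #i ∷ []
relaxBody =
  setReg #x (cell $adj (pairE (reg #v) (reg #j))) ∷
  pushP ++ increment #j ∷ []
searchBody =
  setReg #v (cell $qv (reg #head)) ∷
  setReg #s (cell $qs (reg #head)) ∷
  setReg #d (cell $qd (reg #head) ⟪ add ⟫ const 1) ∷
  setReg #j (const 0) ∷
  loop #j (cell $deg (reg #v)) relaxBody ++ increment #head ∷ []
nearP =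
  setReg #end (const 0) ∷
  setReg #i (const 0) ∷
  setReg #head (const 0) ∷
  loop #i (cell $len (reg #r)) seedBody ++
  setReg #src (reg #end) ∷
  loop #head (reg #end) searchBody

Adjacency : Store → List (ℕ × ℕ) → Set
Adjacency σ H = ∀ v → Row (arrays σ $deg) (arrays σ $adj) v (sel v H)

Symmetric : List (ℕ × ℕ) → Set
Symmetric H = ∀ {a b} → (a , b) ∈ H → (b , a) ∈ H

module _ (H : List (ℕ × ℕ)) where

  degree : ℕ → ℕ
  degree v = length (sel v H)

  -- No vertex enters the queue more than k times, so each half-edge is scanned at most k times.
  degrees≤ : ∀ {k} Q → Table k Q → Sum (λ q → degree (vertex q)) Q ≤ length H * k
  degrees≤ {k} Q t = begin
    Sum (λ q → degree (vertex q)) Q                       ≡⟨ Sum-map degree vertex Q ⟨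
    Sum degree (map vertex Q)                             ≡⟨ double-count-length (map vertex Q) H ⟩
    Sum (λ p → mult (proj₁ p) (map vertex Q)) H           ≤⟨ Sum-≤-const k H (λ p _ → m≤k (proj₁ p)) ⟩
    length H * k                                          ∎
    where
    open ≤-Reasoning
    len : ∀ v Q → mult v (map vertex Q) ≡ length (at v Q)
    len v []      = refl
    len v (q ∷ Q) with vertex q ≟ v
    ... | yes refl = trans (cong₂ _+_ (same-refl v) (len v Q)) (sym (cong length (sel-yes v (source q) (VS Q))))
    ... | no ne    = trans (cong₂ _+_ (same-≢ λ e → ne (sym e)) (len v Q)) (sym (cong length (sel-no (source q) (VS Q) ne)))
    m≤k : ∀ v → mult v (map vertex Q) ≤ k
    m≤k v = subst (_≤ k) (sym (len v Q)) (length-at t v)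

  size≤ : ∀ {k} Q xs → Table k Q → (∀ q → q ∈ Q → vertex q ∈ xs) → length Q ≤ length xs * k
  size≤ {k} Q xs t h = begin
    length Q                                   ≡⟨ Sum-1 Q ⟨
    Sum (λ _ → 1) Q                            ≤⟨ Sum-mono Q (λ q q∈ → ∈-mult (h q q∈)) ⟩
    Sum (λ q → mult (vertex q) xs) Q           ≡⟨ Sum-map (λ p → mult (proj₁ p) xs) vs Q ⟨
    Sum (λ p → mult (proj₁ p) xs) (VS Q)       ≡⟨ double-count-length xs (VS Q) ⟨
    Sum (λ x → length (at x Q)) xs             ≤⟨ Sum-≤-const k xs (λ x _ → length-at t x) ⟩
    length xs * k                              ∎
    where open ≤-Reasoning

  searchCost : Entry → ℕ
  searchCost q = 7 + degree (vertex q) * 15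

  -- The entries themselves are also charged to half-edges, 7 on top of 15, which works because no
  -- isolated vertex occurs in the queue. A charge of n k would exceed the time bound for graphs
  -- with few edges.
  searchCost≤ : ∀ {k} Q → Table k Q → (∀ q → q ∈ Q → vertex q ∈ map proj₁ H) → Sum searchCost Q ≤ 22 * (length H * k)
  searchCost≤ {k} Q t h = begin
    Sum searchCost Q                                                     ≡⟨ Sum-+ (λ _ → 7) (λ q → degree (vertex q) * 15) Q ⟩
    Sum (λ _ → 7) Q + Sum (λ q → degree (vertex q) * 15) Q               ≡⟨ cong₂ _+_ (Sum-const 7 Q) (trans (Sum-cong Q λ q → *-comm (degree (vertex q)) 15) (Sum-*ˡ 15 _ Q)) ⟩
    length Q * 7 + 15 * Sum (λ q → degree (vertex q)) Q                  ≤⟨ +-mono-≤ (*-monoˡ-≤ 7 (size≤ Q (map proj₁ H) t h)) (*-monoʳ-≤ 15 (degrees≤ Q t)) ⟩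
    length (map proj₁ H) * k * 7 + 15 * (length H * k)                   ≡⟨ cong (λ l → l * k * 7 + 15 * (length H * k)) (length-map proj₁ H) ⟩
    length H * k * 7 + 15 * (length H * k)                               ≡⟨ lem (length H * k) ⟩
    22 * (length H * k)                                                  ∎
    where
    open ≤-Reasoning
    lem : ∀ a → a * 7 + 15 * a ≡ 22 * a
    lem = solve-∀

  walk-end : Symmetric H → ∀ {s x ℓ} → s ∈ map proj₁ H → Walk H s x ℓ → x ∈ map proj₁ H
  walk-end sm s∈ nil = s∈
  walk-end sm s∈ (snoc w e) = ∈-map⁺ proj₁ (sm e)

stored-map-at : ∀ {A : Set} {f} (g : A → ℕ) todo q done → Stored f (map g (todo ʳ++ (q ∷ done))) → f (length done) ≡ g q
stored-map-at {f = f} g todo q done st =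
  trans (cong f (sym (length-map g done)))
    (stored-at (map g todo) (g q) (map g done) (subst (Stored f) (map-ʳ++ g todo) st))
  where open import Data.List.Properties using (map-ʳ++)

module NearSpec (H : List (ℕ × ℕ)) (sm : Symmetric H) (W : List ℕ) (W⊆ : ∀ w → w ∈ W → w ∈ map proj₁ H)
                (k r : ℕ) (F : ℕ → Set) where

  seed-step : ∀ w todo done σ → regs σ #r ≡ r → regs σ #k ≡ k →
    Row (arrays σ $len) (arrays σ $lst) r W → (w ∷ todo) ʳ++ done ≡ W → regs σ #i ≡ length done →
    Searching F σ r (seeds k done) →
    Ex seedBody σ 16 (λ τ → regs τ #i ≡ suc (length done) × Searching F τ r (seeds k (w ∷ done)))
  seed-step w todo done σ refl refl (_ , st) refl i≡ S =
    ex-setR (ex-setR (ex-setR (ex-++ {p = pushP}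
      (ex-frame (ex-push′ σ′ {x = w} {w} {0} refl refl x≡ x≡ refl (searching-regs {σ} {σ′} refl refl S)))
      λ τ (S′ , fr) → ex-setR (ex-halt {T = 0}
        (trans (cong (_+ 1) (trans (reg≡ fr #i refl) i≡)) (+-comm _ 1) , searching-regs {τ} refl refl S′)))))
    where
    σ′ = setR (setR (setR σ #x (arrays σ $lst (pair r (regs σ #i)))) #s (arrays σ $lst (pair r (regs σ #i)))) #d 0
    x≡ : arrays σ $lst (pair r (regs σ #i)) ≡ w
    x≡ = trans (cong (λ l → arrays σ $lst (pair r l)) i≡) (stored-at todo w done st)

  relax-step : ∀ q xs x todo done σ Q → regs σ #r ≡ r → regs σ #k ≡ k → regs σ #v ≡ vertex q → regs σ #s ≡ source q →
    regs σ #d ≡ suc (dist q) → Row (arrays σ $deg) (arrays σ $adj) (vertex q) xs → (x ∷ todo) ʳ++ done ≡ xs →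
    regs σ #j ≡ length done → Searching F σ r (foldr (push k) Q (map (λ x → entry x (source q) (suc (dist q))) done)) →
    Ex relaxBody σ 14 (λ τ → regs τ #j ≡ suc (length done) ×
      Searching F τ r (foldr (push k) Q (map (λ x → entry x (source q) (suc (dist q))) (x ∷ done))))
  relax-step q xs x todo done σ Q refl refl refl refl d≡ (_ , st) refl j≡ S =
    ex-setR (ex-++ {p = pushP} (ex-frame (ex-push′ σ′ {x = x} refl refl x≡ refl d≡ (searching-regs {σ} {σ′} refl refl S)))
      λ τ (S′ , fr) → ex-setR (ex-halt {T = 0}
        (trans (cong (_+ 1) (trans (reg≡ fr #j refl) j≡)) (+-comm _ 1) , searching-regs {τ} refl refl S′)))
    where
    σ′ = setR σ #x (arrays σ $adj (pair (regs σ #v) (regs σ #j)))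
    x≡ : arrays σ $adj (pair (regs σ #v) (regs σ #j)) ≡ x
    x≡ = trans (cong (λ l → arrays σ $adj (pair (regs σ #v) l)) j≡) (stored-at todo x done st)

  search-body : ∀ q todo done σ → regs σ #r ≡ r → regs σ #k ≡ k → Adjacency σ H → regs σ #head ≡ length done →
    Searching F σ r ((q ∷ todo) ʳ++ done) →
    Ex searchBody σ (6 + degree H (vertex q) * 15) (λ τ → regs τ #head ≡ suc (length done) ×
      Searching F τ r (foldr (push k) ((q ∷ todo) ʳ++ done) (relax H q)))
  search-body q todo done σ r≡ k≡ adj h≡ S = ex-weaken time (λ _ z → z)
    (ex-setR (ex-setR (ex-setR (ex-setR (ex-++ {p = loop #j (cell $deg (reg #v)) relaxBody}
      (ex-frame (ex-loop #j (cell $deg (reg #v)) relaxBody (sel (vertex q) H) I (λ _ → 14) σ′ len body refl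
        (searching-regs {σ} {σ′} refl refl S)))
      λ τ (S′ , fr) → ex-setR (ex-halt {T = 0}
        (trans (cong (_+ 1) (trans (reg≡ fr #head refl) h≡)) (+-comm _ 1) , searching-regs {τ} refl refl S′)))))))
    where
    Q = (q ∷ todo) ʳ++ done
    h = regs σ #head
    σ′ = setR (setR (setR (setR σ #v (arrays σ $qv h)) #s (arrays σ $qs h)) #d (arrays σ $qd h + 1)) #j 0
    I : List ℕ → Store → Set
    I xs τ = Searching F τ r (foldr (push k) Q (map (λ x → entry x (source q) (suc (dist q))) xs))
    v≡ : regs σ′ #v ≡ vertex q
    v≡ = trans (cong (arrays σ $qv) h≡) (stored-map-at vertex todo q done (qv≡ (queue S)))
    s≡ : regs σ′ #s ≡ source q
    s≡ = trans (cong (arrays σ $qs) h≡) (stored-map-at source todo q done (qs≡ (queue S)))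
    d≡ : regs σ′ #d ≡ suc (dist q)
    d≡ = trans (cong (_+ 1) (trans (cong (arrays σ $qd) h≡) (stored-map-at dist todo q done (qd≡ (queue S))))) (+-comm _ 1)
    row : ∀ τ → Frame relaxBody σ′ τ → Row (arrays τ $deg) (arrays τ $adj) (vertex q) (sel (vertex q) H)
    row τ fr = row-cong (arr≡ fr $deg refl) (arr≡ fr $adj refl) (adj (vertex q))
    len : ∀ xs τ → Frame relaxBody σ′ τ → I xs τ → arrays τ $deg (regs τ #v) ≡ length (sel (vertex q) H)
    len xs τ fr i = trans (cong (arrays τ $deg) (trans (reg≡ fr #v refl) v≡)) (proj₁ (row τ fr))
    body : ∀ x todo done τ → (x ∷ todo) ʳ++ done ≡ sel (vertex q) H → Frame relaxBody σ′ τ → regs τ #j ≡ length done →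
           I done τ → Ex relaxBody τ 14 (λ υ → regs υ #j ≡ suc (length done) × I (x ∷ done) υ)
    body x todo′ done′ τ eq fr j≡ i = relax-step q (sel (vertex q) H) x todo′ done′ τ Q
      (trans (reg≡ fr #r refl) r≡) (trans (reg≡ fr #k refl) k≡) (trans (reg≡ fr #v refl) v≡) (trans (reg≡ fr #s refl) s≡)
      (trans (reg≡ fr #d refl) d≡) (row τ fr) eq j≡ i
    time : 4 + (suc (Sum (λ _ → 15) (sel (vertex q) H)) + 1) ≤ 6 + degree H (vertex q) * 15
    time = ≤-reflexive (trans (cong (λ t → 4 + (suc t + 1)) (Sum-const 15 (sel (vertex q) H))) (cong (5 +_) (+-comm _ 1)))

  budget : ℕ
  budget = 22 * (length H * k)

  spent≤ : ∀ {todo done} → Search H W k todo done → Sum (searchCost H) (todo ʳ++ done) ≤ budget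
  spent≤ S = searchCost≤ H _ table λ q q∈ → walk-end H sm (W⊆ _ (seeds-⊆ k W (sourced q q∈))) (walk q q∈)
    where open Search S

  Found : Store → Set
  Found τ = ∃[ Q ] Search H W k [] Q × Searching F τ r Q

  -- The queue grows while it is scanned, so the time is not a sum over a list known in advance.
  -- Instead `rest` is what is left of a budget that at every moment pays for all entries of the
  -- current queue. The recursion is structural in `fuel`, since each entry consumes part of the
  -- budget.
  search-loop : ∀ fuel rest todo done σ₀ σ → Sum (searchCost H) done + rest ≡ budget → rest ≤ fuel →
    regs σ₀ #r ≡ r → regs σ₀ #k ≡ k → Adjacency σ₀ H → Frame searchBody σ₀ σ →
    regs σ #head ≡ length done → Searching F σ r (todo ʳ++ done) → Search H W k todo done →
    Ex (loop #head (reg #end) searchBody) σ (suc rest) Found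
  search-loop fuel rest [] done σ₀ σ b≡ rest≤ r≡ k≡ adj fr h≡ S M =
    ex-exit (less-false (≤-reflexive (trans (end≡ (queue S)) (sym h≡)))) (done , M , S)
  search-loop fuel rest (q ∷ todo) done σ₀ σ b≡ rest≤ r≡ k≡ adj fr h≡ S M = go fuel rest≤
    where
    fits-rest : searchCost H q ≤ rest
    fits-rest = +-cancelˡ-≤ (Sum (searchCost H) done) _ _ (begin
      Sum (searchCost H) done + searchCost H q                            ≡⟨ +-comm _ (searchCost H q) ⟩
      Sum (searchCost H) (q ∷ done)                                       ≤⟨ m≤n+m _ (Sum (searchCost H) todo) ⟩
      Sum (searchCost H) todo + Sum (searchCost H) (q ∷ done)             ≡⟨ Sum-ʳ++ (searchCost H) todo (q ∷ done) ⟨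
      Sum (searchCost H) ((q ∷ todo) ʳ++ done)                            ≤⟨ spent≤ M ⟩
      budget                                                              ≡⟨ b≡ ⟨
      Sum (searchCost H) done + rest                                      ∎)
      where open ≤-Reasoning
    rest′ = rest ∸ searchCost H q
    rest≡ : searchCost H q + rest′ ≡ rest
    rest≡ = m+[n∸m]≡n fits-rest
    b≡′ : Sum (searchCost H) (q ∷ done) + rest′ ≡ budget
    b≡′ = trans (trans (cong (_+ rest′) (+-comm (searchCost H q) _)) (trans (+-assoc (Sum (searchCost H) done) _ _) (cong (Sum (searchCost H) done +_) rest≡))) b≡
    lt : length done < length ((q ∷ todo) ʳ++ done)
    lt = subst (length done <_) (sym (length-ʳ++ todo)) (m≤n+m _ (length todo))
    adj′ : Adjacency σ H
    adj′ v = row-cong (arr≡ fr $deg refl) (arr≡ fr $adj refl) (adj v)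
    go : ∀ fuel → rest ≤ fuel → Ex (loop #head (reg #end) searchBody) σ (suc rest) Found
    go zero rest≤ = ⊥-elim (<-irrefl refl (≤-trans (≤-trans (s≤s z≤n) fits-rest) rest≤))
    go (suc fuel) rest≤ = ex-weaken (≤-reflexive (cong suc (trans (+-suc _ rest′) rest≡))) (λ _ z → z)
      (ex-again (less-true (subst₂ _<_ (sym h≡) (sym (end≡ (queue S))) lt))
        (ex-frame (search-body q todo done σ (trans (reg≡ fr #r refl) r≡) (trans (reg≡ fr #k refl) k≡) adj′ h≡ S))
        next-round)
      where
      next-round : ∀ τ → (regs τ #head ≡ suc (length done) × Searching F τ r (foldr (push k) ((q ∷ todo) ʳ++ done) (relax H q))) × Frame searchBody σ τ →
                   Ex (loop #head (reg #end) searchBody) τ (suc rest′) Found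
      next-round τ ((h≡′ , S′) , fr′) with search-step H M
      ... | todo′ , eq , M′ = search-loop fuel rest′ todo′ (q ∷ done) σ₀ τ b≡′ rest′≤ r≡ k≡ adj (frame-trans fr fr′) h≡′
                                (subst (Searching F τ r) eq S′) M′
        where
        rest′≤ : rest′ ≤ fuel
        rest′≤ = ≤-pred (≤-trans (≤-trans (s≤s (m≤n+m rest′ (6 + degree H (vertex q) * 15))) (≤-reflexive rest≡)) rest≤)

  record Near-post (τ : Store) : Set where
    field
      Q         : List Entry
      nearest   : Nearest H W k Q
      searching : Searching F τ r Q
      src≡      : regs τ #src ≡ length (map source (seeds k W))
      sources   : Stored (arrays τ $qs) (map source (seeds k W))

  ex-near : ∀ σ → regs σ #r ≡ r → regs σ #k ≡ k → Adjacency σ H → Row (arrays σ $len) (arrays σ $lst) r W →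
            Tagged σ r [] → (∀ r′ → F r′ → r′ ≢ r → Tagged σ r′ []) →
            Ex nearP σ (6 + length W * 17 + budget) Near-post
  ex-near σ r≡ k≡ adj row t others = ex-weaken time (λ _ z → z)
    (ex-setR (ex-setR (ex-setR (ex-++ {p = loop #i (cell $len (reg #r)) seedBody}
      (ex-frame (ex-loop #i (cell $len (reg #r)) seedBody W (λ done τ → Searching F τ r (seeds k done)) (λ _ → 16) σ′ len body refl start₀))
      after-seeds))))
    where
    σ′ = setR (setR (setR σ #end 0) #i 0) #head 0
    start₀ : Searching F σ′ r []
    start₀ = record { tagged = tagged-regs refl t ; others = λ r′ f ne → tagged-regs refl (others r′ f ne)
                    ; queue = record { end≡ = refl ; qv≡ = tt ; qs≡ = tt ; qd≡ = tt } }
    row′ : ∀ {τ} → Frame seedBody σ′ τ → Row (arrays τ $len) (arrays τ $lst) r W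
    row′ fr = row-cong (arr≡ fr $len refl) (arr≡ fr $lst refl) row
    len : ∀ done τ → Frame seedBody σ′ τ → Searching F τ r (seeds k done) → arrays τ $len (regs τ #r) ≡ length W
    len done τ fr _ = trans (cong (arrays τ $len) (trans (reg≡ fr #r refl) r≡)) (proj₁ (row′ fr))
    body : ∀ x todo done τ → (x ∷ todo) ʳ++ done ≡ W → Frame seedBody σ′ τ → regs τ #i ≡ length done →
           Searching F τ r (seeds k done) → Ex seedBody τ 16 (λ υ → regs υ #i ≡ suc (length done) × Searching F υ r (seeds k (x ∷ done)))
    body x todo done τ eq fr i≡ S = seed-step x todo done τ (trans (reg≡ fr #r refl) r≡) (trans (reg≡ fr #k refl) k≡) (row′ fr) eq i≡ S
    p₁ = loop #i (cell $len (reg #r)) seedBody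
    after-seeds : ∀ τ → Searching F τ r (seeds k W) × Frame p₁ σ′ τ →
                  Ex (setReg #src (reg #end) ∷ loop #head (reg #end) searchBody) τ (suc (suc budget)) Near-post
    after-seeds τ (S , fr) with search-start H W k
    ... | todo , eq , M = ex-setR (ex-weaken ≤-refl finish
            (ex-frame (search-loop budget budget todo [] τ′ τ′ refl ≤-refl (trans (reg≡ fr #r refl) r≡) (trans (reg≡ fr #k refl) k≡)
              (λ v → row-cong (arr≡ fr $deg refl) (arr≡ fr $adj refl) (adj v)) frame-refl (reg≡ fr #head refl)
              (subst (Searching F τ′ r) eq (searching-regs {τ} {τ′} refl refl S)) M)))
      where
      τ′ = setR τ #src (regs τ #end)
      finish : ∀ υ → Found υ × Frame (loop #head (reg #end) searchBody) τ′ υ → Near-post υ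
      finish υ ((Q , M′ , S′) , fr′) = record
        { Q = Q ; nearest = search-end M′ ; searching = S′
        ; src≡ = trans (reg≡ fr′ #src refl) (trans (end≡ (queue S)) (sym (length-map source (seeds k W))))
        ; sources = src (Search.suffix M′) (qs≡ (queue S′)) }
        where
        src : (∃[ ext ] Q ≡ ext ++ seeds k W) → Stored (arrays υ $qs) (map source Q) → Stored (arrays υ $qs) (map source (seeds k W))
        src (ext , refl) st = stored-++ (map source ext) _ (subst (Stored _) (map-++ source ext (seeds k W)) st)
          where open import Data.List.Properties using (map-++)
    time : 3 + (suc (Sum (λ _ → 17) W) + suc (suc budget)) ≤ 6 + length W * 17 + budget
    time = ≤-reflexive (trans (cong (λ t → 3 + (suc t + suc (suc budget))) (Sum-const 17 W)) (lem (length W * 17) budget))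
      where
      lem : ∀ a b → 3 + (suc a + suc (suc b)) ≡ 6 + a + b
      lem = solve-∀

-- A greedy hitting set of the full lists, with falling thresholds.

sel-swap : ∀ v s Q → mult v (sel s (SV Q)) ≡ mult s (at v Q)
sel-swap v s [] = refl
sel-swap v s (q ∷ Q) with source q ≟ s | vertex q ≟ v
... | yes refl | yes refl = trans (trans (cong (mult v) (sel-yes s v (SV Q))) (cong₂ _+_ (trans (same-refl v) (sym (same-refl s))) (sel-swap v s Q))) (cong (mult s) (sym (sel-yes v s (VS Q))))
... | yes refl | no ne = trans (trans (cong (mult v) (sel-yes s (vertex q) (SV Q))) (cong₂ _+_ (same-≢ λ e → ne (sym e)) (sel-swap v s Q))) (cong (mult s) (sym (sel-no s (VS Q) ne)))
... | no ne | yes refl = trans (trans (cong (mult v) (sel-no v (SV Q) ne)) (sel-swap v s Q)) (trans (cong (_+ mult s (at v Q)) (sym (same-≢ λ e → ne (sym e)))) (cong (mult s) (sym (sel-yes v (source q) (VS Q)))))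
... | no ne | no ne′ = trans (trans (cong (mult v) (sel-no (vertex q) (SV Q) ne)) (sel-swap v s Q)) (cong (mult s) (sym (sel-no (source q) (VS Q) ne′)))

∈-inv : ∀ {Q v s} → v ∈ sel s (SV Q) → ∃[ d ] entry v s d ∈ Q
∈-inv {Q} v∈ with ∈-map⁻ sv (∈-sel (SV Q) v∈)
... | q , q∈ , refl = dist q , q∈

module Threshold (k n : ℕ) (Q : List Entry) (T : Table k Q) (S : List ℕ) (S-distinct : Distinct S)
                 (Q⊆S : ∀ {q} → q ∈ Q → source q ∈ S) (<n : ∀ {q} → q ∈ Q → vertex q < n) where

  inv : ℕ → List ℕ
  inv s = sel s (SV Q)

  inv-distinct : ∀ s → Distinct (inv s)
  inv-distinct s v = subst (_≤ 1) (sym (sel-swap v s Q)) (distinct-at T v s)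

  inv-<n : ∀ s v → v ∈ inv s → v < n
  inv-<n s v v∈ with ∈-inv {Q} v∈
  ... | d , q∈ = <n q∈

  inv-length : ∀ s → length (inv s) ≤ n
  inv-length s = distinct-length≤ n (inv s) (inv-distinct s) (inv-<n s)

  -- need h v is 1 if the list of v is full and not yet hit, where h v ≠ 0 means hit.
  need : (ℕ → ℕ) → ℕ → ℕ
  need h v = same (length (at v Q)) k * same (h v) 0

  demand : (ℕ → ℕ) → ℕ → ℕ
  demand h s = Sum (need h) (inv s)

  unmet : (ℕ → ℕ) → ℕ
  unmet h = Sum (need h) (downFrom n)

  need≤1 : ∀ h v → need h v ≤ 1
  need≤1 h v = *-mono-≤ (bit≤1 (length (at v Q) ≡ᵇ k)) (bit≤1 (h v ≡ᵇ 0))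

  need-hit : ∀ h v → h v ≢ 0 → need h v ≡ 0
  need-hit h v ne = trans (cong (same (length (at v Q)) k *_) (same-≢ ne)) (*-zeroʳ (same (length (at v Q)) k))

  need-0 : ∀ h v → length (at v Q) ≡ k → need h v ≡ 0 → h v ≢ 0
  need-0 h v l≡ n0 h0 = 0≢1+n (trans (sym n0) (cong₂ _*_ (trans (cong (λ l → same l k) l≡) (same-refl k)) (cong (λ z → same z 0) h0)))

  need-k≤ : ∀ h v → need h v * k ≤ Sum (λ _ → need h v) (at v Q)
  need-k≤ h v with length (at v Q) ≟ k
  ... | no ne rewrite ≡ᵇ-≢ ne = z≤n
  ... | yes e = ≤-reflexive (trans (*-comm (need h v) k) (trans (cong (_* need h v) (sym e)) (sym (Sum-const (need h v) (at v Q)))))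

  -- Each unmet list has k sources and adds 1 to the demand of each of them.
  unmet≤ : ∀ h → unmet h * k ≤ Sum (demand h) S
  unmet≤ h = begin
    unmet h * k                                                         ≡⟨ *-comm (unmet h) k ⟩
    k * unmet h                                                         ≡⟨ Sum-*ˡ k (need h) (downFrom n) ⟨
    Sum (λ v → k * need h v) (downFrom n)                               ≤⟨ Sum-mono (downFrom n) (λ v _ → ≤-trans (≤-reflexive (*-comm k _)) (need-k≤ h v)) ⟩
    Sum (λ v → Sum (λ _ → need h v) (at v Q)) (downFrom n)              ≡⟨ double-count (λ v _ → need h v) (downFrom n) (VS Q) ⟩
    Sum (λ p → mult (proj₁ p) (downFrom n) * need h (proj₁ p)) (VS Q)   ≡⟨ Sum-map _ vs Q ⟩
    Sum (λ q → mult (vertex q) (downFrom n) * need h (vertex q)) Q      ≤⟨ Sum-mono Q (λ q q∈ → ≤-trans (*-monoˡ-≤ _ (downFrom-distinct n (vertex q))) (*-monoˡ-≤ _ (∈-mult (Q⊆S q∈)))) ⟩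
    Sum (λ q → mult (source q) S * need h (vertex q)) Q                 ≡⟨ Sum-map _ sv Q ⟨
    Sum (λ p → mult (proj₁ p) S * need h (proj₂ p)) (SV Q)              ≡⟨ double-count (λ _ → need h) S (SV Q) ⟨
    Sum (demand h) S                                                    ∎
    where open ≤-Reasoning

  Marked : List ℕ → (ℕ → ℕ) → (ℕ → ℕ) → Set
  Marked ys h h′ = ∀ v → (mult v ys ≡ 0 → h′ v ≡ h v) × (mult v ys ≢ 0 → h′ v ≡ 1)

  marked-need : ∀ ys {h h′} → Marked ys h h′ → ∀ v → need h′ v ≤ need h v × (mult v ys ≢ 0 → need h′ v ≡ 0)
  marked-need ys {h} {h′} M v with mult v ys ≟ 0
  ... | yes e = ≤-reflexive (cong (λ z → same (length (at v Q)) k * same z 0) (proj₁ (M v) e)) , λ ne → ⊥-elim (ne e)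
  ... | no ne = ≤-trans (≤-reflexive z) z≤n , λ _ → z
    where
    z : need h′ v ≡ 0
    z = need-hit h′ v λ e → 0≢1+n (trans (sym e) (proj₂ (M v) ne))

  demand-marked : ∀ ys {h h′} → Marked ys h h′ → ∀ s → demand h′ s ≤ demand h s
  demand-marked ys M s = Sum-mono (inv s) λ v _ → proj₁ (marked-need ys M v)

  demand-met : ∀ {h h′} s → Marked (inv s) h h′ → demand h′ s ≡ 0
  demand-met {h} {h′} s M = n≤0⇒n≡0 (≤-trans (Sum-≤-const 0 (inv s) (λ v v∈ → ≤-reflexive (proj₂ (marked-need (inv s) M v) λ e → 1+n≰n (subst (1 ≤_) e (∈-mult v∈)))))
                              (≤-reflexive (*-zeroʳ (length (inv s)))))

  -- Marking the lists that contain `s` settles the unmet ones among them, and `demand` counts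
  -- exactly those.
  unmet-drop : ∀ {h h′} s → Marked (inv s) h h′ → unmet h′ + demand h s ≤ unmet h
  unmet-drop {h} {h′} s M = begin
    unmet h′ + demand h s                                                       ≤⟨ +-monoʳ-≤ (unmet h′) below ⟩
    unmet h′ + Sum (λ v → mult v (inv s) * need h v) (downFrom n)               ≡⟨ Sum-+ (need h′) _ (downFrom n) ⟨
    Sum (λ v → need h′ v + mult v (inv s) * need h v) (downFrom n)              ≤⟨ Sum-mono (downFrom n) (λ v _ → each v) ⟩
    unmet h                                                                     ∎
    where
    open ≤-Reasoning
    below : demand h s ≤ Sum (λ v → mult v (inv s) * need h v) (downFrom n)
    below = begin
      Sum (need h) (inv s)                                                  ≤⟨ Sum-mono (inv s) (λ v v∈ → self v (inv-<n s v v∈)) ⟩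
      Sum (λ v → Sum (λ _ → need h v) (sel v (diagonal (downFrom n)))) (inv s) ≡⟨ double-count (λ v _ → need h v) (inv s) (diagonal (downFrom n)) ⟩
      Sum (λ p → mult (proj₁ p) (inv s) * need h (proj₁ p)) (diagonal (downFrom n)) ≡⟨ Sum-map _ (λ x → x , x) (downFrom n) ⟩
      Sum (λ v → mult v (inv s) * need h v) (downFrom n)                    ∎
      where
      self : ∀ v → v < n → need h v ≤ Sum (λ _ → need h v) (sel v (diagonal (downFrom n)))
      self v v<n = ≤-trans (m≤n*m (need h v) (length (sel v (diagonal (downFrom n)))) {{>-nonZero pos}})
                     (≤-reflexive (sym (Sum-const (need h v) (sel v (diagonal (downFrom n))))))
        where
        pos : 0 < length (sel v (diagonal (downFrom n)))
        pos = subst (0 <_) (sym (length-sel-diagonal v (downFrom n))) (∈-mult (∈-downFrom v<n))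
    each : ∀ v → need h′ v + mult v (inv s) * need h v ≤ need h v
    each v with mult v (inv s) ≟ 0
    ... | yes e = ≤-trans (≤-reflexive (trans (cong (λ m → need h′ v + m * need h v) e) (+-identityʳ _))) (proj₁ (marked-need (inv s) M v))
    ... | no ne = ≤-trans (≤-reflexive (cong (_+ mult v (inv s) * need h v) (proj₂ (marked-need (inv s) M v) ne)))
                    (≤-trans (*-monoˡ-≤ (need h v) (inv-distinct s v)) (≤-reflexive (*-identityˡ _)))

  sources-inv : Sum (λ s → length (inv s)) S ≤ length Q
  sources-inv = begin
    Sum (λ s → length (inv s)) S              ≡⟨ double-count-length S (SV Q) ⟩
    Sum (λ p → mult (proj₁ p) S) (SV Q)       ≡⟨ Sum-map _ sv Q ⟩
    Sum (λ q → mult (source q) S) Q           ≤⟨ Sum-mono Q (λ q _ → S-distinct (source q)) ⟩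
    Sum (λ _ → 1) Q                           ≡⟨ Sum-1 Q ⟩
    length Q                                  ∎
    where open ≤-Reasoning

-- The hitting set program and its correctness.

countBody markBody chooseBody passBody hitP : Program
countBody =
  setReg #v (cell $inv (pairE (pairE (reg #r) (reg #s)) (reg #j))) ∷
  -- The product of the two tests is the conjunction in `need`.
  ite ((cell $size (pairE (reg #r) (reg #v)) ⟪ equal ⟫ reg #k) ⟪ mul ⟫ (cell $hit (pairE (reg #r) (reg #v)) ⟪ equal ⟫ const 0))
    (increment #c ∷ []) [] ∷
  increment #j ∷ []
markBody =
  setCell $hit (pairE (reg #r) (cell $inv (pairE (pairE (reg #r) (reg #s)) (reg #j)))) (const 1) ∷
  increment #j ∷ []
chooseBody =
  setReg #s (cell $qs (reg #i)) ∷
  setReg #c (const 0) ∷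
  setReg #j (const 0) ∷
  loop #j (cell $cnt (pairE (reg #r) (reg #s))) countBody ++
  ite (reg #c ⟪ less ⟫ reg #θ) []
    (rowPush $len $lst (reg #out) (reg #s) ++
     setReg #j (const 0) ∷
     loop #j (cell $cnt (pairE (reg #r) (reg #s))) markBody) ∷
  increment #i ∷ []
passBody =
  setReg #i (const 0) ∷
  loop #i (reg #src) chooseBody ++
  setReg #θ (reg #θ ⟪ div ⟫ const 2) ∷ []
hitP =
  setReg #θ (reg #n) ∷
  while (reg #θ) passBody ∷ []

Sum-∈ : ∀ {A : Set} (f : A → ℕ) {x xs} → x ∈ xs → f x ≤ Sum f xs
Sum-∈ f (here refl) = m≤m+n _ _
Sum-∈ f {xs = y ∷ _} (there i) = ≤-trans (Sum-∈ f i) (m≤n+m _ (f y))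

half-< : ∀ θ L → θ < 2 ^ suc L → θ / 2 < 2 ^ L
half-< θ L lt = m<n*o⇒m/o<n {θ} {2 ^ L} {2} (subst (θ <_) (*-comm 2 (2 ^ L)) lt)
  where open import Data.Nat.DivMod using (m<n*o⇒m/o<n)

module HitSpec (k n r out : ℕ) (Q : List Entry) (T : Table k Q) (S : List ℕ) (S-distinct : Distinct S)
               (Q⊆S : ∀ {q} → q ∈ Q → source q ∈ S) (<n : ∀ {q} → q ∈ Q → vertex q < n)
               (base : Store) (R₀ : List ℕ) where

  open Threshold k n Q T S S-distinct Q⊆S <n public

  record Context (σ : Store) : Set where
    field
      r≡     : regs σ #r ≡ r
      k≡     : regs σ #k ≡ k
      out≡   : regs σ #out ≡ out
      src≡   : regs σ #src ≡ length S
      tagged : Tagged σ r Q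
      qs≡    : Stored (arrays σ $qs) S
  open Context

  -- All frame conditions of a context in one Boolean, so that a single `refl` preserves the whole
  -- context.
  context-keeps : Program → Bool
  context-keeps p = keepsReg #r p ∧ keepsReg #k p ∧ keepsReg #out p ∧ keepsReg #src p
    ∧ keepsArr $seen p ∧ keepsArr $size p ∧ keepsArr $cnt p ∧ keepsArr $inv p ∧ keepsArr $qs p

  context-frame : ∀ p {σ τ} → context-keeps p ≡ true → Frame p σ τ → Context σ → Context τ
  context-frame p e fr c =
    let (a₁ , e₁) = ∧-true {keepsReg #r p} e ; (a₂ , e₂) = ∧-true {keepsReg #k p} e₁ ; (a₃ , e₃) = ∧-true {keepsReg #out p} e₂
        (a₄ , e₄) = ∧-true {keepsReg #src p} e₃ ; (a₅ , e₅) = ∧-true {keepsArr $seen p} e₄ ; (a₆ , e₆) = ∧-true {keepsArr $size p} e₅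
        (a₇ , e₇) = ∧-true {keepsArr $cnt p} e₆ ; (a₈ , a₉) = ∧-true {keepsArr $inv p} e₇
    in record
      { r≡ = trans (reg≡ fr #r a₁) (r≡ c) ; k≡ = trans (reg≡ fr #k a₂) (k≡ c) ; out≡ = trans (reg≡ fr #out a₃) (out≡ c)
      ; src≡ = trans (reg≡ fr #src a₄) (src≡ c)
      ; tagged = record
        { seen≡ = λ x s → trans (cong (λ f → f (pair (pair r x) s)) (arr≡ fr $seen a₅)) (seen≡ (tagged c) x s)
        ; size≡ = λ x → trans (cong (λ f → f (pair r x)) (arr≡ fr $size a₆)) (size≡ (tagged c) x)
        ; inv≡  = λ s → row-cong (arr≡ fr $cnt a₇) (arr≡ fr $inv a₈) (inv≡ (tagged c) s) }
      ; qs≡ = subst (λ f → Stored f S) (sym (arr≡ fr $qs a₉)) (qs≡ c) }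

  hits : Store → ℕ → ℕ
  hits σ v = arrays σ $hit (pair r v)

  count-step : ∀ s x todo done σ {h} → Context σ → regs σ #s ≡ s → (∀ v → hits σ v ≡ h v) → (x ∷ todo) ʳ++ done ≡ inv s →
    regs σ #j ≡ length done → regs σ #c ≡ Sum (need h) done →
    Ex countBody σ 5 (λ τ → regs τ #j ≡ suc (length done) × regs τ #c ≡ Sum (need h) (x ∷ done))
  count-step s x todo done σ {h} C s≡ h≡ eq j≡ c≡ = by-cases (need h x ≟ 0)
    where
    at-x : arrays σ $inv (pair (pair (regs σ #r) (regs σ #s)) (regs σ #j)) ≡ x
    at-x = trans (cong₂ (λ a b → arrays σ $inv (pair a b)) (cong₂ pair (r≡ C) s≡) j≡)
             (stored-at todo x done (subst (Stored _) (sym eq) (proj₂ (inv≡ (tagged C) s))))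
    σ₁ = setR σ #v (arrays σ $inv (pair (pair (regs σ #r) (regs σ #s)) (regs σ #j)))
    σ₂ = setR σ₁ #c (regs σ #c + 1)
    cond : ⟦ mul ⟧ (⟦ equal ⟧ (arrays σ₁ $size (pair (regs σ₁ #r) (regs σ₁ #v))) (regs σ₁ #k)) (⟦ equal ⟧ (arrays σ₁ $hit (pair (regs σ₁ #r) (regs σ₁ #v))) 0)
           ≡ need h x
    cond = cong₂ _*_ (cong₂ same (trans (cong₂ (λ a b → arrays σ $size (pair a b)) (r≡ C) at-x) (size≡ (tagged C) x)) (k≡ C))
                     (cong (λ z → same z 0) (trans (cong₂ (λ a b → arrays σ $hit (pair a b)) (r≡ C) at-x) (h≡ x)))
    by-cases : Dec (need h x ≡ 0) → Ex countBody σ 5 (λ τ → regs τ #j ≡ suc (length done) × regs τ #c ≡ Sum (need h) (x ∷ done))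
    by-cases (yes n0) = ex-weaken (m≤m+n 3 2) (λ _ z → z)
      (ex-setR (ex-ite₀ {P = λ ρ → ρ ≡ σ₁} (trans cond n0) (ex-halt {T = 0} refl)
        λ { ρ refl → ex-setR (ex-halt {T = 0} (trans (cong (_+ 1) j≡) (+-comm _ 1) , trans c≡ (cong (_+ Sum (need h) done) (sym n0)))) }))
    by-cases (no n≢0) = ex-weaken (m≤m+n 4 1) (λ _ z → z)
      (ex-setR (ex-ite₁ {P = λ ρ → ρ ≡ σ₂} (λ e → n≢0 (trans (sym cond) e)) (ex-setR (ex-halt {T = 0} refl))
        λ { ρ refl → ex-setR (ex-halt {T = 0} (trans (cong (_+ 1) j≡) (+-comm _ 1) , trans (+-comm _ 1) (cong₂ _+_ (sym n1) c≡))) }))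
      where
      n1 : need h x ≡ 1
      n1 = ≤-antisym (need≤1 h x) (n≢0⇒n>0 n≢0)

  Untouched : Store → Store → Set
  Untouched σ τ = ∀ r′ v → r′ ≢ r → arrays τ $hit (pair r′ v) ≡ arrays σ $hit (pair r′ v)

  mark-step : ∀ s x todo done σ₀ σ → Context σ → regs σ #s ≡ s → (x ∷ todo) ʳ++ done ≡ inv s → regs σ #j ≡ length done →
    Marked done (hits σ₀) (hits σ) × Untouched σ₀ σ →
    Ex markBody σ 2 (λ τ → regs τ #j ≡ suc (length done) × Marked (x ∷ done) (hits σ₀) (hits τ) × Untouched σ₀ τ)
  mark-step s x todo done σ₀ σ C s≡ eq j≡ (M , U) =
    ex-setA (ex-setR (ex-halt {T = 0} (trans (cong (_+ 1) j≡) (+-comm _ 1) , M′ , U′)))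
    where
    idx = pair (regs σ #r) (arrays σ $inv (pair (pair (regs σ #r) (regs σ #s)) (regs σ #j)))
    idx≡ : idx ≡ pair r x
    idx≡ = cong₂ pair (r≡ C) (trans (cong₂ (λ a b → arrays σ $inv (pair a b)) (cong₂ pair (r≡ C) s≡) j≡)
             (stored-at todo x done (subst (Stored _) (sym eq) (proj₂ (inv≡ (tagged C) s)))))
    M′ : Marked (x ∷ done) (hits σ₀) (λ v → (arrays σ $hit [ idx ↦ 1 ]) (pair r v))
    M′ v with x ≟ v
    ... | yes refl rewrite idx≡ = (λ e → ⊥-elim (0≢1+n (trans (sym e) (cong (_+ mult x done) (same-refl x))))) , (λ _ → upd-same (arrays σ $hit) (pair r x) 1)
    ... | no ne rewrite idx≡ | same-≢ {v} {x} (λ e → ne (sym e)) =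
            (λ e → trans off (proj₁ (M v) e)) , (λ e → trans off (proj₂ (M v) e))
      where
      off : (arrays σ $hit [ pair r x ↦ 1 ]) (pair r v) ≡ hits σ v
      off = upd-other (arrays σ $hit) {pair r x} {pair r v} 1 (pair-≢ʳ {r} {x} {r} {v} ne)
    U′ : ∀ r′ v → r′ ≢ r → (arrays σ $hit [ idx ↦ 1 ]) (pair r′ v) ≡ arrays σ₀ $hit (pair r′ v)
    U′ r′ v ne rewrite idx≡ = trans (upd-other (arrays σ $hit) {pair r x} {pair r′ v} 1 (pair-≢ˡ {r} {x} {r′} {v} λ e → ne (sym e))) (U r′ v ne)

  -- `R₀` is what the target list held before, since the hitting sets of several rounds accumulate
  -- in one list. `alien` protects the marks of searches with other tags.
  record Hitting (σ : Store) (C : List ℕ) : Set where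
    field
      row    : Row (arrays σ $len) (arrays σ $lst) out (C ++ R₀)
      rows   : ∀ key xs → key ≢ out → Row (arrays base $len) (arrays base $lst) key xs → Row (arrays σ $len) (arrays σ $lst) key xs
      alien  : Untouched base σ
      marked : ∀ v → hits σ v ≢ 0 → ∃[ s ] s ∈ C × v ∈ inv s
      chosen : ∀ s → s ∈ C → s ∈ S
  open Hitting

  hitting-cong : ∀ {σ τ C} → arrays τ $len ≡ arrays σ $len → arrays τ $lst ≡ arrays σ $lst → arrays τ $hit ≡ arrays σ $hit →
                 Hitting σ C → Hitting τ C
  hitting-cong e₁ e₂ e₃ H = record
    { row    = row-cong e₁ e₂ (row H)
    ; rows   = λ key xs ne R → row-cong e₁ e₂ (rows H key xs ne R)
    ; alien  = λ r′ v ne → trans (cong (λ f → f (pair r′ v)) e₃) (alien H r′ v ne)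
    ; marked = λ v ne → marked H v λ e → ne (trans (cong (λ f → f (pair r v)) e₃) e)
    ; chosen = chosen H }

  data Choice (θ : ℕ) (σ τ : Store) (C : List ℕ) (s : ℕ) : Set where
    skip : Hitting τ C → (∀ v → hits τ v ≡ hits σ v) → demand (hits σ) s < θ → Choice θ σ τ C s
    take : Hitting τ (s ∷ C) → Marked (inv s) (hits σ) (hits τ) → θ ≤ demand (hits σ) s → Choice θ σ τ C s

  choose-cost : ℕ → ℕ
  choose-cost s = 10 + length (inv s) * 9

  choose-step : ∀ θ s todo done σ C → Context σ → regs σ #θ ≡ θ → (s ∷ todo) ʳ++ done ≡ S → regs σ #i ≡ length done → Hitting σ C →
    Ex chooseBody σ (choose-cost s) (λ τ → regs τ #i ≡ suc (length done) × Choice θ σ τ C s)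
  choose-step θ s todo done σ C ctx θ≡ eq i≡ H = ex-weaken time (λ _ z → z)
    (ex-setR (ex-setR (ex-setR (ex-++ {p = countLoop}
      (ex-frame (ex-loop #j (cell $cnt (pairE (reg #r) (reg #s))) countBody (inv s) (λ xs τ → regs τ #c ≡ Sum (need (hits σ)) xs) (λ _ → 5) σ₁
        (λ xs τ fr _ → bound τ (context-frame countBody refl fr ctx₁) (trans (reg≡ fr #s refl) s≡))
        (λ x todo done τ eq fr j≡ c≡ → count-step s x todo done τ (context-frame countBody refl fr ctx₁) (trans (reg≡ fr #s refl) s≡)
          (λ v → cong (λ f → f (pair r v)) (arr≡ fr $hit refl)) eq j≡ c≡)
        refl refl))
      decide))))
    where
    countLoop = loop #j (cell $cnt (pairE (reg #r) (reg #s))) countBody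
    markLoop = loop #j (cell $cnt (pairE (reg #r) (reg #s))) markBody
    σ₁ = setR (setR (setR σ #s (arrays σ $qs (regs σ #i))) #c 0) #j 0
    s≡ : regs σ₁ #s ≡ s
    s≡ = trans (cong (arrays σ $qs) i≡) (stored-at todo s done (subst (Stored _) (sym eq) (qs≡ ctx)))
    ctx₁ : Context σ₁
    ctx₁ = record { r≡ = r≡ ctx ; k≡ = k≡ ctx ; out≡ = out≡ ctx ; src≡ = src≡ ctx ; tagged = tagged-regs refl (tagged ctx) ; qs≡ = qs≡ ctx }
    bound : ∀ τ → Context τ → regs τ #s ≡ s → arrays τ $cnt (pair (regs τ #r) (regs τ #s)) ≡ length (inv s)
    bound τ c s≡ = trans (cong (arrays τ $cnt) (cong₂ pair (r≡ c) s≡)) (proj₁ (inv≡ (tagged c) s))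
    Post : Store → Set
    Post τ = regs τ #i ≡ suc (length done) × Choice θ σ τ C s
    L = length (inv s)
    decide : ∀ τ → (regs τ #c ≡ Sum (need (hits σ)) (inv s)) × Frame countLoop σ₁ τ →
      Ex (ite (reg #c ⟪ less ⟫ reg #θ) [] (rowPush $len $lst (reg #out) (reg #s) ++ setReg #j (const 0) ∷ markLoop) ∷ increment #i ∷ [])
        τ (suc ((3 + suc (L * 3)) + 1)) Post
    decide τ (c≡ , fr) with demand (hits σ) s <? θ
    ... | yes lt = ex-weaken (s≤s (m≤n+m 1 (3 + suc (L * 3)))) (λ _ z → z)
          (ex-ite₁ {P = λ ρ → ρ ≡ τ} (less-true (subst₂ _<_ (sym c≡) (sym (trans (reg≡ fr #θ refl) θ≡)) lt)) (ex-halt {T = 0} refl)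
            λ { ρ refl → ex-setR (ex-halt {T = 0} (trans (cong (_+ 1) (trans (reg≡ fr #i refl) i≡)) (+-comm _ 1) ,
              skip (hitting-cong (arr≡ fr $len refl) (arr≡ fr $lst refl) (arr≡ fr $hit refl) H)
                (λ v → cong (λ f → f (pair r v)) (arr≡ fr $hit refl)) lt)) })
    ... | no ≮ = ex-ite₀ {P = Marking} (less-false (subst₂ _≤_ (sym (trans (reg≡ fr #θ refl) θ≡)) (sym c≡) (≮⇒≥ ≮)))
            (ex-setA (ex-setA (ex-setR (ex-weaken (≤-reflexive (cong suc (Sum-const 3 (inv s)))) (λ _ z → z)
              (ex-frame (ex-loop #j (cell $cnt (pairE (reg #r) (reg #s))) markBody (inv s) (λ xs υ → Marked xs (hits τ₁) (hits υ) × Untouched τ₁ υ) (λ _ → 2) τ₁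
                (λ xs υ fr′ _ → bound υ (context-frame markBody refl fr′ ctx₂) (trans (reg≡ fr′ #s refl) s≡τ))
                (λ x todo done υ eq fr′ j≡ M → mark-step s x todo done τ₁ υ (context-frame markBody refl fr′ ctx₂) (trans (reg≡ fr′ #s refl) s≡τ) eq j≡ M)
                refl ((λ v → (λ _ → refl) , (λ ne → ⊥-elim (ne refl))) , λ r′ v ne → refl)))))))
            λ ρ M → ex-setR (ex-halt {T = 0} (finish ρ M))
      where
      o = regs τ #out
      o≡ : o ≡ out
      o≡ = trans (reg≡ fr #out refl) (out≡ ctx)
      τ₁ = setR (setA (setA τ $lst (pair o (arrays τ $len o)) (regs τ #s)) $len o (arrays τ $len o + 1)) #j 0
      ctxτ : Context τ
      ctxτ = context-frame countLoop refl fr ctx₁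
      s≡τ : regs τ #s ≡ s
      s≡τ = trans (reg≡ fr #s refl) s≡
      ctx₂ : Context τ₁
      ctx₂ = record { r≡ = r≡ ctxτ ; k≡ = k≡ ctxτ ; out≡ = out≡ ctxτ ; src≡ = src≡ ctxτ
                    ; tagged = record { seen≡ = seen≡ (tagged ctxτ) ; size≡ = size≡ (tagged ctxτ) ; inv≡ = inv≡ (tagged ctxτ) } ; qs≡ = qs≡ ctxτ }
      Marking : Store → Set
      Marking ρ = (Marked (inv s) (hits τ₁) (hits ρ) × Untouched τ₁ ρ) × Frame markLoop τ₁ ρ
      Hτ : Hitting τ C
      Hτ = hitting-cong (arr≡ fr $len refl) (arr≡ fr $lst refl) (arr≡ fr $hit refl) H
      len₁ = arrays τ $len [ o ↦ arrays τ $len o + 1 ]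
      lst₁ = arrays τ $lst [ pair o (arrays τ $len o) ↦ regs τ #s ]
      row₁ : Row len₁ lst₁ out (s ∷ C ++ R₀)
      row₁ = subst₂ (λ a b → Row len₁ lst₁ a (b ∷ C ++ R₀)) o≡ s≡τ (row-push {arrays τ $len} {arrays τ $lst} o (regs τ #s) (subst (λ a → Row (arrays τ $len) (arrays τ $lst) a (C ++ R₀)) (sym o≡) (row Hτ)))
      finish : ∀ ρ → Marking ρ → regs ρ #i + 1 ≡ suc (length done) × Choice θ σ (setR ρ #i (regs ρ #i + 1)) C s
      finish ρ ((M , U) , fr′) =
          trans (cong (_+ 1) (trans (reg≡ fr′ #i refl) (trans (reg≡ fr #i refl) i≡))) (+-comm _ 1)
        , take record
            { row    = row-cong (arr≡ fr′ $len refl) (arr≡ fr′ $lst refl) row₁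
            ; rows   = λ key xs ne R → row-cong (arr≡ fr′ $len refl) (arr≡ fr′ $lst refl)
                         (row-other {arrays τ $len} {arrays τ $lst} o (regs τ #s) (λ e → ne (trans (sym e) o≡)) (rows Hτ key xs ne R))
            ; alien  = λ r′ v ne → trans (U r′ v ne) (alien Hτ r′ v ne)
            ; marked = mk
            ; chosen = ch }
          (λ v → (λ e → trans (proj₁ (M v) e) (hτ v)) , proj₂ (M v)) (≮⇒≥ ≮)
        where
        hτ : ∀ v → hits τ v ≡ hits σ v
        hτ v = cong (λ f → f (pair r v)) (arr≡ fr $hit refl)
        mk : ∀ v → hits ρ v ≢ 0 → ∃[ z ] z ∈ s ∷ C × v ∈ inv z
        mk v ne with mult v (inv s) ≟ 0
        ... | no m = s , here refl , mult-∈ (inv s) m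
        ... | yes m with marked Hτ v (λ e → ne (trans (proj₁ (M v) m) e))
        ...   | z , z∈ , v∈ = z , there z∈ , v∈
        ch : ∀ z → z ∈ s ∷ C → z ∈ S
        ch z (here refl) = subst (s ∈_) eq (∈-ʳ++ʳ todo (here refl))
        ch z (there i)   = chosen H z i
    time : 3 + (suc (Sum (λ _ → 6) (inv s)) + suc ((3 + suc (L * 3)) + 1)) ≤ choose-cost s
    time = ≤-reflexive (trans (cong (λ t → 3 + (suc t + suc ((3 + suc (L * 3)) + 1))) (Sum-const 6 (inv s))) (lem L))
      where
      lem : ∀ l → 3 + (suc (l * 6) + suc ((3 + suc (l * 3)) + 1)) ≡ 10 + l * 9
      lem = solve-∀

  pass-cost : ℕ
  pass-cost = 3 + length S * 11 + length Q * 9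

  -- Every source chosen at threshold θ settles at least θ unmet lists, which the middle component
  -- charges. Demands never increase, so a visited source keeps its demand below θ until the end of
  -- the pass.
  Pass : ℕ → (ℕ → ℕ) → List ℕ → List ℕ → Store → Set
  Pass θ h₀ C₀ done τ = ∃[ extra ] Hitting τ (extra ++ C₀) × unmet (hits τ) + θ * length extra ≤ unmet h₀ × (∀ s → s ∈ done → demand (hits τ) s < θ)

  need-cong : ∀ {h h′} → (∀ v → h′ v ≡ h v) → ∀ v → need h′ v ≡ need h v
  need-cong e v = cong (λ z → same (length (at v Q)) k * same z 0) (e v)

  pass-step : ∀ θ h₀ C₀ done s {σ τ} → 1 ≤ θ → (P : Pass θ h₀ C₀ done σ) → Choice θ σ τ (proj₁ P ++ C₀) s → Pass θ h₀ C₀ (s ∷ done) τ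
  pass-step θ h₀ C₀ done s {σ} {τ} 1≤θ (extra , H , U , D) (skip H′ same-hits lt) =
    extra , H′ , ≤-trans (≤-reflexive (cong (_+ θ * length extra) (Sum-cong (downFrom n) (need-cong same-hits)))) U , D′
    where
    D′ : ∀ z → z ∈ s ∷ done → demand (hits τ) z < θ
    D′ z (here refl) = subst (_< θ) (sym (Sum-cong (inv z) (need-cong same-hits))) lt
    D′ z (there i)   = subst (_< θ) (sym (Sum-cong (inv z) (need-cong same-hits))) (D z i)
  pass-step θ h₀ C₀ done s {σ} {τ} 1≤θ (extra , H , U , D) (take H′ M ge) = s ∷ extra , H′ , U′ , D′
    where
    open ≤-Reasoning
    lem : ∀ u t l → u + t * suc l ≡ u + t + t * l
    lem = solve-∀
    U′ : unmet (hits τ) + θ * suc (length extra) ≤ unmet h₀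
    U′ = begin
      unmet (hits τ) + θ * suc (length extra)                       ≡⟨ lem (unmet (hits τ)) θ (length extra) ⟩
      unmet (hits τ) + θ + θ * length extra                         ≤⟨ +-monoˡ-≤ _ (+-monoʳ-≤ (unmet (hits τ)) ge) ⟩
      unmet (hits τ) + demand (hits σ) s + θ * length extra         ≤⟨ +-monoˡ-≤ _ (unmet-drop s M) ⟩
      unmet (hits σ) + θ * length extra                             ≤⟨ U ⟩
      unmet h₀                                                    ∎
    D′ : ∀ z → z ∈ s ∷ done → demand (hits τ) z < θ
    D′ z (here refl) = ≤-trans (s≤s (≤-reflexive (demand-met z M))) 1≤θ
    D′ z (there i)   = ≤-<-trans (demand-marked (inv s) M z) (D z i)

  pass : ∀ θ σ C₀ → 1 ≤ θ → Context σ → regs σ #θ ≡ θ → Hitting σ C₀ →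
         Ex passBody σ pass-cost (λ τ → Pass θ (hits σ) C₀ S τ × regs τ #θ ≡ θ / 2)
  pass θ σ C₀ 1≤θ ctx θ≡ H = ex-weaken time (λ _ z → z)
    (ex-setR (ex-++ {p = loop #i (reg #src) chooseBody}
      (ex-frame (ex-loop #i (reg #src) chooseBody S (Pass θ (hits σ) C₀) choose-cost σ₁
        (λ done τ fr _ → src≡ (context-frame chooseBody refl fr ctx₁))
        (λ s todo done τ eq fr i≡ P → ex-weaken ≤-refl (λ υ (i≡′ , ch) → i≡′ , pass-step θ (hits σ) C₀ done s 1≤θ P ch)
          (choose-step θ s todo done τ (proj₁ P ++ C₀) (context-frame chooseBody refl fr ctx₁) (trans (reg≡ fr #θ refl) θ≡) eq i≡ (proj₁ (proj₂ P))))
        refl ([] , hitting-cong refl refl refl H , ≤-reflexive (trans (cong (unmet (hits σ) +_) (*-zeroʳ θ)) (+-identityʳ _)) , λ s ())))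
      λ τ ((extra , H′ , U , D) , fr) → ex-setR (ex-halt {T = 0} ((extra , hitting-cong refl refl refl H′ , U , D) , cong (_/ 2) (trans (reg≡ fr #θ refl) θ≡)))))
    where
    σ₁ = setR σ #i 0
    ctx₁ : Context σ₁
    ctx₁ = record { r≡ = r≡ ctx ; k≡ = k≡ ctx ; out≡ = out≡ ctx ; src≡ = src≡ ctx ; tagged = tagged-regs refl (tagged ctx) ; qs≡ = qs≡ ctx }
    open ≤-Reasoning
    lem : ∀ a b → 1 + (suc (a * 11 + 9 * b) + 1) ≡ 3 + a * 11 + b * 9
    lem = solve-∀
    time : 1 + (suc (Sum (λ s → suc (choose-cost s)) S) + 1) ≤ pass-cost
    time = begin
      1 + (suc (Sum (λ s → 11 + length (inv s) * 9) S) + 1)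
        ≡⟨ cong (λ t → 1 + (suc t + 1)) (trans (Sum-+ (λ _ → 11) _ S) (cong₂ _+_ (Sum-const 11 S) (trans (Sum-cong S λ s → *-comm (length (inv s)) 9) (Sum-*ˡ 9 _ S)))) ⟩
      1 + (suc (length S * 11 + 9 * Sum (λ s → length (inv s)) S) + 1)
        ≤⟨ s≤s (+-monoˡ-≤ 1 (s≤s (+-monoʳ-≤ (length S * 11) (*-monoʳ-≤ 9 sources-inv)))) ⟩
      1 + (suc (length S * 11 + 9 * length Q) + 1)
        ≡⟨ lem (length S) (length Q) ⟩
      pass-cost ∎

  record Hit-post (L : ℕ) (τ : Store) (C₀ C : List ℕ) : Set where
    field
      hitting : Hitting τ C
      few     : length C * k ≤ length C₀ * k + 2 * length S * L
      met     : ∀ s → s ∈ S → demand (hits τ) s ≡ 0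
  open Hit-post public

  -- The invariant is that no demand exceeds 2θ. Then at most 2θ|S| / k lists are unmet, each chosen
  -- source settles at least θ of them, and the pass chooses at most 2|S| / k sources. At most `L`
  -- halvings bring θ down to 0, where the invariant says that nothing is left to hit.
  passes : ∀ L θ σ C₀ → θ < 2 ^ L → Context σ → regs σ #θ ≡ θ → Hitting σ C₀ → (∀ s → s ∈ S → demand (hits σ) s ≤ 2 * θ) →
           Ex (while (reg #θ) passBody ∷ []) σ (1 + L * (1 + pass-cost)) (λ τ → ∃[ C ] Hit-post L τ C₀ C)
  passes L zero σ C₀ θ< ctx θ≡ H D = ex-exit θ≡
    (C₀ , record { hitting = H ; few = m≤m+n _ _ ; met = λ s s∈ → n≤0⇒n≡0 (D s s∈) })
  passes zero (suc θ) σ C₀ (s≤s ()) ctx θ≡ H D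
  passes (suc L) (suc θ₋) σ C₀ θ< ctx θ≡ H D = ex-weaken (≤-reflexive (cong suc (+-suc pass-cost _))) (λ _ z → z)
    (ex-again (λ e → 0≢1+n (trans (sym e) θ≡)) (ex-frame (pass θ σ C₀ (s≤s z≤n) ctx θ≡ H))
      λ { τ (((extra , H′ , U , D′) , θ≡′) , fr) → ex-weaken ≤-refl
            (λ υ (C , P) → C , record { hitting = hitting P ; met = met P ; few = count extra C {unmet (hits τ)} U (few P) })
            (passes L (θ / 2) τ (extra ++ C₀) (half-< θ L θ<) (context-frame passBody refl fr ctx) θ≡′ H′ (λ s s∈ → falling (D′ s s∈))) })
    where
    θ = suc θ₋
    open ≤-Reasoning
    -- After the pass all demands are at most θ - 1, and twice the rounded half of θ is at least
    -- that, so the invariant survives rounding.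
    falling : ∀ {x} → x < θ → x ≤ 2 * (θ / 2)
    falling {x} lt = ≤-pred (begin
      suc x                     ≤⟨ lt ⟩
      θ                         ≡⟨ m≡m%n+[m/n]*n θ 2 ⟩
      θ % 2 + θ / 2 * 2         ≤⟨ +-monoˡ-≤ _ (≤-pred (m%n<n θ 2)) ⟩
      1 + θ / 2 * 2             ≡⟨ cong suc (*-comm (θ / 2) 2) ⟩
      suc (2 * (θ / 2))         ∎)
      where open import Data.Nat.DivMod using (m≡m%n+[m/n]*n; m%n<n)
    extra≤ : ∀ extra u → u + θ * length extra ≤ unmet (hits σ) → length extra * k ≤ 2 * length S
    extra≤ extra u U = *-cancelʳ-≤ (length extra * k) (2 * length S) θ (begin
      length extra * k * θ              ≡⟨ lem₁ (length extra) k θ ⟩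
      θ * length extra * k              ≤⟨ *-monoˡ-≤ k (≤-trans (m≤n+m _ u) U) ⟩
      unmet (hits σ) * k                ≤⟨ unmet≤ (hits σ) ⟩
      Sum (demand (hits σ)) S           ≤⟨ Sum-≤-const (2 * θ) S D ⟩
      length S * (2 * θ)                ≡⟨ lem₂ (length S) θ ⟩
      2 * length S * θ                  ∎)
      where
      lem₁ : ∀ a b c → a * b * c ≡ c * a * b
      lem₁ = solve-∀
      lem₂ : ∀ a b → a * (2 * b) ≡ 2 * a * b
      lem₂ = solve-∀
    count : ∀ extra C {u} → u + θ * length extra ≤ unmet (hits σ) → length C * k ≤ length (extra ++ C₀) * k + 2 * length S * L →
            length C * k ≤ length C₀ * k + 2 * length S * suc L
    count extra C {u} U le = begin
      length C * k                                                   ≤⟨ le ⟩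
      length (extra ++ C₀) * k + 2 * length S * L                    ≡⟨ cong (λ l → l * k + 2 * length S * L) (length-++ extra) ⟩
      (length extra + length C₀) * k + 2 * length S * L              ≡⟨ cong (_+ 2 * length S * L) (*-distribʳ-+ k (length extra) (length C₀)) ⟩
      length extra * k + length C₀ * k + 2 * length S * L            ≤⟨ +-monoˡ-≤ _ (+-monoˡ-≤ (length C₀ * k) (extra≤ extra u U)) ⟩
      2 * length S + length C₀ * k + 2 * length S * L                ≡⟨ lem (2 * length S) (length C₀ * k) L ⟩
      length C₀ * k + 2 * length S * suc L                           ∎
      where
      open import Data.List.Properties using (length-++)
      lem : ∀ a b l → a + b + a * l ≡ b + a * suc l
      lem = solve-∀

  ex-hit : ∀ L → n < 2 ^ L → Context base → regs base #n ≡ n → Row (arrays base $len) (arrays base $lst) out R₀ →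
           (∀ v → hits base v ≡ 0) → Ex hitP base (2 + L * (1 + pass-cost)) (λ τ → ∃[ C ] Hit-post L τ [] C)
  ex-hit L n< ctx n≡ row h0 = ex-setR (passes L n (setR base #θ (regs base #n)) [] n< ctx₁ n≡ H D)
    where
    ctx₁ : Context (setR base #θ (regs base #n))
    ctx₁ = record { r≡ = r≡ ctx ; k≡ = k≡ ctx ; out≡ = out≡ ctx ; src≡ = src≡ ctx ; tagged = tagged-regs refl (tagged ctx) ; qs≡ = qs≡ ctx }
    H : Hitting (setR base #θ (regs base #n)) []
    H = record { row = row ; rows = λ key xs ne R → R ; alien = λ r′ v ne → refl ; marked = λ v ne → ⊥-elim (ne (h0 v)) ; chosen = λ s () }
    -- A source occurs in at most n lists, so n is a valid first threshold.
    D : ∀ s → s ∈ S → demand (hits base) s ≤ 2 * n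
    D s s∈ = ≤-trans (Sum-≤-const 1 (inv s) (λ v _ → need≤1 (hits base) v)) (≤-trans (≤-reflexive (*-identityʳ _)) (≤-trans (inv-length s) (m≤m+n n _)))

  -- As k ≥ 1, the full list has some source. Its demand is 0, so the list is not unmet, and its
  -- mark comes from a chosen source.
  full-hit : ∀ {L τ C} → 1 ≤ k → Hit-post L τ [] C → ∀ v → length (at v Q) ≡ k → ∃[ s ] s ∈ C × ∃[ d ] entry v s d ∈ Q
  full-hit {L} {τ} {C} 1≤k P v l≡ with at v Q in eq | l≡
  ... | [] | refl = ⊥-elim (1+n≰n 1≤k)
  ... | s ∷ _ | _ with ∈-at {Q} {v} {s} (subst (s ∈_) (sym eq) (here refl))
  ...   | d , q∈ with marked (hitting P) v (need-0 (hits τ) v l≡ zero-need)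
    where
    zero-need : need (hits τ) v ≡ 0
    zero-need = n≤0⇒n≡0 (≤-trans (Sum-∈ (need (hits τ)) {v} {inv s} (sel-∈ (∈-map⁺ sv q∈))) (≤-reflexive (met P s (Q⊆S q∈))))
  ...     | z , z∈ , v∈ = z , z∈ , ∈-inv {Q} v∈

-- Labels: cell x < n of the data structure points to a linked list of nodes
-- hub, distance, next.

data Chain (f : ℕ → ℕ) (lo hi : ℕ) : ℕ → List (ℕ × ℕ) → Set where
  end  : Chain f lo hi 0 []
  link : ∀ {p h d ls} → lo ≤ p → p + 3 ≤ hi → f p ≡ h → f (p + 1) ≡ d → Chain f lo hi (f (p + 2)) ls →
         Chain f lo hi p ((h , d) ∷ ls)

chain-mono : ∀ {f g lo hi hi′ p ls} → (∀ i → lo ≤ i → i < hi → g i ≡ f i) → hi ≤ hi′ → Chain f lo hi p ls → Chain g lo hi′ p ls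
chain-mono e le end = end
chain-mono {f} {g} {lo} {hi} {hi′} {p} e le (link {h = h} {d} {ls} lo≤ ≤hi fh fd c) =
  link lo≤ (≤-trans ≤hi le) (trans (e p lo≤ (below 0 z≤n)) fh) (trans (e (p + 1) (≤-trans lo≤ (m≤m+n p 1)) (at-off 1 (s≤s z≤n))) fd)
    (subst (λ z → Chain g lo hi′ z ls) (sym (e (p + 2) (≤-trans lo≤ (m≤m+n p 2)) (at-off 2 (s≤s (s≤s z≤n))))) (chain-mono e le c))
  where
  at-off : ∀ i → i ≤ 2 → p + i < hi
  at-off i i≤ = ≤-trans (≤-trans (≤-reflexive (sym (+-suc p i))) (+-monoʳ-≤ p (s≤s i≤))) ≤hi
  below : ∀ i → i ≤ 0 → p < hi
  below _ _ = ≤-trans (≤-trans (≤-reflexive (sym (+-comm p 1))) (+-monoʳ-≤ p (s≤s z≤n))) ≤hi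

-- The first n cells are the list heads, so a node has an address of at least n. For positive n this
-- differs from 0, which ends a list.
record Labelled (σ : Store) (n : ℕ) (Lab : ℕ → List (ℕ × ℕ)) : Set where
  field
    n≤tail : n ≤ regs σ #tail
    chain  : ∀ x → x < n → Chain (arrays σ $D) n (regs σ #tail) (arrays σ $D x) (Lab x)
open Labelled public

labelled-cong : ∀ {σ τ n Lab} → regs τ #tail ≡ regs σ #tail → arrays τ $D ≡ arrays σ $D → Labelled σ n Lab → Labelled τ n Lab
labelled-cong {σ} {τ} {n} e₁ e₂ L = record
  { n≤tail = subst (n ≤_) (sym e₁) (n≤tail L)
  ; chain  = λ x x< → subst₂ (λ f t → Chain f n t (f x) _) (sym e₂) (sym e₁) (chain L x x<) }

-- `#tail` is register 0, which initially holds n and finally has to hold the length of the data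
-- structure. The n list heads, initially 0, are thus reserved without any work.
emits : Program
emits =
  setCell $D (reg #tail) (reg #v) ∷
  setCell $D (reg #tail ⟪ add ⟫ const 1) (reg #d) ∷
  setCell $D (reg #tail ⟪ add ⟫ const 2) (cell $D (reg #x)) ∷
  setCell $D (reg #x) (reg #tail) ∷
  setReg #tail (reg #tail ⟪ add ⟫ const 3) ∷ []

emitBody : ℕ → ℕ → Expr → Program
emitBody key hub guard =
  setReg #s (cell $qs (reg #head)) ∷
  setReg #x (cell key (reg #head)) ∷
  setReg #v (cell hub (reg #head)) ∷
  setReg #d (cell $qd (reg #head)) ∷
  ite guard [] emits ∷
  increment #head ∷ []

emitP : ℕ → ℕ → Expr → Program
emitP key hub guard =
  setReg #head (const 0) ∷
  loop #head (reg #end) (emitBody key hub guard)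

isHeavy : Expr
isHeavy = reg #K ⟪ less ⟫ cell $cnt (pairE (reg #r) (reg #s))

-- The sources that occur in too many lists form the list with key r + 1, from which the search of
-- the next round starts.
heavyBody heavyP : Program
heavyBody =
  setReg #s (cell $qs (reg #i)) ∷
  ite isHeavy (rowPush $len $lst (reg #r ⟪ add ⟫ const 1) (reg #s)) [] ∷
  increment #i ∷ []
heavyP =
  setReg #i (const 0) ∷
  loop #i (reg #src) heavyBody

addLabel : (ℕ → List (ℕ × ℕ)) → ℕ → ℕ × ℕ → ℕ → List (ℕ × ℕ)
addLabel Lab x l y = if x ≡ᵇ y then l ∷ Lab y else Lab y

addLabel-same : ∀ Lab x l → addLabel Lab x l x ≡ l ∷ Lab x
addLabel-same Lab x l rewrite ≡ᵇ-refl x = refl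

addLabel-other : ∀ Lab {x y} l → x ≢ y → addLabel Lab x l y ≡ Lab y
addLabel-other Lab l ne rewrite ≡ᵇ-≢ ne = refl

module EmitStep (σ : Store) {n : ℕ} {Lab : ℕ → List (ℕ × ℕ)} (L : Labelled σ n Lab) (x<n : regs σ #x < n) where

  t = regs σ #tail
  x = regs σ #x
  f = arrays σ $D
  f₁ = f [ t ↦ regs σ #v ]
  f₂ = f₁ [ t + 1 ↦ regs σ #d ]
  f₃ = f₂ [ t + 2 ↦ f₂ x ]
  f₄ = f₃ [ x ↦ t ]

  x<t : x < t
  x<t = <-≤-trans x<n (n≤tail L)

  t+-≢ : ∀ {i j} → i ≢ j → t + i ≢ t + j
  t+-≢ ne e = ne (+-cancelˡ-≡ t _ _ e)

  t≢t+ : ∀ {i} → t + suc i ≢ t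
  t≢t+ {i} e = <-irrefl (sym e) (≤-trans (s≤s (m≤m+n t i)) (≤-reflexive (sym (+-suc t i))))

  below : ∀ i → i < t → i ≢ x → f₄ i ≡ f i
  below i i<t i≢x =
    trans (upd-other f₃ t (λ e → i≢x (sym e)))
    (trans (upd-other f₂ (f₂ x) (λ e → <-irrefl (sym e) (<-≤-trans i<t (m≤m+n t 2))))
    (trans (upd-other f₁ (regs σ #d) (λ e → <-irrefl (sym e) (<-≤-trans i<t (m≤m+n t 1))))
           (upd-other f (regs σ #v) (λ e → <-irrefl (sym e) i<t))))

  f₂x : f₂ x ≡ f x
  f₂x = trans (upd-other f₁ (regs σ #d) (λ e → <-irrefl (sym e) (<-≤-trans x<t (m≤m+n t 1))))
              (upd-other f (regs σ #v) (λ e → <-irrefl (sym e) x<t))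

  above : ∀ i → f₄ (t + i) ≡ f₃ (t + i)
  above i = upd-other f₃ t (λ e → <-irrefl e (<-≤-trans x<t (m≤m+n t i)))

  at-0 : f₄ t ≡ regs σ #v
  at-0 = trans (upd-other f₃ t (λ e → <-irrefl e x<t))
         (trans (upd-other f₂ _ (t≢t+ {1})) (trans (upd-other f₁ _ (t≢t+ {0})) (upd-same f t _)))

  at-1 : f₄ (t + 1) ≡ regs σ #d
  at-1 = trans (above 1) (trans (upd-other f₂ _ (t+-≢ {2} {1} λ ())) (upd-same f₁ (t + 1) _))

  at-2 : f₄ (t + 2) ≡ f x
  at-2 = trans (above 2) (trans (upd-same f₂ (t + 2) _) f₂x)

  τ : Store
  τ = setR (setA (setA (setA (setA σ $D t (regs σ #v)) $D (t + 1) (regs σ #d)) $D (t + 2) (f₂ x)) $D x t) #tail (t + 3)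

  labelled : Labelled τ n (addLabel Lab x (regs σ #v , regs σ #d))
  labelled = record { n≤tail = ≤-trans (n≤tail L) (m≤m+n t 3) ; chain = ch }
    where
    old : ∀ {p ls} → Chain f n t p ls → Chain f₄ n (t + 3) p ls
    old = chain-mono (λ i n≤i i<t → below i i<t λ e → <-irrefl (sym e) (<-≤-trans x<n n≤i)) (m≤m+n t 3)
    ch : ∀ y → y < n → Chain f₄ n (t + 3) (f₄ y) (addLabel Lab x (regs σ #v , regs σ #d) y)
    ch y y<n with x ≟ y
    ... | no ne = subst₂ (Chain f₄ n (t + 3)) (sym (below y (<-≤-trans y<n (n≤tail L)) λ e → ne (sym e)))
                    (sym (addLabel-other Lab _ ne)) (old (chain L y y<n))
    ... | yes refl = subst₂ (Chain f₄ n (t + 3)) (sym (upd-same f₃ x t)) (sym (addLabel-same Lab x _))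
                       (link (n≤tail L) ≤-refl at-0 at-1 (subst (λ z → Chain f₄ n (t + 3) z (Lab x)) (sym at-2) (old (chain L x y<n))))

  ex-emits : Ex emits σ 5 (λ ρ → ρ ≡ τ)
  ex-emits = ex-setA (ex-setA (ex-setA (ex-setA (ex-setR (ex-halt {T = 0} refl)))))

-- Used in both directions. With the source as `key`, the owner of a list becomes a hub of the
-- sources in it. With the vertex as `key`, the sources in a list become hubs of its owner. A
-- nonzero `bar` suppresses the labels of a key.
module Emission (key hub : Entry → ℕ) (bar : ℕ → ℕ) where

  emitted : List Entry → (ℕ → List (ℕ × ℕ)) → ℕ → List (ℕ × ℕ)
  emitted []      Lab = Lab
  emitted (q ∷ Q) Lab = branch (bar (key q)) (emitted Q Lab) (addLabel (emitted Q Lab) (key q) (hub q , dist q))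

  emitted-∈ : ∀ {Lab} Q {x l} → l ∈ emitted Q Lab x → l ∈ Lab x ⊎ (∃[ q ] q ∈ Q × key q ≡ x × l ≡ (hub q , dist q))
  emitted-∈ [] l∈ = inj₁ l∈
  emitted-∈ {Lab} (q ∷ Q) {x} l∈ with bar (key q)
  ... | suc _ = deeper (emitted-∈ Q l∈)
    where
    deeper : ∀ {l} → l ∈ Lab x ⊎ (∃[ p ] p ∈ Q × key p ≡ x × l ≡ (hub p , dist p)) → l ∈ Lab x ⊎ (∃[ p ] p ∈ q ∷ Q × key p ≡ x × l ≡ (hub p , dist p))
    deeper (inj₁ i)                 = inj₁ i
    deeper (inj₂ (p , i , e₁ , e₂)) = inj₂ (p , there i , e₁ , e₂)
  ... | zero with key q ≟ x
  ...   | no ne rewrite ≡ᵇ-≢ ne = deeper (emitted-∈ Q l∈)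
    where
    deeper : ∀ {l} → l ∈ Lab x ⊎ (∃[ p ] p ∈ Q × key p ≡ x × l ≡ (hub p , dist p)) → l ∈ Lab x ⊎ (∃[ p ] p ∈ q ∷ Q × key p ≡ x × l ≡ (hub p , dist p))
    deeper (inj₁ i)                 = inj₁ i
    deeper (inj₂ (p , i , e₁ , e₂)) = inj₂ (p , there i , e₁ , e₂)
  ...   | yes refl rewrite ≡ᵇ-refl (key q) with l∈
  ...     | here refl = inj₂ (q , here refl , refl , refl)
  ...     | there l∈′ with emitted-∈ Q l∈′
  ...       | inj₁ i                 = inj₁ i
  ...       | inj₂ (p , i , e₁ , e₂) = inj₂ (p , there i , e₁ , e₂)

  addLabel-⊆ : ∀ {Lab} z l {x m} → m ∈ Lab x → m ∈ addLabel Lab z l x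
  addLabel-⊆ z l {x} m∈ with z ≡ᵇ x
  ... | true  = there m∈
  ... | false = m∈

  emitted-⊆ : ∀ {Lab} Q {x l} → l ∈ Lab x → l ∈ emitted Q Lab x
  emitted-⊆ []      l∈ = l∈
  emitted-⊆ {Lab} (q ∷ Q) l∈ with bar (key q)
  ... | suc _ = emitted-⊆ Q l∈
  ... | zero  = addLabel-⊆ {emitted Q Lab} (key q) _ (emitted-⊆ {Lab} Q l∈)

  ∈-emitted : ∀ {Lab} Q {q} → q ∈ Q → bar (key q) ≡ 0 → (hub q , dist q) ∈ emitted Q Lab (key q)
  ∈-emitted (q ∷ Q) (here refl) b rewrite b | ≡ᵇ-refl (key q) = here refl
  ∈-emitted {Lab} (p ∷ Q) {q} (there i) b with bar (key p)
  ... | suc _ = ∈-emitted Q i b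
  ... | zero  = addLabel-⊆ {emitted Q Lab} (key p) _ (∈-emitted {Lab} Q i b)

  emitted-barred : ∀ {Lab} Q x → bar x ≢ 0 → emitted Q Lab x ≡ Lab x
  emitted-barred [] x b = refl
  emitted-barred (q ∷ Q) x b with bar (key q) in eq
  ... | suc _ = emitted-barred Q x b
  ... | zero with key q ≟ x
  ...   | yes refl = ⊥-elim (b eq)
  ...   | no ne rewrite ≡ᵇ-≢ ne = emitted-barred Q x b

  emitted-length : ∀ {Lab} Q x → length (emitted Q Lab x) ≤ length (Lab x) + length (sel x (map (λ q → key q , hub q) Q))
  emitted-length {Lab} [] x = m≤m+n _ 0
  emitted-length {Lab} (q ∷ Q) x with bar (key q) | key q ≟ x
  ... | suc _ | no ne rewrite ≡ᵇ-≢ ne = emitted-length {Lab} Q x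
  ... | suc _ | yes refl rewrite ≡ᵇ-refl (key q) = ≤-trans (emitted-length {Lab} Q x) (+-monoʳ-≤ (length (Lab x)) (n≤1+n _))
  ... | zero  | no ne rewrite ≡ᵇ-≢ ne = emitted-length {Lab} Q x
  ... | zero  | yes refl rewrite ≡ᵇ-refl (key q) = ≤-trans (s≤s (emitted-length {Lab} Q x)) (≤-reflexive (sym (+-suc (length (Lab x)) _)))

  module _ (kA hA : ℕ) (guard : Expr) (n : ℕ) (Q : List Entry) (<n : ∀ q → q ∈ Q → key q < n)
           (keeps-k : keepsArr kA (emitBody kA hA guard) ≡ true) (keeps-h : keepsArr hA (emitBody kA hA guard) ≡ true) where

    private
      body = emitBody kA hA guard

    ex-emit : ∀ σ Lab → Labelled σ n Lab → Queue σ Q → Stored (arrays σ kA) (map key Q) → Stored (arrays σ hA) (map hub Q) →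
      (∀ τ q → Frame body (setR σ #head 0) τ → q ∈ Q →
         ev (setR (setR (setR (setR τ #s (source q)) #x (key q)) #v (hub q)) #d (dist q)) guard ≡ bar (key q)) →
      Ex (emitP kA hA guard) σ (2 + length Q * 12)
        (λ τ → Labelled τ n (emitted Q Lab) × regs τ #tail ≤ regs σ #tail + length Q * 3)
    ex-emit σ Lab L Qσ stk sth gd = ex-weaken (≤-reflexive (cong (2 +_) (Sum-const 12 Q))) (λ _ z → z)
      (ex-setR (ex-loop #head (reg #end) body Q I (λ _ → 11) σ₀
        (λ done τ fr _ → trans (reg≡ fr #end refl) (end≡ Qσ))
        step′ refl (labelled-cong {σ} {σ₀} refl refl L , m≤m+n _ 0)))
      where
      σ₀ = setR σ #head 0
      I : List Entry → Store → Set
      I done τ = Labelled τ n (emitted done Lab) × regs τ #tail ≤ regs σ #tail + length done * 3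
      step′ : ∀ q todo done τ → (q ∷ todo) ʳ++ done ≡ Q → Frame body σ₀ τ → regs τ #head ≡ length done → I done τ →
              Ex body τ 11 (λ υ → regs υ #head ≡ suc (length done) × I (q ∷ done) υ)
      step′ q todo done τ eq fr h≡ (Lτ , t≤) = ex-setR (ex-setR (ex-setR (ex-setR (by-cases (bar (key q)) refl))))
        where
        h = regs τ #head
        read : ∀ a (g : Entry → ℕ) → arrays τ a ≡ arrays σ a → Stored (arrays σ a) (map g Q) → arrays τ a h ≡ g q
        read a g e st = trans (cong₂ (λ f i → f i) e h≡) (stored-map-at g todo q done (subst (λ xs → Stored (arrays σ a) (map g xs)) (sym eq) st))
        τ₁ = setR (setR (setR (setR τ #s (arrays τ $qs h)) #x (arrays τ kA h)) #v (arrays τ hA h)) #d (arrays τ $qd h)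
        x≡ : arrays τ kA h ≡ key q
        x≡ = read kA key (arr≡ fr kA keeps-k) stk
        v≡ : arrays τ hA h ≡ hub q
        v≡ = read hA hub (arr≡ fr hA keeps-h) sth
        d≡ : arrays τ $qd h ≡ dist q
        d≡ = read $qd dist (arr≡ fr $qd refl) (qd≡ Qσ)
        s≡ : arrays τ $qs h ≡ source q
        s≡ = read $qs source (arr≡ fr $qs refl) (qs≡ Qσ)
        q∈ : q ∈ Q
        q∈ = subst (q ∈_) eq (∈-ʳ++ʳ todo (here refl))
        guard≡ : ev τ₁ guard ≡ bar (key q)
        guard≡ = trans (cong₂ (λ (a , b) (c , d) → ev (setR (setR (setR (setR τ #s a) #x b) #v c) #d d) guard) (cong₂ _,_ s≡ x≡) (cong₂ _,_ v≡ d≡)) (gd τ q fr q∈)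
        module E = EmitStep τ₁ (labelled-cong {τ} {τ₁} refl refl Lτ) (subst (_< n) (sym x≡) (<n q q∈))
        by-cases : ∀ b → bar (key q) ≡ b → Ex (ite guard [] emits ∷ increment #head ∷ []) τ₁ 7 (λ υ → regs υ #head ≡ suc (length done) × I (q ∷ done) υ)
        by-cases (suc b) e = ex-weaken (m≤m+n 2 5) (λ _ z → z)
          (ex-ite₁ {P = λ ρ → ρ ≡ τ₁} (λ z → 0≢1+n (trans (sym z) (trans guard≡ e))) (ex-halt {T = 0} refl)
            λ { ρ refl → ex-setR (ex-halt {T = 0} (trans (cong (_+ 1) h≡) (+-comm _ 1)
              , subst (Labelled _ n) (sym (cong (λ z → branch z (emitted done Lab) (addLabel (emitted done Lab) (key q) (hub q , dist q))) e)) (labelled-cong {τ} refl refl Lτ)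
              , ≤-trans t≤ (+-monoʳ-≤ (regs σ #tail) (m≤n+m _ 3)))) })
        by-cases zero e = ex-ite₀ {P = λ ρ → ρ ≡ E.τ} (trans guard≡ e) E.ex-emits
            λ { ρ refl → ex-setR (ex-halt {T = 0} (trans (cong (_+ 1) h≡) (+-comm _ 1)
              , subst (Labelled _ n) (trans (cong₂ (λ x l → addLabel (emitted done Lab) x l) x≡ (cong₂ _,_ v≡ d≡)) (sym (cong (λ z → branch z (emitted done Lab) (addLabel (emitted done Lab) (key q) (hub q , dist q))) e)))
                  (labelled-cong {E.τ} refl refl E.labelled)
              , ≤-trans (+-monoˡ-≤ 3 t≤) (≤-reflexive (trans (+-assoc (regs σ #tail) _ 3) (cong (regs σ #tail +_) (+-comm _ 3)))))) }

-- Sources that occur in more than K lists.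

module HeavySpec (K r : ℕ) (Q : List Entry) where

  heavies : List ℕ → List ℕ
  heavies []      = []
  heavies (s ∷ S) = branch (⟦ less ⟧ K (length (sel s (SV Q)))) (s ∷ heavies S) (heavies S)

  -- A heavy source accounts for more than K entries of the queue.
  heavies-bound : ∀ S → length (heavies S) * K ≤ Sum (λ s → length (sel s (SV Q))) S
  heavies-bound [] = z≤n
  heavies-bound (s ∷ S) with K <? length (sel s (SV Q))
  ... | yes lt rewrite <ᵇ-true lt = +-mono-≤ (<⇒≤ lt) (heavies-bound S)
  ... | no ≮ rewrite <ᵇ-false (≮⇒≥ ≮) = ≤-trans (heavies-bound S) (m≤n+m _ (length (sel s (SV Q))))

  heavies-length : ∀ S → length (heavies S) ≤ length S
  heavies-length [] = z≤n
  heavies-length (s ∷ S) with ⟦ less ⟧ K (length (sel s (SV Q)))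
  ... | suc _ = s≤s (heavies-length S)
  ... | zero  = m≤n⇒m≤1+n (heavies-length S)

  heavies-⊆ : ∀ S {s} → s ∈ heavies S → s ∈ S
  heavies-⊆ (z ∷ S) s∈ with ⟦ less ⟧ K (length (sel z (SV Q)))
  ... | zero = there (heavies-⊆ S s∈)
  heavies-⊆ (z ∷ S) (here refl) | suc _ = here refl
  heavies-⊆ (z ∷ S) (there s∈)  | suc _ = there (heavies-⊆ S s∈)

  heavies-∈ : ∀ S {s} → s ∈ S → ⟦ less ⟧ K (length (sel s (SV Q))) ≢ 0 → s ∈ heavies S
  heavies-∈ (s ∷ S) (here refl) h with ⟦ less ⟧ K (length (sel s (SV Q)))
  ... | zero  = ⊥-elim (h refl)
  ... | suc _ = here refl
  heavies-∈ (z ∷ S) (there s∈) h with ⟦ less ⟧ K (length (sel z (SV Q)))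
  ... | zero  = heavies-∈ S s∈ h
  ... | suc _ = there (heavies-∈ S s∈ h)

  ex-heavy : ∀ σ S → regs σ #K ≡ K → regs σ #r ≡ r → regs σ #src ≡ length S → Stored (arrays σ $qs) S → Tagged σ r Q →
    Row (arrays σ $len) (arrays σ $lst) (r + 1) [] →
    Ex heavyP σ (2 + length S * 6) (λ τ → Row (arrays τ $len) (arrays τ $lst) (r + 1) (heavies S) ×
      (∀ key xs → key ≢ r + 1 → Row (arrays σ $len) (arrays σ $lst) key xs → Row (arrays τ $len) (arrays τ $lst) key xs))
  ex-heavy σ S K≡ refl src≡ st t row = ex-weaken (≤-reflexive (cong (2 +_) (Sum-const 6 S))) (λ _ z → z)
    (ex-setR (ex-loop #i (reg #src) heavyBody S I (λ _ → 5) (setR σ #i 0) (λ done τ fr _ → trans (reg≡ fr #src refl) src≡)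
      body refl (row , λ key xs ne R → R)))
    where
    I : List ℕ → Store → Set
    I done τ = Row (arrays τ $len) (arrays τ $lst) (r + 1) (heavies done) ×
      (∀ key xs → key ≢ r + 1 → Row (arrays σ $len) (arrays σ $lst) key xs → Row (arrays τ $len) (arrays τ $lst) key xs)
    body : ∀ s todo done τ → (s ∷ todo) ʳ++ done ≡ S → Frame heavyBody (setR σ #i 0) τ → regs τ #i ≡ length done → I done τ →
           Ex heavyBody τ 5 (λ υ → regs υ #i ≡ suc (length done) × I (s ∷ done) υ)
    body s todo done τ eq fr i≡ (R , rows) = ex-setR (by-cases (⟦ less ⟧ K (length (sel s (SV Q)))) refl)
      where
      s≡ : arrays τ $qs (regs τ #i) ≡ s
      s≡ = trans (cong₂ (λ f i → f i) (arr≡ fr $qs refl) i≡) (stored-at todo s done (subst (Stored _) (sym eq) st))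
      r≡ : regs τ #r ≡ r
      r≡ = reg≡ fr #r refl
      τ₁ = setR τ #s (arrays τ $qs (regs τ #i))
      guard≡ : ev τ₁ isHeavy ≡ ⟦ less ⟧ K (length (sel s (SV Q)))
      guard≡ = cong₂ ⟦ less ⟧ (trans (reg≡ fr #K refl) K≡)
        (trans (cong₂ (λ f i → f i) (arr≡ fr $cnt refl) (cong₂ pair r≡ s≡)) (proj₁ (inv≡ t s)))
      o = regs τ #r + 1
      o≡ : o ≡ r + 1
      o≡ = cong (_+ 1) r≡
      τ₂ = setA (setA τ₁ $lst (pair o (arrays τ $len o)) (regs τ₁ #s)) $len o (arrays τ $len o + 1)
      pushed : Row (arrays τ₂ $len) (arrays τ₂ $lst) (r + 1) (s ∷ heavies done)
      pushed = subst₂ (λ a b → Row (arrays τ₂ $len) (arrays τ₂ $lst) a (b ∷ heavies done)) o≡ s≡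
        (row-push {arrays τ $len} {arrays τ $lst} o (regs τ₁ #s) (subst (λ a → Row (arrays τ $len) (arrays τ $lst) a (heavies done)) (sym o≡) R))
      by-cases : ∀ b → ⟦ less ⟧ K (length (sel s (SV Q))) ≡ b →
        Ex (ite isHeavy (rowPush $len $lst (reg #r ⟪ add ⟫ const 1) (reg #s)) [] ∷ increment #i ∷ []) τ₁ 4 (λ υ → regs υ #i ≡ suc (length done) × I (s ∷ done) υ)
      by-cases zero e = ex-weaken (m≤m+n 2 2) (λ _ z → z)
        (ex-ite₀ {P = λ ρ → ρ ≡ τ₁} (trans guard≡ e) (ex-halt {T = 0} refl)
          λ { ρ refl → ex-setR (ex-halt {T = 0} (trans (cong (_+ 1) i≡) (+-comm _ 1)
            , subst (Row (arrays τ $len) (arrays τ $lst) (r + 1)) (sym (cong (λ z → branch z (s ∷ heavies done) (heavies done)) e)) R , rows)) })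
      by-cases (suc b) e =
        ex-ite₁ {P = λ ρ → ρ ≡ τ₂} (λ z → 0≢1+n (trans (sym z) (trans guard≡ e))) (ex-setA (ex-setA (ex-halt {T = 0} refl)))
          λ { ρ refl → ex-setR (ex-halt {T = 0} (trans (cong (_+ 1) i≡) (+-comm _ 1)
            , subst (Row (arrays τ₂ $len) (arrays τ₂ $lst) (r + 1)) (sym (cong (λ z → branch z (s ∷ heavies done) (heavies done)) e)) pushed
            , λ key xs ne X → row-other {arrays τ $len} {arrays τ $lst} o (regs τ₁ #s) (λ z → ne (trans (sym z) o≡)) (rows key xs ne X))) }

-- Walks in a symmetric graph.

walk-cons : ∀ {H u v w ℓ} → (u , v) ∈ H → Walk H v w ℓ → Walk H u w (suc ℓ)
walk-cons e nil         = snoc nil e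
walk-cons e (snoc w e′) = snoc (walk-cons e w) e′

walk-sym : ∀ {H} → Symmetric H → ∀ {u v ℓ} → Walk H u v ℓ → Walk H v u ℓ
walk-sym sm nil        = nil
walk-sym sm (snoc w e) = walk-cons (sm e) (walk-sym sm w)

walk-++ : ∀ {H u v w a b} → Walk H u v a → Walk H v w b → Walk H u w (b + a)
walk-++ p nil        = p
walk-++ p (snoc q e) = snoc (walk-++ p q) e

walk-split : ∀ {H u v} a b → Walk H u v (a + b) → ∃[ w ] Walk H u w b × Walk H w v a
walk-split zero b w = _ , w , nil
walk-split (suc a) b (snoc w e) with walk-split a b w
... | x , p , q = x , p , snoc q e

-- Reading the input: adjacency lists and the cube root.

edgeBody initP : Program
edgeBody =
  setReg #x (cell $in (reg #i ⟪ add ⟫ reg #i)) ∷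
  setReg #v (cell $in ((reg #i ⟪ add ⟫ reg #i) ⟪ add ⟫ const 1)) ∷
  rowPush $deg $adj (reg #x) (reg #v) ++
  rowPush $deg $adj (reg #v) (reg #x) ++
  rowPush $len $lst (const 3) (reg #x) ++
  rowPush $len $lst (const 3) (reg #v) ++
  increment #i ∷ []

rootLoop : Program
rootLoop = while (((reg #K ⟪ mul ⟫ reg #K) ⟪ mul ⟫ reg #K) ⟪ less ⟫ reg #n) (increment #K ∷ []) ∷ []

initP =
  setReg #n (reg #tail) ∷
  loop #i (reg 1) edgeBody ++
  rootLoop ++
  setReg #r (const 3) ∷
  setReg #k (reg #K) ∷ []

-- Newest first, in the order in which `edgeBody` pushes. The first components are then also the
-- list with key 3, the first W, in which a vertex appears once for each incident edge.
halves : List (ℕ × ℕ) → List (ℕ × ℕ)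
halves []             = []
halves ((u , v) ∷ es) = (v , u) ∷ (u , v) ∷ halves es

halves-symmetric : ∀ es → Symmetric (halves es)
halves-symmetric (_ ∷ es) (here refl)         = there (here refl)
halves-symmetric (_ ∷ es) (there (here refl)) = here refl
halves-symmetric (_ ∷ es) (there (there i))   = there (there (halves-symmetric es i))

halves-length : ∀ es → length (halves es) ≡ 2 * length es
halves-length []       = refl
halves-length (_ ∷ es) = trans (cong (λ l → suc (suc l)) (halves-length es)) (sym (cong suc (+-suc (length es) _)))

ends : List (ℕ × ℕ) → List ℕ
ends []             = []
ends ((u , v) ∷ es) = u ∷ v ∷ ends es

nth-ends : ∀ done rest j → nth (ends (done ʳ++ rest)) (length done + length done + j) ≡ nth (ends rest) j
nth-ends []         rest j = refl
nth-ends (e ∷ done) rest j = trans (cong (nth (ends (done ʳ++ (e ∷ rest)))) (lem (length done) j)) (nth-ends done (e ∷ rest) (2 + j))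
  where
  lem : ∀ l j → suc l + suc l + j ≡ l + l + (2 + j)
  lem = solve-∀

adjacency-push : ∀ {c d} {H : List (ℕ × ℕ)} a b → (∀ v → Row c d v (sel v H)) →
                 ∀ v → Row (c [ a ↦ c a + 1 ]) (d [ pair a (c a) ↦ b ]) v (sel v ((a , b) ∷ H))
adjacency-push {c} {d} {H} a b rows v with a ≟ v
... | yes refl = subst (Row (c [ a ↦ c a + 1 ]) (d [ pair a (c a) ↦ b ]) a) (sym (sel-yes a b H)) (row-push {c} {d} a b (rows a))
... | no ne    = subst (Row (c [ a ↦ c a + 1 ]) (d [ pair a (c a) ↦ b ]) v) (sym (sel-no b H ne)) (row-other {c} {d} a b ne (rows v))

ex-link : ∀ y z σ H → Adjacency σ H → Ex (rowPush $deg $adj (reg y) (reg z)) σ 2 (λ τ → Adjacency τ ((regs σ y , regs σ z) ∷ H))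
ex-link y z σ H adj = ex-setA (ex-setA (ex-halt (adjacency-push {arrays σ $deg} {arrays σ $adj} {H} (regs σ y) (regs σ z) adj)))

ex-list : ∀ y σ xs → Row (arrays σ $len) (arrays σ $lst) 3 xs → (∀ key → key ≢ 3 → Row (arrays σ $len) (arrays σ $lst) key []) →
  Ex (rowPush $len $lst (const 3) (reg y)) σ 2 (λ τ → Row (arrays τ $len) (arrays τ $lst) 3 (regs σ y ∷ xs) ×
    (∀ key → key ≢ 3 → Row (arrays τ $len) (arrays τ $lst) key []))
ex-list y σ xs row rows = ex-setA (ex-setA (ex-halt (row-push {arrays σ $len} {arrays σ $lst} 3 (regs σ y) row ,
  λ key ne → row-other {arrays σ $len} {arrays σ $lst} 3 (regs σ y) (λ e → ne (sym e)) (rows key ne))))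

record Root (n : ℕ) : Set where
  field
    root  : ℕ
    above : n ≤ root * root * root
    below : ∀ j → j < root → j * j * j < n

cube-root : ∀ n → Root n
cube-root n = go n 0 (≤-reflexive (sym (+-identityʳ n))) (λ j ())
  where
  n≤n³ : ∀ n → n ≤ n * n * n
  n≤n³ zero      = z≤n
  n≤n³ n@(suc _) = ≤-trans (m≤n*m n n) (m≤m*n (n * n) n)
  go : ∀ fuel K → n ≤ fuel + K → (∀ j → j < K → j * j * j < n) → Root n
  go fuel K le bl with n ≤? K * K * K
  ... | yes p = record { root = K ; above = p ; below = bl }
  -- Without fuel n is at most K, and K is at most its cube.
  go zero K le bl | no p = ⊥-elim (p (≤-trans le (n≤n³ K)))
  go (suc fuel) K le bl | no p = go fuel (suc K) (≤-trans le (≤-reflexive (sym (+-suc fuel K)))) bl′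
    where
    bl′ : ∀ j → j < suc K → j * j * j < n
    bl′ j j< with j ≟ K
    ... | yes refl = ≰⇒> p
    ... | no ne    = bl j (≤∧≢⇒< (≤-pred j<) ne)

open Root public

ex-root : ∀ n (ρ : Root n) σ → regs σ #n ≡ n → regs σ #K ≡ 0 →
          Ex rootLoop σ (1 + root ρ * 2) (λ τ → regs τ #K ≡ root ρ)
ex-root n ρ σ n≡ K0 = go (root ρ) 0 σ (+-identityʳ _) n≡ K0
  where
  go : ∀ fuel K σ → fuel + K ≡ root ρ → regs σ #n ≡ n → regs σ #K ≡ K → Ex rootLoop σ (1 + fuel * 2) (λ τ → regs τ #K ≡ root ρ)
  go zero K σ refl n≡ refl = ex-exit (less-false (≤-trans (≤-reflexive n≡) (above ρ))) refl
  go (suc fuel) K σ eq n≡ refl = ex-again (less-true (subst (K * K * K <_) (sym n≡) (below ρ K (≤-trans (s≤s (m≤n+m K fuel)) (≤-reflexive eq)))))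
    (ex-setR {T = 0} (ex-halt {Q = λ τ → regs τ #n ≡ n × regs τ #K ≡ suc K} (n≡ , +-comm _ 1)))
    λ τ (n≡′ , K≡) → go fuel (suc K) τ (trans (+-suc fuel K) eq) n≡′ K≡

Fresh : Store → ℕ → Set
Fresh σ r = Tagged σ r [] × (∀ v → arrays σ $hit (pair r v) ≡ 0)

module InitSpec (n : ℕ) (es : List (ℕ × ℕ)) where

  σ₀ : Store
  σ₀ = initial n (length es) (ends es)

  -- The edges are read in input order, and the tables list the newest first, hence the reversal.
  H : List (ℕ × ℕ)
  H = halves (reverse es)

  record Init-post (τ : Store) : Set where
    field
      tail≡ : regs τ #tail ≡ n
      n≡    : regs τ #n ≡ n
      K≡    : regs τ #K ≡ root (cube-root n)
      k≡    : regs τ #k ≡ root (cube-root n)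
      r≡    : regs τ #r ≡ 3
      out≡  : regs τ #out ≡ 0
      adj   : Adjacency τ H
      row   : Row (arrays τ $len) (arrays τ $lst) 3 (map proj₁ H)
      rows  : ∀ key → key ≢ 3 → Row (arrays τ $len) (arrays τ $lst) key []
      fresh : ∀ r → Fresh τ r
      D≡    : ∀ x → arrays τ $D x ≡ 0

  I : List (ℕ × ℕ) → Store → Set
  I done τ = (∀ v → Row (arrays τ $deg) (arrays τ $adj) v (sel v (halves done)))
           × Row (arrays τ $len) (arrays τ $lst) 3 (map proj₁ (halves done))
           × (∀ key → key ≢ 3 → Row (arrays τ $len) (arrays τ $lst) key [])

  edge-step : ∀ e todo done τ → (e ∷ todo) ʳ++ done ≡ reverse es → Frame edgeBody (setR σ₀ #n n) τ → regs τ #i ≡ length done → I done τ →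
              Ex edgeBody τ 11 (λ υ → regs υ #i ≡ suc (length done) × I (e ∷ done) υ)
  edge-step (a , b) todo done τ eq fr i≡ (adj , row , rows) =
    ex-setR (ex-setR (ex-++ {p = rowPush $deg $adj (reg #x) (reg #v)} (ex-frame (ex-link #x #v τ₁ (halves done) adj))
    λ τ₂ (adj₂ , fr₂) → ex-++ {p = rowPush $deg $adj (reg #v) (reg #x)} (ex-frame (ex-link #v #x τ₂ ((x , v) ∷ halves done) adj₂))
    λ τ₃ (adj₃ , fr₃) → ex-++ {p = rowPush $len $lst (const 3) (reg #x)} (ex-frame (ex-list #x τ₃ (map proj₁ (halves done))
      (row-cong (trans (arr≡ fr₃ $len refl) (arr≡ fr₂ $len refl)) (trans (arr≡ fr₃ $lst refl) (arr≡ fr₂ $lst refl)) row)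
      λ key ne → row-cong (trans (arr≡ fr₃ $len refl) (arr≡ fr₂ $len refl)) (trans (arr≡ fr₃ $lst refl) (arr≡ fr₂ $lst refl)) (rows key ne)))
    λ τ₄ ((row₄ , rows₄) , fr₄) → ex-++ {p = rowPush $len $lst (const 3) (reg #v)} (ex-frame (ex-list #v τ₄ (regs τ₃ #x ∷ map proj₁ (halves done)) row₄ rows₄))
    λ τ₅ ((row₅ , rows₅) , fr₅) → ex-setR (ex-halt {T = 0}
      ( trans (cong (_+ 1) (trans (reg≡ fr₅ #i refl) (trans (reg≡ fr₄ #i refl) (trans (reg≡ fr₃ #i refl) (trans (reg≡ fr₂ #i refl) i≡))))) (+-comm _ 1)
      , (λ y → row-cong (trans (arr≡ fr₅ $deg refl) (arr≡ fr₄ $deg refl)) (trans (arr≡ fr₅ $adj refl) (arr≡ fr₄ $adj refl))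
          (subst₂ (λ p q → Row (arrays τ₃ $deg) (arrays τ₃ $adj) y (sel y (p ∷ q ∷ halves done)))
            (cong₂ _,_ (trans (reg≡ fr₂ #v refl) v≡) (trans (reg≡ fr₂ #x refl) x≡)) (cong₂ _,_ x≡ v≡) (adj₃ y)))
      , subst₂ (λ p q → Row (arrays τ₅ $len) (arrays τ₅ $lst) 3 (p ∷ q ∷ map proj₁ (halves done)))
          (trans (reg≡ fr₄ #v refl) (trans (reg≡ fr₃ #v refl) (trans (reg≡ fr₂ #v refl) v≡)))
          (trans (reg≡ fr₃ #x refl) (trans (reg≡ fr₂ #x refl) x≡)) row₅
      , rows₅ ))))
    where
    x = arrays τ $in (regs τ #i + regs τ #i)
    v = arrays τ $in (regs τ #i + regs τ #i + 1)
    τ₁ = setR (setR τ #x x) #v v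
    es≡ : es ≡ done ʳ++ ((a , b) ∷ todo)
    es≡ = trans (sym (reverse-involutive es)) (trans (cong reverse (sym eq)) (trans (ʳ++-ʳ++ ((a , b) ∷ todo)) (cong (done ʳ++_) (++-identityʳ ((a , b) ∷ todo)))))
      where open import Data.List.Properties using (reverse-involutive; ʳ++-ʳ++; ++-identityʳ)
    read : ∀ j → arrays τ $in (regs τ #i + regs τ #i + j) ≡ nth (ends ((a , b) ∷ todo)) j
    read j = trans (cong₂ (λ f i → f (i + i + j)) (arr≡ fr $in refl) i≡)
               (trans (cong (λ l → nth (ends l) (length done + length done + j)) es≡) (nth-ends done ((a , b) ∷ todo) j))
    x≡ : x ≡ a
    x≡ = trans (cong (arrays τ $in) (sym (+-identityʳ _))) (read 0)
    v≡ : v ≡ b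
    v≡ = read 1

  ex-init : Ex initP σ₀ (5 + length es * 12 + root (cube-root n) * 2) Init-post
  ex-init = ex-weaken time (λ _ z → z) (ex-setR (ex-++ {p = loop #i (reg 1) edgeBody}
    (ex-frame (ex-loop #i (reg 1) edgeBody (reverse es) I (λ _ → 11) σ₁
      (λ done τ fr _ → trans (reg≡ fr 1 refl) (sym (length-reverse es)))
      edge-step refl ((λ v → refl , tt) , (refl , tt) , λ key ne → refl , tt)))
    λ τ ((adj , row , rows) , fr) → ex-++ {p = rootLoop} (ex-frame (ex-root n (cube-root n) τ (reg≡ fr #n refl) (reg≡ fr #K refl)))
    λ υ (K≡ , fr′) → ex-setR (ex-setR (ex-halt {T = 0} (record
      { tail≡ = trans (reg≡ fr′ #tail refl) (reg≡ fr #tail refl)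
      ; n≡    = trans (reg≡ fr′ #n refl) (reg≡ fr #n refl)
      ; K≡    = K≡
      ; k≡    = K≡
      ; r≡    = refl
      ; out≡  = trans (reg≡ fr′ #out refl) (reg≡ fr #out refl)
      ; adj   = λ v → row-cong (arr≡ fr′ $deg refl) (arr≡ fr′ $adj refl) (adj v)
      ; row   = row-cong (arr≡ fr′ $len refl) (arr≡ fr′ $lst refl) row
      ; rows  = λ key ne → row-cong (arr≡ fr′ $len refl) (arr≡ fr′ $lst refl) (rows key ne)
      ; fresh = λ r → record
          { seen≡ = λ x s → zero≡ fr fr′ $seen refl refl refl _
          ; size≡ = λ x → zero≡ fr fr′ $size refl refl refl _
          ; inv≡  = λ s → zero≡ fr fr′ $cnt refl refl refl _ , tt }
        , λ v → zero≡ fr fr′ $hit refl refl refl _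
      ; D≡    = λ x → zero≡ fr fr′ $D refl refl refl x
      })))))
    where
    open import Data.List.Properties using (length-reverse)
    σ₁ = setR σ₀ #n n
    zero≡ : ∀ {p q τ υ} → Frame p σ₁ τ → Frame q τ υ → ∀ a → keepsArr a p ≡ true → keepsArr a q ≡ true →
            arrays σ₁ a ≡ (λ _ → 0) → ∀ i → arrays υ a i ≡ 0
    zero≡ fr fr′ a k k′ z i = cong (λ f → f i) (trans (arr≡ fr′ a k′) (trans (arr≡ fr a k) z))
    lem : ∀ a b → 1 + (suc (a * 12) + (1 + b * 2 + 2)) ≡ 5 + a * 12 + b * 2
    lem = solve-∀
    time : 1 + (suc (Sum (λ _ → 12) (reverse es)) + (1 + root (cube-root n) * 2 + 2)) ≤ 5 + length es * 12 + root (cube-root n) * 2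
    time = ≤-reflexive (trans (cong (λ t → 1 + (suc t + (1 + root (cube-root n) * 2 + 2))) (trans (Sum-const 12 (reverse es)) (cong (_* 12) (length-reverse es))))
             (lem (length es) (root (cube-root n))))

tagged-arrays : ∀ {σ τ r Q} → arrays τ $seen ≡ arrays σ $seen → arrays τ $size ≡ arrays σ $size → arrays τ $cnt ≡ arrays σ $cnt →
                arrays τ $inv ≡ arrays σ $inv → Tagged σ r Q → Tagged τ r Q
tagged-arrays {r = r} e₁ e₂ e₃ e₄ t = record
  { seen≡ = λ x s → trans (cong (λ f → f (pair (pair r x) s)) e₁) (seen≡ t x s)
  ; size≡ = λ x → trans (cong (λ f → f (pair r x)) e₂) (size≡ t x)
  ; inv≡  = λ s → row-cong e₃ e₄ (inv≡ t s) }

queue-arrays : ∀ {σ τ Q} → regs τ #end ≡ regs σ #end → arrays τ $qv ≡ arrays σ $qv → arrays τ $qs ≡ arrays σ $qs →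
               arrays τ $qd ≡ arrays σ $qd → Queue σ Q → Queue τ Q
queue-arrays e₁ e₂ e₃ e₄ u = record
  { end≡ = trans e₁ (end≡ u)
  ; qv≡  = subst (λ f → Stored f _) (sym e₂) (qv≡ u)
  ; qs≡  = subst (λ f → Stored f _) (sym e₃) (qs≡ u)
  ; qd≡  = subst (λ f → Stored f _) (sym e₄) (qd≡ u) }

keeps-tags : Program → Bool
keeps-tags p = keepsArr $seen p ∧ keepsArr $size p ∧ keepsArr $cnt p ∧ keepsArr $inv p

tagged-frame : ∀ p {σ τ r Q} → keeps-tags p ≡ true → Frame p σ τ → Tagged σ r Q → Tagged τ r Q
tagged-frame p e fr =
  let (a₁ , e₁) = ∧-true {keepsArr $seen p} e ; (a₂ , e₂) = ∧-true {keepsArr $size p} e₁ ; (a₃ , a₄) = ∧-true {keepsArr $cnt p} e₂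
  in tagged-arrays (arr≡ fr $seen a₁) (arr≡ fr $size a₂) (arr≡ fr $cnt a₃) (arr≡ fr $inv a₄)

fresh-frame : ∀ p {σ τ r} → keeps-tags p ≡ true → keepsArr $hit p ≡ true → Frame p σ τ → Fresh σ r → Fresh τ r
fresh-frame p {r = r} e e′ fr (t , h) = tagged-frame p e fr t , λ v → trans (cong (λ f → f (pair r v)) (arr≡ fr $hit e′)) (h v)

fresh-regs : ∀ {σ τ r} → arrays τ ≡ arrays σ → Fresh σ r → Fresh τ r
fresh-regs {r = r} e (t , h) = tagged-regs e t , λ v → trans (cong (λ f → f $hit (pair r v)) e) (h v)

-- The complete preprocessing program.

selectP roundBody leftBody leftP preprocessP : Program
selectP = nearP ++ hitP
roundBody =
  selectP ++ heavyP ++ emitP $qs $qv isHeavy ++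
  increment #r ∷
  setReg #k (reg #k ⟪ div ⟫ const 2) ∷ []
leftBody =
  setReg #s (cell $lst (pairE (reg #r) (reg #i))) ∷
  rowPush $len $lst (const 0) (reg #s) ++
  increment #i ∷ []
leftP =
  setReg #i (const 0) ∷
  loop #i (cell $len (reg #r)) leftBody
preprocessP =
  initP ++
  while (reg #k) roundBody ∷
  leftP ++
  setReg #k (reg #K) ∷
  setReg #r (const 0) ∷
  setReg #out (const 1) ∷
  selectP ++
  emitP $qv $qs (const 0) ++
  -- One more than the size of A₂, so that no list fills and this search is not truncated.
  setReg #k (cell $len (const 1) ⟪ add ⟫ const 1) ∷
  setReg #r (const 1) ∷
  nearP ++
  emitP $qv $qs (const 0)

-- Nearest lists together with a hitting set, and what labels guarantee.

module Phases (n : ℕ) (H : List (ℕ × ℕ)) (sm : Symmetric H) (H<n : ∀ {a b} → (a , b) ∈ H → a < n) (L : ℕ) (n<2^L : n < 2 ^ L) where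

  V : List ℕ
  V = map proj₁ H

  V<n : ∀ {a} → a ∈ V → a < n
  V<n a∈ with ∈-map⁻ proj₁ a∈
  ... | _ , e , refl = H<n e

  module _ {W k Q} (W⊆ : ∀ w → w ∈ W → w ∈ V) (N : Nearest H W k Q) where

    open Nearest N

    nearest-V : ∀ {q} → q ∈ Q → vertex q ∈ V
    nearest-V q∈ = walk-end H sm (W⊆ _ (seeds-⊆ k W (sourced q∈))) (walk q∈)

    nearest-size : length Q ≤ length H * k
    nearest-size = ≤-trans (size≤ H Q V table λ q q∈ → nearest-V q∈) (≤-reflexive (cong (_* k) (length-map proj₁ H)))

    nearest-size-n : length Q ≤ n * k
    nearest-size-n = ≤-trans (size≤ H Q (downFrom n) table λ q q∈ → ∈-downFrom (V<n (nearest-V q∈))) (≤-reflexive (cong (_* k) (length-downFrom n)))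

  select-cost : ℕ → ℕ → ℕ
  select-cost a b = 8 + a * 17 + 22 * b + L * (4 + a * 11 + b * 9)

  record Selected (F : ℕ → Set) (W : List ℕ) (k r out : ℕ) (R₀ : List ℕ) (σ τ : Store) : Set where
    field
      Q       : List Entry
      C       : List ℕ
      nearest : Nearest H W k Q
      tagged  : Tagged τ r Q
      queue   : Queue τ Q
      src≡    : regs τ #src ≡ length (map source (seeds k W))
      sources : Stored (arrays τ $qs) (map source (seeds k W))
      row     : Row (arrays τ $len) (arrays τ $lst) out (C ++ R₀)
      rows    : ∀ key xs → key ≢ out → Row (arrays σ $len) (arrays σ $lst) key xs → Row (arrays τ $len) (arrays τ $lst) key xs
      fresh   : ∀ r′ → F r′ → r′ ≢ r → Fresh τ r′
      few     : length C * k ≤ 2 * length (map source (seeds k W)) * L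
      hitting : ∀ v → length (at v Q) ≡ k → ∃[ s ] s ∈ C × ∃[ d ] entry v s d ∈ Q
      chosen  : ∀ s → s ∈ C → s ∈ W

  ex-select : ∀ F W k r out R₀ σ → 1 ≤ k → (∀ w → w ∈ W → w ∈ V) → regs σ #r ≡ r → regs σ #k ≡ k → regs σ #out ≡ out → regs σ #n ≡ n →
    Adjacency σ H → Row (arrays σ $len) (arrays σ $lst) r W → Row (arrays σ $len) (arrays σ $lst) out R₀ →
    Fresh σ r → (∀ r′ → F r′ → Fresh σ r′) →
    Ex selectP σ (select-cost (length W) (length H * k)) (Selected F W k r out R₀ σ)
  ex-select F W k r out R₀ σ 1≤k W⊆ r≡ k≡ out≡ n≡ adj row rowOut fr fresh =
    ex-weaken time (λ _ z → z) (ex-++ {p = nearP}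
      (ex-frame (NearSpec.ex-near H sm W W⊆ k r F σ r≡ k≡ adj row (proj₁ fr) λ r′ f _ → proj₁ (fresh r′ f)))
      after-near)
    where
    S = map source (seeds k W)
    hit-cost : ℕ
    hit-cost = 2 + L * (4 + length W * 11 + length H * k * 9)
    after-near : ∀ τ → NearSpec.Near-post H sm W W⊆ k r F τ × Frame nearP σ τ → Ex hitP τ hit-cost (Selected F W k r out R₀ σ)
    after-near τ (P , frN) = ex-weaken cheaper finish (ex-frame (Hit.ex-hit L n<2^L context (trans (reg≡ frN #n refl) n≡)
        (row-cong (arr≡ frN $len refl) (arr≡ frN $lst refl) rowOut)
        (λ v → trans (cong (λ f → f (pair r v)) (arr≡ frN $hit refl)) (proj₂ fr v))))
      where
      open NearSpec.Near-post P
      module N = Nearest nearest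
      module Hit = HitSpec k n r out Q N.table S (seeds-distinct k W) N.sourced (λ q∈ → V<n (nearest-V W⊆ nearest q∈)) τ R₀
      context : Hit.Context τ
      context = record { r≡ = trans (reg≡ frN #r refl) r≡ ; k≡ = trans (reg≡ frN #k refl) k≡ ; out≡ = trans (reg≡ frN #out refl) out≡
                       ; src≡ = src≡ ; tagged = Searching.tagged searching ; qs≡ = sources }
      cheaper : 2 + L * (4 + length S * 11 + length Q * 9) ≤ hit-cost
      cheaper = +-monoʳ-≤ 2 (*-monoʳ-≤ L (+-mono-≤ (+-monoʳ-≤ 4 (*-monoˡ-≤ 11 (seeds-length k W))) (*-monoˡ-≤ 9 (nearest-size W⊆ nearest))))
      finish : ∀ υ → (∃[ C ] Hit.Hit-post L υ [] C) × Frame hitP τ υ → Selected F W k r out R₀ σ υ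
      finish υ ((C , HP) , frH) = record
        { Q = Q ; C = C ; nearest = nearest
        ; tagged  = tagged-frame hitP refl frH (Searching.tagged searching)
        ; queue   = queue-arrays (reg≡ frH #end refl) (arr≡ frH $qv refl) (arr≡ frH $qs refl) (arr≡ frH $qd refl) (Searching.queue searching)
        ; src≡    = trans (reg≡ frH #src refl) src≡
        ; sources = subst (λ f → Stored f S) (sym (arr≡ frH $qs refl)) sources
        ; row     = Hit.Hitting.row (Hit.hitting HP)
        ; rows    = λ key xs ne R → Hit.Hitting.rows (Hit.hitting HP) key xs ne (row-cong (arr≡ frN $len refl) (arr≡ frN $lst refl) R)
        ; fresh   = λ r′ f ne → tagged-frame hitP refl frH (Searching.others searching r′ f ne)
                  , λ v → trans (Hit.Hitting.alien (Hit.hitting HP) r′ v ne) (trans (cong (λ g → g (pair r′ v)) (arr≡ frN $hit refl)) (proj₂ (fresh r′ f) v))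
        ; few     = Hit.few HP
        ; hitting = Hit.full-hit 1≤k HP
        ; chosen  = λ s s∈ → seeds-⊆ k W (Hit.Hitting.chosen (Hit.hitting HP) s s∈) }
    time : 6 + length W * 17 + 22 * (length H * k) + hit-cost ≤ select-cost (length W) (length H * k)
    time = ≤-reflexive (lem (length W * 17) (22 * (length H * k)) (L * (4 + length W * 11 + length H * k * 9)))
      where
      lem : ∀ a b c → 6 + a + b + (2 + c) ≡ 8 + a + b + c
      lem = solve-∀

  Labels : Set
  Labels = ℕ → List (ℕ × ℕ)

  -- Labels are exact. The walk yields the lower bound on the estimate, and minimality makes the
  -- label of a hub unique, as the marking of hubs in the query requires.
  Sound : Labels → Set
  Sound Lab = ∀ {x h d} → (h , d) ∈ Lab x → Walk H h x d × (∀ ℓ → Walk H h x ℓ → d ≤ ℓ)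

  HasHub : Labels → ℕ → ℕ → ℕ → Set
  HasHub Lab u w ℓ = ∃[ d ] d ≤ ℓ × (w , d) ∈ Lab u

  Reaches : List ℕ → ℕ → ℕ → Set
  Reaches A w ℓ = ∃[ q ] q ∈ A × ∃[ ℓ′ ] ℓ′ ≤ ℓ × Walk H w q ℓ′

  -- The third kind of hub. The distance to `A` is measured from `w`, as the midpoint argument
  -- requires.
  Inward : List ℕ → Labels → ℕ → Set
  Inward A Lab u = ∀ w ℓ → Walk H w u ℓ → HasHub Lab u w ℓ ⊎ Reaches A w ℓ

  -- The second kind of hub, with `W` in the place of A₁ and `A` in the place of A₂. Here the
  -- distance to `A` is measured from the owner `v` of the labels.
  Outward : List ℕ → List ℕ → Labels → ℕ → Set
  Outward W A Lab v = ∀ w ℓ → w ∈ W → Walk H w v ℓ → HasHub Lab v w ℓ ⊎ Reaches A v ℓ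

  hub-⊆ : ∀ {Lab Lab′ : Labels} → (∀ {x l} → l ∈ Lab x → l ∈ Lab′ x) → ∀ {u w ℓ} → HasHub Lab u w ℓ → HasHub Lab′ u w ℓ
  hub-⊆ incl (d , d≤ , l) = d , d≤ , incl l

  inward-mono : ∀ {A A′ Lab Lab′ u} → (∀ {q} → q ∈ A → q ∈ A′) → (∀ {x l} → l ∈ Lab x → l ∈ Lab′ x) → Inward A Lab u → Inward A′ Lab′ u
  inward-mono {Lab = Lab} {Lab′} A⊆ L⊆ g w ℓ p with g w ℓ p
  ... | inj₁ h = inj₁ (hub-⊆ {Lab} {Lab′} L⊆ h)
  ... | inj₂ (q , q∈ , z) = inj₂ (q , A⊆ q∈ , z)

  module _ {F W k r out R₀ σ τ} (P : Selected F W k r out R₀ σ τ) (W⊆ : ∀ w → w ∈ W → w ∈ V) where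

    open Selected P
    open Nearest nearest

    -- If `s` was crowded out, the list of `x` is full and therefore hit, and all its sources are
    -- within ℓ of `x`.
    nearest-or-hit : ∀ {s x ℓ} → s ∈ W → Walk H s x ℓ → Near Q x s ℓ ⊎ Reaches C x ℓ
    nearest-or-hit {x = x} s∈ w with complete s∈ w
    ... | inj₁ near = inj₁ near
    ... | inj₂ (k≤ , h) with hitting x (≤-antisym (length-at table x) k≤)
    ...   | s , s∈C , d , q∈ = inj₂ (s , s∈C , d , h s d q∈ , walk-sym sm (walk q∈))

  module _ {W k Q} (W⊆ : ∀ w → w ∈ W → w ∈ V) (N : Nearest H W k Q) where

    open Nearest N

    sound-out : ∀ bar {Lab} → Sound Lab → Sound (Emission.emitted vertex source bar Q Lab)
    sound-out bar snd l∈ with Emission.emitted-∈ vertex source bar Q l∈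
    ... | inj₁ i = snd i
    ... | inj₂ (q , q∈ , refl , refl) = walk q∈ , λ ℓ w → shortest q∈ (seeds-⊆ k W (sourced q∈)) w

    sound-in : ∀ bar {Lab} → Sound Lab → Sound (Emission.emitted source vertex bar Q Lab)
    sound-in bar snd l∈ with Emission.emitted-∈ source vertex bar Q l∈
    ... | inj₁ i = snd i
    ... | inj₂ (q , q∈ , refl , refl) = walk-sym sm (walk q∈) , λ ℓ w → shortest q∈ (seeds-⊆ k W (sourced q∈)) (walk-sym sm w)

-- The rounds with halved list length.

module Rounds (n : ℕ) (H : List (ℕ × ℕ)) (sm : Symmetric H) (H<n : ∀ {a b} → (a , b) ∈ H → a < n) (L : ℕ) (n<2^L : n < 2 ^ L)
              (K : ℕ) (1≤K : 1 ≤ K) (K<2^L : K < 2 ^ L) where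

  open Phases n H sm H<n L n<2^L public

  HK : ℕ
  HK = length H * K

  -- Tags 0 and 1 are kept for the searches from A₁ and A₂, and the tags from `r` on for the current
  -- and the later rounds.
  Spare : ℕ → ℕ → Set
  Spare r r′ = r′ < 2 ⊎ r ≤ r′

  -- `R` counts the finished rounds. `A` has two bounds: `A*K≤` in terms of n leads to the size of
  -- A₂, while `A≤` in terms of the edges serves the running time, since n may exceed m. The first W
  -- may violate the second alternative of `W*K≤`, because vertices repeat in it.
  record Phase1 (R r k : ℕ) (W A : List ℕ) (Lab : Labels) (σ : Store) : Set where
    field
      r≡     : regs σ #r ≡ r
      k≡     : regs σ #k ≡ k
      out≡   : regs σ #out ≡ 0
      n≡     : regs σ #n ≡ n
      K≡     : regs σ #K ≡ K
      adj    : Adjacency σ H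
      row    : Row (arrays σ $len) (arrays σ $lst) r W
      rowA   : Row (arrays σ $len) (arrays σ $lst) 0 A
      empty  : ∀ key → key ≡ 1 ⊎ r < key → Row (arrays σ $len) (arrays σ $lst) key []
      fresh  : ∀ r′ → Spare r r′ → Fresh σ r′
      label  : Labelled σ n Lab
      3≤r    : 3 ≤ r
      k≤K    : k ≤ K
      W⊆     : ∀ w → w ∈ W → w ∈ V
      A⊆     : ∀ w → w ∈ A → w ∈ V
      sound  : Sound Lab
      inward : ∀ u → u ∈ V → u ∈ W ⊎ Inward A Lab u
      labels≤ : ∀ x → length (Lab x) ≤ R * K
      tail≤  : regs σ #tail ≤ n + R * (n * K * 3)
      A*K≤   : length A * K ≤ R * (6 * L * n)
      A≤     : length A ≤ R * (2 * L * HK)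
      W*K≤   : k ≡ K ⊎ length W * K ≤ n * (2 * k + 1)
      W≤     : length W ≤ HK

  round-cost : ℕ
  round-cost = select-cost HK HK + (2 + HK * 6) + (2 + HK * 12) + 2

  half : ∀ k → k ≤ 2 * (k / 2) + 1
  half k = begin
    k                       ≡⟨ m≡m%n+[m/n]*n k 2 ⟩
    k % 2 + k / 2 * 2       ≤⟨ +-monoˡ-≤ _ (≤-pred (m%n<n k 2)) ⟩
    1 + k / 2 * 2           ≡⟨ trans (+-comm 1 _) (cong (_+ 1) (*-comm (k / 2) 2)) ⟩
    2 * (k / 2) + 1         ∎
    where
    open ≤-Reasoning
    open import Data.Nat.DivMod using (m≡m%n+[m/n]*n; m%n<n)

  module _ {R r k W A Lab σ} (P : Phase1 R r k W A Lab σ) (1≤k : 1 ≤ k) where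

    open Phase1 P

    private
      S = map source (seeds k W)
      F = λ r′ → Spare (r + 1) r′
      0≢r : 0 ≢ r
      0≢r refl = 1+n≰n (≤-trans (s≤s z≤n) 3≤r)
      |H|k≤HK : length H * k ≤ HK
      |H|k≤HK = *-monoʳ-≤ (length H) k≤K

    module _ {ρ} (Z : Selected F W k r 0 A σ ρ) where

      open Selected Z using (Q; C; nearest; hitting; few; chosen)
      open Nearest nearest
      open HeavySpec K r Q

      bar : ℕ → ℕ
      bar s = ⟦ less ⟧ K (length (sel s (SV Q)))

      open Emission source vertex bar using (emitted; emitted-⊆; ∈-emitted; emitted-barred; emitted-length)

      Lab′ : Labels
      Lab′ = emitted Q Lab

      -- A light u in `W` receives the owners of all lists that contain it. For any other w that
      -- reaches u, the list of w is full and has been hit, by a vertex no farther from w than u.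
      inward′ : ∀ u → u ∈ V → u ∈ heavies S ⊎ Inward (C ++ A) Lab′ u
      inward′ u u∈V with inward u u∈V
      ... | inj₂ g = inj₂ (inward-mono {Lab = Lab} {Lab′} (∈-++⁺ʳ C) (emitted-⊆ Q) g)
      ... | inj₁ u∈W with bar u ≟ 0
      ...   | no heavy = inj₁ (heavies-∈ S u∈S heavy)
        where
        inhabited : ∀ xs → (∀ {v} → v ∈ xs → v ∈ sel u (SV Q)) → ⟦ less ⟧ K (length xs) ≢ 0 → u ∈ S
        inhabited [] _ ne = ⊥-elim (ne refl)
        inhabited (v ∷ _) h _ with ∈-inv {Q} (h (here refl))
        ... | d , q∈ = sourced q∈
        u∈S : u ∈ S
        u∈S = inhabited (sel u (SV Q)) (λ i → i) heavy
      ...   | yes light = inj₂ λ w ℓ wu → reach w ℓ (nearest-or-hit Z W⊆ u∈W (walk-sym sm wu))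
        where
        reach : ∀ w ℓ → Near Q w u ℓ ⊎ Reaches C w ℓ → HasHub Lab′ u w ℓ ⊎ Reaches (C ++ A) w ℓ
        reach w ℓ (inj₁ (d , d≤ , q∈))  = inj₁ (d , d≤ , ∈-emitted {Lab} Q q∈ light)
        reach w ℓ (inj₂ (q , q∈ , z))   = inj₂ (q , ∈-++⁺ˡ q∈ , z)

      labels≤′ : ∀ x → length (Lab′ x) ≤ suc R * K
      labels≤′ x with bar x ≟ 0
      ... | no heavy = ≤-trans (≤-reflexive (cong length (emitted-barred {Lab} Q x heavy))) (≤-trans (labels≤ x) (m≤n+m (R * K) K))
      ... | yes light = ≤-trans (emitted-length {Lab} Q x) (≤-trans (≤-reflexive (+-comm (length (Lab x)) _))
                          (+-mono-≤ small (labels≤ x)))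
        where
        small : length (sel x (SV Q)) ≤ K
        small with K <? length (sel x (SV Q))
        ... | yes lt = ⊥-elim (less-true lt light)
        ... | no ≮   = ≮⇒≥ ≮

      S<n : length S ≤ n
      S<n = distinct-length≤ n S (seeds-distinct k W) λ s s∈ → V<n (W⊆ s (seeds-⊆ k W s∈))

      -- In the first round `W` may be longer than n, but `S`, which has no repetitions, is not.
      S*K≤ : length S * K ≤ n * (2 * k + 1)
      S*K≤ with W*K≤
      ... | inj₂ le   = ≤-trans (*-monoˡ-≤ K (seeds-length k W)) le
      ... | inj₁ refl = *-mono-≤ S<n (≤-trans (m≤m+n K (K + 0)) (m≤m+n (2 * K) 1))

      -- Shorter lists need more hitting vertices per source, but the sources become fewer in
      -- proportion: |S| K is at most n (2k + 1), hence at most 3 n k. With |C| k at most 2 |S| L,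
      -- the k cancels and 6 = 2 · 3 remains.
      C*K≤ : length C * K ≤ 6 * L * n
      C*K≤ = *-cancelʳ-≤ (length C * K) (6 * L * n) k {{>-nonZero 1≤k}} (begin
        length C * K * k             ≡⟨ lem₁ (length C) K k ⟩
        length C * k * K             ≤⟨ *-monoˡ-≤ K few ⟩
        2 * length S * L * K         ≡⟨ lem₂ (length S) L K ⟩
        2 * L * (length S * K)       ≤⟨ *-monoʳ-≤ (2 * L) S*K≤ ⟩
        2 * L * (n * (2 * k + 1))    ≤⟨ *-monoʳ-≤ (2 * L) (*-monoʳ-≤ n (+-monoʳ-≤ (2 * k) 1≤k)) ⟩
        2 * L * (n * (2 * k + k))    ≡⟨ lem₃ L n k ⟩
        6 * L * n * k                ∎)
        where
        open ≤-Reasoning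
        lem₁ : ∀ a b c → a * b * c ≡ a * c * b
        lem₁ = solve-∀
        lem₂ : ∀ a b c → 2 * a * b * c ≡ 2 * b * (a * c)
        lem₂ = solve-∀
        lem₃ : ∀ a b c → 2 * a * (b * (2 * c + c)) ≡ 6 * a * b * c
        lem₃ = solve-∀

      C≤ : length C ≤ 2 * L * HK
      C≤ = begin
        length C              ≤⟨ m≤m*n (length C) k {{>-nonZero 1≤k}} ⟩
        length C * k          ≤⟨ few ⟩
        2 * length S * L      ≤⟨ *-monoˡ-≤ L (*-monoʳ-≤ 2 (≤-trans (seeds-length k W) W≤)) ⟩
        2 * HK * L             ≡⟨ lem HK L ⟩
        2 * L * HK             ∎
        where
        open ≤-Reasoning
        lem : ∀ a b → 2 * a * b ≡ 2 * b * a
        lem = solve-∀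

      -- The lists have at most n k entries in total. The last step expresses this through the next
      -- value of k, where rounding costs the 1.
      heavies*K≤ : length (heavies S) * K ≤ n * (2 * (k / 2) + 1)
      heavies*K≤ = begin
        length (heavies S) * K                    ≤⟨ heavies-bound S ⟩
        Sum (λ s → length (sel s (SV Q))) S       ≤⟨ Threshold.sources-inv k n Q table S (seeds-distinct k W) sourced (λ q∈ → V<n (nearest-V W⊆ nearest q∈)) ⟩
        length Q                                  ≤⟨ nearest-size-n W⊆ nearest ⟩
        n * k                                     ≤⟨ *-monoʳ-≤ n (half k) ⟩
        n * (2 * (k / 2) + 1)                     ∎
        where open ≤-Reasoning

      concat-bound : ∀ B {b a} → length C * B ≤ b → length A * B ≤ R * a → b ≤ a → length (C ++ A) * B ≤ suc R * a
      concat-bound B {b} {a} c≤ a≤ b≤ = ≤-trans (≤-reflexive (trans (cong (_* B) (length-++ C)) (*-distribʳ-+ B (length C) (length A))))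
        (+-mono-≤ (≤-trans c≤ b≤) a≤)
        where open import Data.List.Properties using (length-++)

      Post : Store → Set
      Post υ = ∃[ W′ ] ∃[ A′ ] ∃[ Lab′ ] Phase1 (suc R) (r + 1) (k / 2) W′ A′ Lab′ υ

      rest : ∀ τ → Frame selectP σ ρ → Labelled ρ n Lab → regs ρ #K ≡ K → regs ρ #r ≡ r → τ ≡ ρ →
             Ex (heavyP ++ emitP $qs $qv isHeavy ++ increment #r ∷ setReg #k (reg #k ⟪ div ⟫ const 2) ∷ []) τ
               ((2 + length S * 6) + ((2 + length Q * 12) + 2))
               Post
      rest .ρ fr labρ K≡ρ r≡ρ refl = ex-++ {p = heavyP}
        (ex-frame (ex-heavy ρ S K≡ρ r≡ρ (Selected.src≡ Z) (Selected.sources Z) (Selected.tagged Z)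
          (Selected.rows Z (r + 1) [] (λ e → 1+n≢0 (trans (+-comm 1 r) e)) (empty (r + 1) (inj₂ (≤-reflexive (+-comm 1 r)))))))
        λ τ₂ ((rowW , rows₂) , fr₂) → ex-++ {p = emitP $qs $qv isHeavy}
          (ex-frame (Emission.ex-emit source vertex bar $qs $qv isHeavy n Q (λ q q∈ → V<n (W⊆ _ (seeds-⊆ k W (sourced q∈)))) refl refl τ₂ Lab
            (labelled-cong (reg≡ fr₂ #tail refl) (arr≡ fr₂ $D refl) labρ)
            (queue₂ τ₂ fr₂) (qs≡ (queue₂ τ₂ fr₂)) (qv≡ (queue₂ τ₂ fr₂))
            λ τ q frE q∈ → cong₂ ⟦ less ⟧ (trans (reg≡ frE #K refl) (trans (reg≡ fr₂ #K refl) K≡ρ))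
              (trans (cong₂ (λ f i → f (pair i (source q))) (trans (arr≡ frE $cnt refl) (arr≡ fr₂ $cnt refl)) (trans (reg≡ frE #r refl) (trans (reg≡ fr₂ #r refl) r≡ρ)))
                (proj₁ (inv≡ (Selected.tagged Z) (source q))))))
        (finish τ₂ rowW rows₂ fr₂)
        where
        open import Data.Nat.DivMod using (m/n≤m)
        queue₂ : ∀ τ₂ → Frame heavyP ρ τ₂ → Queue τ₂ Q
        queue₂ τ₂ fr₂ = queue-arrays (reg≡ fr₂ #end refl) (arr≡ fr₂ $qv refl) (arr≡ fr₂ $qs refl) (arr≡ fr₂ $qd refl) (Selected.queue Z)
        lem : ∀ a b c → a + b + c ≡ a + (c + b)
        lem = solve-∀
        both : ∀ w → w ∈ C ⊎ w ∈ A → w ∈ V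
        both w (inj₁ i) = W⊆ w (chosen w i)
        both w (inj₂ i) = A⊆ w i
        wider : ∀ key → key ≡ 1 ⊎ r + 1 < key → key ≡ 1 ⊎ r < key
        wider key (inj₁ e) = inj₁ e
        wider key (inj₂ l) = inj₂ (≤-trans (s≤s (m≤m+n r 1)) l)
        ne₁ : ∀ key → key ≡ 1 ⊎ r + 1 < key → key ≢ r + 1
        ne₁ key (inj₁ refl) e = 0≢r (suc-injective (trans e (+-comm r 1)))
        ne₁ key (inj₂ l) e = <-irrefl (sym e) l
        ne₀ : ∀ key → key ≡ 1 ⊎ r + 1 < key → key ≢ 0
        ne₀ key (inj₁ refl) ()
        ne₀ .0 (inj₂ ()) refl
        ne-r : ∀ r′ → Spare (r + 1) r′ → r′ ≢ r
        ne-r r′ (inj₁ l) refl = <-irrefl refl (≤-trans l (≤-trans (n≤1+n 2) 3≤r))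
        ne-r r′ (inj₂ l) refl = <-irrefl refl (≤-trans (≤-reflexive (+-comm 1 r)) l)
        finish : ∀ τ₂ → Row (arrays τ₂ $len) (arrays τ₂ $lst) (r + 1) (heavies S) →
          (∀ key xs → key ≢ r + 1 → Row (arrays ρ $len) (arrays ρ $lst) key xs → Row (arrays τ₂ $len) (arrays τ₂ $lst) key xs) → Frame heavyP ρ τ₂ →
          ∀ τ₃ → (Labelled τ₃ n Lab′ × regs τ₃ #tail ≤ regs τ₂ #tail + length Q * 3) × Frame (emitP $qs $qv isHeavy) τ₂ τ₃ →
          Ex (increment #r ∷ setReg #k (reg #k ⟪ div ⟫ const 2) ∷ []) τ₃ 2 Post
        finish τ₂ rowW rows₂ fr₂ τ₃ ((lab₃ , tail₃) , fr₃) = ex-setR (ex-setR (ex-halt {T = 0} (heavies S , C ++ A , Lab′ , phase)))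
          where
          phase : Phase1 (suc R) (r + 1) (k / 2) (heavies S) (C ++ A) Lab′ (setR (setR τ₃ #r (regs τ₃ #r + 1)) #k (regs τ₃ #k / 2))
          phase = record
            { r≡ = cong (_+ 1) (trans (reg≡ fr₃ #r refl) (trans (reg≡ fr₂ #r refl) r≡ρ))
            ; k≡ = cong (_/ 2) (trans (reg≡ fr₃ #k refl) (trans (reg≡ fr₂ #k refl) (trans (reg≡ fr #k refl) k≡)))
            ; out≡ = trans (reg≡ fr₃ #out refl) (trans (reg≡ fr₂ #out refl) (trans (reg≡ fr #out refl) out≡))
            ; n≡ = trans (reg≡ fr₃ #n refl) (trans (reg≡ fr₂ #n refl) (trans (reg≡ fr #n refl) n≡))
            ; K≡ = trans (reg≡ fr₃ #K refl) (trans (reg≡ fr₂ #K refl) K≡ρ)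
            ; adj = λ v → row-cong (trans (arr≡ fr₃ $deg refl) (trans (arr≡ fr₂ $deg refl) (arr≡ fr $deg refl)))
                                   (trans (arr≡ fr₃ $adj refl) (trans (arr≡ fr₂ $adj refl) (arr≡ fr $adj refl))) (adj v)
            ; row = row-cong (arr≡ fr₃ $len refl) (arr≡ fr₃ $lst refl) rowW
            ; rowA = row-cong (arr≡ fr₃ $len refl) (arr≡ fr₃ $lst refl) (rows₂ 0 _ (λ e → 1+n≢0 (trans (+-comm 1 r) (sym e))) (Selected.row Z))
            ; empty = λ key e → row-cong (arr≡ fr₃ $len refl) (arr≡ fr₃ $lst refl)
                (rows₂ key [] (ne₁ key e) (Selected.rows Z key [] (ne₀ key e) (empty key (wider key e))))
            ; fresh = λ r′ s → fresh-regs {τ₃} refl (fresh-frame (emitP $qs $qv isHeavy) refl refl fr₃ (fresh-frame heavyP refl refl fr₂ (Selected.fresh Z r′ s (ne-r r′ s))))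
            ; label = labelled-cong {τ₃} refl refl lab₃
            ; 3≤r = ≤-trans 3≤r (m≤m+n r 1)
            ; k≤K = ≤-trans (m/n≤m k 2) k≤K
            ; W⊆ = λ w w∈ → W⊆ w (seeds-⊆ k W (heavies-⊆ S w∈))
            ; A⊆ = λ w w∈ → both w (∈-++⁻ C w∈)
            ; sound = λ l∈ → sound-in W⊆ nearest bar {Lab} sound l∈
            ; inward = inward′
            ; labels≤ = labels≤′
            ; tail≤ = ≤-trans tail₃ (≤-trans (+-mono-≤ (≤-trans (≤-reflexive (trans (reg≡ fr₂ #tail refl) (reg≡ fr #tail refl))) tail≤)
                        (*-monoˡ-≤ 3 (≤-trans (nearest-size-n W⊆ nearest) (*-monoʳ-≤ n k≤K))))
                        (≤-reflexive (lem n (R * (n * K * 3)) (n * K * 3))))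
            ; A*K≤ = concat-bound K C*K≤ A*K≤ ≤-refl
            ; A≤ = subst (_≤ suc R * (2 * L * HK)) (*-identityʳ _) (concat-bound 1 (subst (_≤ 2 * L * HK) (sym (*-identityʳ _)) C≤)
                     (subst (_≤ R * (2 * L * HK)) (sym (*-identityʳ _)) A≤) ≤-refl)
            ; W*K≤ = inj₂ heavies*K≤
            ; W≤ = ≤-trans (heavies-length S) (≤-trans (seeds-length k W) W≤)
            }

    ex-round : Ex roundBody σ round-cost (λ υ → ∃[ W′ ] ∃[ A′ ] ∃[ Lab′ ] Phase1 (suc R) (r + 1) (k / 2) W′ A′ Lab′ υ)
    ex-round = ex-weaken time (λ _ z → z) (ex-++ {p = selectP}
      (ex-frame (ex-select F W k r 0 A σ 1≤k W⊆ r≡ k≡ out≡ n≡ adj row rowA (fresh r (inj₂ ≤-refl)) λ r′ s → fresh r′ (widen r′ s)))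
      λ ρ (Z , fr) → ex-weaken (rest≤ Z) (λ _ z → z)
        (rest Z ρ fr (labelled-cong (reg≡ fr #tail refl) (arr≡ fr $D refl) label) (trans (reg≡ fr #K refl) K≡) (trans (reg≡ fr #r refl) r≡) refl))
      where
      widen : ∀ r′ → Spare (r + 1) r′ → Spare r r′
      widen r′ (inj₁ l) = inj₁ l
      widen r′ (inj₂ l) = inj₂ (≤-trans (m≤m+n r 1) l)
      rest≤ : ∀ {ρ} (Z : Selected F W k r 0 A σ ρ) → (2 + length S * 6) + ((2 + length (Selected.Q Z) * 12) + 2) ≤ (2 + HK * 6) + ((2 + HK * 12) + 2)
      rest≤ Z = +-mono-≤ (+-monoʳ-≤ 2 (*-monoˡ-≤ 6 (≤-trans (seeds-length k W) W≤)))
        (+-monoˡ-≤ 2 (+-monoʳ-≤ 2 (*-monoˡ-≤ 12 (≤-trans (nearest-size W⊆ (Selected.nearest Z)) |H|k≤HK))))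
      select-mono : select-cost (length W) (length H * k) ≤ select-cost HK HK
      select-mono = +-mono-≤ (+-mono-≤ (+-monoʳ-≤ 8 (*-monoˡ-≤ 17 W≤)) (*-monoʳ-≤ 22 |H|k≤HK))
        (*-monoʳ-≤ L (+-mono-≤ (+-monoʳ-≤ 4 (*-monoˡ-≤ 11 W≤)) (*-monoˡ-≤ 9 |H|k≤HK)))
      time : select-cost (length W) (length H * k) + ((2 + HK * 6) + ((2 + HK * 12) + 2)) ≤ round-cost
      time = ≤-trans (+-monoˡ-≤ _ select-mono) (≤-reflexive (lem (select-cost HK HK) (2 + HK * 6) (2 + HK * 12)))
        where
        lem : ∀ a b c → a + (b + (c + 2)) ≡ a + b + c + 2
        lem = solve-∀

  ex-rounds : ∀ fuel {R r k W A Lab} σ → k < 2 ^ fuel → Phase1 R r k W A Lab σ →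
    Ex (while (reg #k) roundBody ∷ []) σ (1 + fuel * (1 + round-cost))
      (λ υ → ∃[ R′ ] ∃[ r′ ] ∃[ W′ ] ∃[ A′ ] ∃[ Lab′ ] R′ ≤ R + fuel × Phase1 R′ r′ 0 W′ A′ Lab′ υ)
  ex-rounds fuel {R} {r} {zero} {W} {A} {Lab} σ k< P = ex-exit (Phase1.k≡ P) (R , r , W , A , Lab , m≤m+n R fuel , P)
  ex-rounds zero {k = suc _} σ (s≤s ()) P
  ex-rounds (suc fuel) {R} {k = suc k} σ k< P = ex-weaken (≤-reflexive (cong suc (+-suc round-cost _))) (λ _ z → z)
    (ex-again (λ e → 0≢1+n (trans (sym e) (Phase1.k≡ P))) (ex-round P (s≤s z≤n))
      λ τ (W′ , A′ , Lab′ , P′) → ex-weaken ≤-refl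
        (λ υ (R″ , r″ , W″ , A″ , Lab″ , R≤ , P″) → R″ , r″ , W″ , A″ , Lab″ , ≤-trans R≤ (≤-reflexive (sym (+-suc R fuel))) , P″)
        (ex-rounds fuel τ (half-< (suc k) fuel k<) P′))

-- The stretch, and the searches from A₁ and A₂.

module Build (n : ℕ) (1≤n : 1 ≤ n) (es : List (ℕ × ℕ)) (es<n : ∀ {a b} → (a , b) ∈ halves (reverse es) → a < n)
             (L : ℕ) (n<2^L : n < 2 ^ L) where

  H : List (ℕ × ℕ)
  H = halves (reverse es)

  K : ℕ
  K = root (cube-root n)

  n≤K³ : n ≤ K * K * K
  n≤K³ = above (cube-root n)

  1≤K : 1 ≤ K
  1≤K = n≢0⇒n>0 λ e → 1+n≰n (≤-trans 1≤n (≤-trans n≤K³ (≤-reflexive (cong (λ z → z * z * z) e))))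

  K≤n : K ≤ n
  K≤n = go K 1≤K (below (cube-root n))
    where
    go : ∀ K → 1 ≤ K → (∀ j → j < K → j * j * j < n) → K ≤ n
    go (suc zero)        _ _ = 1≤n
    go (suc j@(suc _))   _ b = ≤-trans (s≤s (≤-trans (m≤n*m j j) (m≤m*n (j * j) j))) (b j ≤-refl)

  1≤L : 1 ≤ L
  1≤L = n≢0⇒n>0 λ e → 1+n≰n (≤-trans (s≤s 1≤n) (≤-trans n<2^L (≤-reflexive (cong (2 ^_) e))))

  open Rounds n H (halves-symmetric (reverse es)) es<n L n<2^L K 1≤K (≤-<-trans K≤n n<2^L) public hiding (Lab′; bar; rest; Post)

  private
    sm : Symmetric H
    sm = halves-symmetric (reverse es)

  walk-V : ∀ {u v ℓ} → Walk H u v (suc ℓ) → u ∈ V × v ∈ V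
  walk-V w = start (walk-sym sm w) , start w
    where
    start : ∀ {u v ℓ} → Walk H u v (suc ℓ) → v ∈ V
    start (snoc _ e) = ∈-map⁺ proj₁ (sm e)

  CommonHub : Labels → ℕ → ℕ → ℕ → Set
  CommonHub Lab u v ℓ = ∃[ h ] ∃[ a ] ∃[ b ] (h , a) ∈ Lab u × (h , b) ∈ Lab v × a + b ≤ ℓ

  -- With w the midpoint of a shortest path from u to v: unless w is a hub of
  -- both, A₁ has a vertex q within ⌈d/2⌉ of w, and unless q is a hub of both,
  -- A₂ has a vertex within d + d mod 2 of u or of v.
  common-hub : ∀ {A₁ A₂ Lab} → (∀ u → u ∈ V → Inward A₁ Lab u) → (∀ v → Outward A₁ A₂ Lab v) →
               (∀ v s ℓ → s ∈ A₂ → Walk H s v ℓ → HasHub Lab v s ℓ) →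
               ∀ {u v d} → 1 ≤ d → Walk H u v d → CommonHub Lab u v (3 * d + 2 * (d % 2))
  common-hub {A₁} {A₂} {Lab} inw outw all {u} {v} {suc d₋} _ uv = split (walk-split (x + e) x (subst (Walk H u v) d≡ uv))
    where
    open import Data.Nat.DivMod using (m≡m%n+[m/n]*n)
    open ≤-Reasoning
    d = suc d₋
    x = d / 2
    e = d % 2
    d≡ : d ≡ x + e + x
    d≡ = trans (m≡m%n+[m/n]*n d 2) (lem e x)
      where
      lem : ∀ a b → a + b * 2 ≡ b + a + b
      lem = solve-∀
    u∈V = proj₁ (walk-V uv)
    v∈V = proj₂ (walk-V uv)
    Goal = CommonHub Lab u v (3 * d + 2 * e)
    -- The vertex s is within d + e of u, and by the triangle inequality at most d farther from v;
    -- the two distances add up to 3d + 2e. The case of v is symmetric.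
    via-s : ∀ s y z → s ∈ A₂ → y ≤ d + e → z ≤ d + y → Walk H s u y → Walk H s v z → Goal
    via-s s y z s∈ y≤ z≤ su sv with all u s y s∈ su | all v s z s∈ sv
    ... | a , a≤ , la | b , b≤ , lb = s , a , b , la , lb , (begin
      a + b                          ≤⟨ +-mono-≤ (≤-trans a≤ y≤) (≤-trans b≤ (≤-trans z≤ (+-monoʳ-≤ d y≤))) ⟩
      d + e + (d + (d + e))          ≡⟨ lem d e ⟩
      3 * d + 2 * e                  ∎)
      where
      lem : ∀ a b → a + b + (a + (a + b)) ≡ 3 * a + 2 * b
      lem = solve-∀
    via-s′ : ∀ s y z → s ∈ A₂ → z ≤ d + e → y ≤ d + z → Walk H s u y → Walk H s v z → Goal
    via-s′ s y z s∈ z≤ y≤ su sv with all u s y s∈ su | all v s z s∈ sv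
    ... | a , a≤ , la | b , b≤ , lb = s , a , b , la , lb , (begin
      a + b                          ≤⟨ +-mono-≤ (≤-trans a≤ (≤-trans y≤ (+-monoʳ-≤ d z≤))) (≤-trans b≤ z≤) ⟩
      d + (d + e) + (d + e)          ≡⟨ lem d e ⟩
      3 * d + 2 * e                  ∎)
      where
      lem : ∀ a b → a + (a + b) + (a + b) ≡ 3 * a + 2 * b
      lem = solve-∀
    split : (∃[ w ] Walk H u w x × Walk H w v (x + e)) → Goal
    split (w , uw , wv) = middle (inw u u∈V w x (walk-sym sm uw)) (inw v v∈V w (x + e) wv)
      where
      -- As q is within x + e of w, it is within 2x + e = d of u and within 2x + 2e = d + e of v.
      via-q : Reaches A₁ w (x + e) → Goal
      via-q (q , q∈ , ℓ , ℓ≤ , wq) = at-q (outw u q (x + ℓ) q∈ qu) (outw v q (x + e + ℓ) q∈ qv)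
        where
        qu : Walk H q u (x + ℓ)
        qu = walk-++ (walk-sym sm wq) (walk-sym sm uw)
        qv : Walk H q v (x + e + ℓ)
        qv = walk-++ (walk-sym sm wq) wv
        xℓ≤ : x + ℓ ≤ d
        xℓ≤ = ≤-trans (+-monoʳ-≤ x ℓ≤) (≤-reflexive (trans (+-comm x _) (sym d≡)))
        xeℓ≤ : x + e + ℓ ≤ d + e
        xeℓ≤ = begin
          x + e + ℓ            ≤⟨ +-monoʳ-≤ (x + e) ℓ≤ ⟩
          x + e + (x + e)      ≡⟨ +-assoc (x + e) x e ⟨
          x + e + x + e        ≡⟨ cong (_+ e) d≡ ⟨
          d + e                ∎
        at-q : HasHub Lab u q (x + ℓ) ⊎ Reaches A₂ u (x + ℓ) → HasHub Lab v q (x + e + ℓ) ⊎ Reaches A₂ v (x + e + ℓ) → Goal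
        at-q (inj₁ (a , a≤ , la)) (inj₁ (b , b≤ , lb)) = q , a , b , la , lb , (begin
          a + b                  ≤⟨ +-mono-≤ (≤-trans a≤ xℓ≤) (≤-trans b≤ xeℓ≤) ⟩
          d + (d + e)            ≤⟨ m≤m+n _ (d + e) ⟩
          d + (d + e) + (d + e)  ≡⟨ lem d e ⟩
          3 * d + 2 * e          ∎)
          where
          lem : ∀ a b → a + (a + b) + (a + b) ≡ 3 * a + 2 * b
          lem = solve-∀
        at-q (inj₂ (s , s∈ , y , y≤ , us)) _ = via-s s y (d + y) s∈ (≤-trans y≤ (≤-trans xℓ≤ (m≤m+n d e))) ≤-refl (walk-sym sm us) (walk-++ (walk-sym sm us) uv)
        at-q (inj₁ _) (inj₂ (s , s∈ , z , z≤ , vs)) = via-s′ s (d + z) z s∈ (≤-trans z≤ xeℓ≤) ≤-refl (walk-++ (walk-sym sm vs) (walk-sym sm uv)) (walk-sym sm vs)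
      middle : HasHub Lab u w x ⊎ Reaches A₁ w x → HasHub Lab v w (x + e) ⊎ Reaches A₁ w (x + e) → Goal
      middle (inj₂ (q , q∈ , ℓ , ℓ≤ , wq)) _ = via-q (q , q∈ , ℓ , ≤-trans ℓ≤ (m≤m+n x e) , wq)
      middle (inj₁ _) (inj₂ r) = via-q r
      middle (inj₁ (a , a≤ , la)) (inj₁ (b , b≤ , lb)) = w , a , b , la , lb , (begin
        a + b                ≤⟨ +-mono-≤ a≤ b≤ ⟩
        x + (x + e)          ≡⟨ trans (+-comm x _) (sym d≡) ⟩
        d                    ≤⟨ m≤m+n d _ ⟩
        3 * d                ≤⟨ m≤m+n _ (2 * e) ⟩
        3 * d + 2 * e        ∎)

  ex-left : ∀ σ r W A → regs σ #r ≡ r → r ≢ 0 → Row (arrays σ $len) (arrays σ $lst) r W → Row (arrays σ $len) (arrays σ $lst) 0 A →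
    Row (arrays σ $len) (arrays σ $lst) 1 [] →
    Ex leftP σ (2 + length W * 5) (λ τ → Row (arrays τ $len) (arrays τ $lst) 0 (W ++ A) × Row (arrays τ $len) (arrays τ $lst) 1 [])
  ex-left σ r W A refl r≢0 rowW rowA row₁ = ex-weaken (≤-reflexive (cong (2 +_) (Sum-const 5 W))) (λ _ (_ , b , c) → b , c)
    (ex-setR (ex-loop #i (cell $len (reg #r)) leftBody W I (λ _ → 4) (setR σ #i 0)
      (λ done τ fr (a , _) → trans (cong (arrays τ $len) (reg≡ fr #r refl)) (proj₁ a)) body refl (rowW , rowA , row₁)))
    where
    I : List ℕ → Store → Set
    I done τ = Row (arrays τ $len) (arrays τ $lst) r W × Row (arrays τ $len) (arrays τ $lst) 0 (done ++ A) × Row (arrays τ $len) (arrays τ $lst) 1 []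
    body : ∀ s todo done τ → (s ∷ todo) ʳ++ done ≡ W → Frame leftBody (setR σ #i 0) τ → regs τ #i ≡ length done → I done τ →
           Ex leftBody τ 4 (λ υ → regs υ #i ≡ suc (length done) × I (s ∷ done) υ)
    body s todo done τ eq fr i≡ (rW , rA , r1) = ex-setR (ex-setA (ex-setA (ex-setR (ex-halt {T = 0}
      ( trans (cong (_+ 1) i≡) (+-comm _ 1)
      , row-other {arrays τ $len} {arrays τ $lst} 0 s′ (λ e → r≢0 (sym e)) rW
      , subst (λ z → Row (arrays τ $len [ 0 ↦ arrays τ $len 0 + 1 ]) (arrays τ $lst [ pair 0 (arrays τ $len 0) ↦ s′ ]) 0 (z ∷ done ++ A)) s≡
          (row-push {arrays τ $len} {arrays τ $lst} 0 s′ rA)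
      , row-other {arrays τ $len} {arrays τ $lst} 0 s′ (λ ()) r1)))))
      where
      s′ = arrays τ $lst (pair (regs τ #r) (regs τ #i))
      s≡ : s′ ≡ s
      s≡ = trans (cong₂ (λ a b → arrays τ $lst (pair a b)) (reg≡ fr #r refl) i≡) (stored-at todo s done (subst (Stored _) (sym eq) (proj₂ rW)))

  record Outer (A₁ A₂ : List ℕ) (Lab : Labels) (σ : Store) : Set where
    field
      adj     : Adjacency σ H
      row     : Row (arrays σ $len) (arrays σ $lst) 1 A₂
      fresh   : Fresh σ 1
      label   : Labelled σ n Lab
      A₂⊆     : ∀ w → w ∈ A₂ → w ∈ V
      sound   : Sound Lab
      inward  : ∀ u → u ∈ V → Inward A₁ Lab u
      outward : ∀ v → Outward A₁ A₂ Lab v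
      labels≤ : ∀ x → length (Lab x) ≤ L * K + K
      tail≤   : regs σ #tail ≤ n + L * (n * K * 3) + n * K * 3
      A₂*K≤   : length A₂ * K ≤ 2 * length A₁ * L

  secondP thirdP : Program
  secondP = setReg #k (reg #K) ∷ setReg #r (const 0) ∷ setReg #out (const 1) ∷ selectP ++ emitP $qv $qs (const 0)
  thirdP = setReg #k (cell $len (const 1) ⟪ add ⟫ const 1) ∷ setReg #r (const 1) ∷ nearP ++ emitP $qv $qs (const 0)

  forward : List Entry → Labels → Labels
  forward = Emission.emitted vertex source (λ _ → 0)

  module _ {R : ℕ} {A₁ : List ℕ} {Lab : Labels} (R≤ : R ≤ L) where

    ex-second : ∀ σ → regs σ #n ≡ n → regs σ #K ≡ K → Adjacency σ H → Row (arrays σ $len) (arrays σ $lst) 0 A₁ →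
      Row (arrays σ $len) (arrays σ $lst) 1 [] → Fresh σ 0 → Fresh σ 1 → Labelled σ n Lab → (∀ w → w ∈ A₁ → w ∈ V) → Sound Lab →
      (∀ u → u ∈ V → Inward A₁ Lab u) → (∀ x → length (Lab x) ≤ R * K) → regs σ #tail ≤ n + R * (n * K * 3) →
      Ex secondP σ (3 + (select-cost (length A₁) HK + (2 + HK * 12))) (λ τ → ∃[ A₂ ] ∃[ Lab′ ] Outer A₁ A₂ Lab′ τ)
    ex-second σ n≡ K≡ adj row₀ row₁ fr₀ fr₁ lab A₁⊆ snd inw lab≤ tail≤ = ex-setR (ex-setR (ex-setR (ex-++ {p = selectP}
      (ex-frame (ex-select (_≡ 1) A₁ K 0 1 [] σ₁ 1≤K A₁⊆ refl K≡ refl n≡ adj row₀ row₁ (fresh-regs refl fr₀) (λ { .1 refl → fresh-regs refl fr₁ })))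
      emission)))
      where
      σ₁ = setR (setR (setR σ #k (regs σ #K)) #r 0) #out 1
      emission : ∀ τ → Selected (_≡ 1) A₁ K 0 1 [] σ₁ τ × Frame selectP σ₁ τ → Ex (emitP $qv $qs (const 0)) τ (2 + HK * 12) (λ τ → ∃[ A₂ ] ∃[ Lab′ ] Outer A₁ A₂ Lab′ τ)
      emission τ (Z , fr) = ex-weaken (+-monoʳ-≤ 2 (*-monoˡ-≤ 12 (nearest-size A₁⊆ nearest))) finish
        (ex-frame (Emission.ex-emit vertex source (λ _ → 0) $qv $qs (const 0) n Q (λ q q∈ → V<n (nearest-V A₁⊆ nearest q∈)) refl refl τ Lab
          (labelled-cong {σ} (reg≡ fr #tail refl) (arr≡ fr $D refl) lab) (Selected.queue Z) (qv≡ (Selected.queue Z)) (qs≡ (Selected.queue Z)) (λ _ _ _ _ → refl)))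
        where
        open Selected Z using (Q; C; nearest; row; fresh; chosen; few)
        open Nearest nearest using (table)
        module E = Emission vertex source (λ _ → 0)
        Lab′ = forward Q Lab
        finish : ∀ υ → (Labelled υ n Lab′ × regs υ #tail ≤ regs τ #tail + length Q * 3) × Frame (emitP $qv $qs (const 0)) τ υ → ∃[ A₂ ] ∃[ Lab′ ] Outer A₁ A₂ Lab′ υ
        finish υ ((lab′ , t≤) , fr′) = C ++ [] , Lab′ , record
          { adj = λ v → row-cong (trans (arr≡ fr′ $deg refl) (arr≡ fr $deg refl)) (trans (arr≡ fr′ $adj refl) (arr≡ fr $adj refl)) (adj v)
          ; row = row-cong (arr≡ fr′ $len refl) (arr≡ fr′ $lst refl) row
          ; fresh = fresh-frame (emitP $qv $qs (const 0)) refl refl fr′ (fresh 1 refl λ ())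
          ; label = lab′
          ; A₂⊆ = λ w w∈ → A₁⊆ w (chosen w (strip w w∈))
          ; sound = sound-out A₁⊆ nearest (λ _ → 0) {Lab} snd
          ; inward = λ u u∈ → inward-mono {Lab = Lab} {Lab′} (λ i → i) (E.emitted-⊆ Q) (inw u u∈)
          ; outward = λ v w ℓ w∈ wv → out v w ℓ (nearest-or-hit Z A₁⊆ w∈ wv)
          ; labels≤ = λ x → ≤-trans (E.emitted-length {Lab} Q x) (+-mono-≤ (≤-trans (lab≤ x) (*-monoˡ-≤ K R≤)) (length-at table x))
          ; tail≤ = ≤-trans t≤ (+-mono-≤ (≤-trans (≤-reflexive (reg≡ fr #tail refl)) (≤-trans tail≤ (+-monoʳ-≤ n (*-monoˡ-≤ (n * K * 3) R≤))))
                      (*-monoˡ-≤ 3 (nearest-size-n A₁⊆ nearest)))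
          ; A₂*K≤ = ≤-trans (≤-reflexive (cong (λ xs → length xs * K) (++-identityʳ C))) (≤-trans few (*-monoˡ-≤ L (*-monoʳ-≤ 2 (seeds-length K A₁))))
          }
          where
          open import Data.List.Properties using (++-identityʳ)
          strip : ∀ w → w ∈ C ++ [] → w ∈ C
          strip w w∈ = subst (w ∈_) (++-identityʳ C) w∈
          out : ∀ v w ℓ → Near Q v w ℓ ⊎ Reaches C v ℓ → HasHub Lab′ v w ℓ ⊎ Reaches (C ++ []) v ℓ
          out v w ℓ (inj₁ (d , d≤ , q∈)) = inj₁ (d , d≤ , E.∈-emitted {Lab} Q q∈ refl)
          out v w ℓ (inj₂ (q , q∈ , z))  = inj₂ (q , ∈-++⁺ˡ q∈ , z)

  record Oracle (c : ℕ) (Lab : Labels) (σ : Store) : Set where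
    field
      label   : Labelled σ n Lab
      sound   : Sound Lab
      common  : ∀ {u v d} → 1 ≤ d → Walk H u v d → CommonHub Lab u v (3 * d + 2 * (d % 2))
      labels≤ : ∀ x → length (Lab x) ≤ L * K + K + (c + 1)
      tail≤   : regs σ #tail ≤ n + L * (n * K * 3) + n * K * 3 + n * (c + 1) * 3

  ex-third : ∀ {A₁ A₂ Lab} σ → Outer A₁ A₂ Lab σ →
    Ex thirdP σ (2 + ((6 + length A₂ * 17 + 22 * (length H * (length A₂ + 1))) + (2 + length H * (length A₂ + 1) * 12))) (λ τ → ∃[ Lab′ ] Oracle (length A₂) Lab′ τ)
  ex-third {A₁} {A₂} {Lab} σ O = ex-setR (ex-setR (ex-++ {p = nearP}
    (ex-frame (NearSpec.ex-near H sm A₂ A₂⊆ k 1 (λ _ → ⊥) σ₁ refl (cong (_+ 1) (proj₁ row)) adj row (tagged-regs refl (proj₁ fresh)) (λ _ ())))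
    emission))
    where
    open Outer O
    k = length A₂ + 1
    σ₁ = setR (setR σ #k (arrays σ $len 1 + 1)) #r 1
    emission : ∀ τ → NearSpec.Near-post H sm A₂ A₂⊆ k 1 (λ _ → ⊥) τ × Frame nearP σ₁ τ →
               Ex (emitP $qv $qs (const 0)) τ (2 + length H * (length A₂ + 1) * 12) (λ τ → ∃[ Lab′ ] Oracle (length A₂) Lab′ τ)
    emission τ (P , fr) = ex-weaken (+-monoʳ-≤ 2 (*-monoˡ-≤ 12 (nearest-size A₂⊆ nearest))) finish
      (ex-frame (Emission.ex-emit vertex source (λ _ → 0) $qv $qs (const 0) n Q (λ q q∈ → V<n (nearest-V A₂⊆ nearest q∈)) refl refl τ Lab
        (labelled-cong {σ} (reg≡ fr #tail refl) (arr≡ fr $D refl) label) (Searching.queue searching) (qv≡ (Searching.queue searching)) (qs≡ (Searching.queue searching)) (λ _ _ _ _ → refl)))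
      where
      open NearSpec.Near-post P
      open Nearest nearest
      module E = Emission vertex source (λ _ → 0)
      Lab′ = forward Q Lab
      ⊆′ : ∀ {x l} → l ∈ Lab x → l ∈ Lab′ x
      ⊆′ = E.emitted-⊆ Q
      all : ∀ v s ℓ → s ∈ A₂ → Walk H s v ℓ → HasHub Lab′ v s ℓ
      all v s ℓ s∈ w with complete s∈ w
      ... | inj₁ (d , d≤ , q∈) = d , d≤ , E.∈-emitted {Lab} Q q∈ refl
      -- A full list would hold more distinct vertices than A₂ has.
      ... | inj₂ (k≤ , _) = ⊥-elim (1+n≰n (≤-trans (≤-reflexive (+-comm 1 (length A₂))) (≤-trans k≤ (pigeonhole (at v Q) A₂ (distinct-at table v) incl))))
        where
        incl : ∀ z → z ∈ at v Q → z ∈ A₂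
        incl z z∈ with ∈-at {Q} z∈
        ... | d , q∈ = seeds-⊆ k A₂ (sourced q∈)
      outward′ : ∀ v → Outward A₁ A₂ Lab′ v
      outward′ v w ℓ w∈ wv with outward v w ℓ w∈ wv
      ... | inj₁ h = inj₁ (hub-⊆ {Lab} {Lab′} ⊆′ h)
      ... | inj₂ z = inj₂ z
      finish : ∀ υ → (Labelled υ n Lab′ × regs υ #tail ≤ regs τ #tail + length Q * 3) × Frame (emitP $qv $qs (const 0)) τ υ → ∃[ Lab′ ] Oracle (length A₂) Lab′ υ
      finish υ ((lab′ , t≤) , fr′) = Lab′ , record
        { label = lab′
        ; sound = sound-out A₂⊆ nearest (λ _ → 0) {Lab} sound
        ; common = common-hub {A₁} {A₂} {Lab′} (λ u u∈ → inward-mono {Lab = Lab} {Lab′} (λ i → i) ⊆′ (inward u u∈)) outward′ all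
        ; labels≤ = λ x → ≤-trans (E.emitted-length {Lab} Q x) (+-mono-≤ (labels≤ x) (length-at table x))
        ; tail≤ = ≤-trans t≤ (+-mono-≤ (≤-trans (≤-reflexive (reg≡ fr #tail refl)) tail≤) (*-monoˡ-≤ 3 (nearest-size-n A₂⊆ nearest)))
        }

-- The running time of the preprocessing.

module Cost (n : ℕ) (1≤n : 1 ≤ n) (es : List (ℕ × ℕ)) (es<n : ∀ {a b} → (a , b) ∈ halves (reverse es) → a < n)
            (L : ℕ) (n<2^L : n < 2 ^ L) where

  open Build n 1≤n es es<n L n<2^L public

  -- At least 1, so that a graph without edges still pays for the constants and for the search of
  -- the cube root.
  M : ℕ
  M = length es ⊔ 1

  -- Opaque, so that coefficients are compared by computation while the unit itself is never
  -- unfolded.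
  abstract

    unit : ℕ → ℕ
    unit i = M * K * L ^ i

    unit≡ : ∀ i → unit i ≡ M * K * L ^ i
    unit≡ i = refl

    unit-up : ∀ i → unit i ≤ unit (suc i)
    unit-up i = *-monoʳ-≤ (M * K) {L ^ i} {L ^ suc i} (m≤n*m (L ^ i) L {{>-nonZero 1≤L}})

    1≤unit : ∀ i → 1 ≤ unit i
    1≤unit i = *-mono-≤ {1} {M * K} {1} {L ^ i} (*-mono-≤ (m≤n⊔m (length es) 1) 1≤K) (^-monoʳ-≤ L {{>-nonZero 1≤L}} {0} {i} z≤n)

  -- Running times as combinations of quantities of the form O(m K Lⁱ).

  data Cost : ℕ → Set where
    con  : ∀ {i} → ℕ → Cost i
    var  : ∀ {i} a p → a ≤ p * unit i → Cost i
    _⊕_  : ∀ {i} → Cost i → Cost i → Cost i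
    _⊗_  : ∀ {i} → Cost i → ℕ → Cost i
    _⊙_  : ∀ {i} → ℕ → Cost i → Cost i
    L⊙_  : ∀ {i} → Cost i → Cost (suc i)
    ↑_   : ∀ {i} → Cost i → Cost (suc i)

  infixl 6 _⊕_
  infixl 7 _⊗_ _⊙_
  infixr 8 L⊙_ ↑_

  value coefficient : ∀ {i} → Cost i → ℕ
  value (con c)     = c
  value (var a p _) = a
  value (e ⊕ f)     = value e + value f
  value (e ⊗ c)     = value e * c
  value (c ⊙ e)     = c * value e
  value (L⊙ e)      = L * value e
  value (↑ e)       = value e
  coefficient (con c)     = c
  coefficient (var a p _) = p
  coefficient (e ⊕ f)     = coefficient e + coefficient f
  coefficient (e ⊗ c)     = coefficient e * c
  coefficient (c ⊙ e)     = c * coefficient e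
  coefficient (L⊙ e)      = coefficient e
  coefficient (↑ e)       = coefficient e

  cost-bound : ∀ {i} (e : Cost i) → value e ≤ coefficient e * unit i
  cost-bound {i} (con c)     = m≤m*n c (unit i) {{>-nonZero (1≤unit i)}}
  cost-bound     (var a p h) = h
  cost-bound {i} (e ⊕ f)     = ≤-trans (+-mono-≤ (cost-bound e) (cost-bound f)) (≤-reflexive (sym (*-distribʳ-+ (unit i) (coefficient e) (coefficient f))))
  cost-bound {i} (e ⊗ c)     = ≤-trans (*-monoˡ-≤ c (cost-bound e)) (≤-reflexive (lem (coefficient e) (unit i) c))
    where
    lem : ∀ a b c → a * b * c ≡ a * c * b
    lem = solve-∀
  cost-bound {i} (c ⊙ e)     = ≤-trans (*-monoʳ-≤ c (cost-bound e)) (≤-reflexive (sym (*-assoc c (coefficient e) (unit i))))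
  cost-bound {suc i} (L⊙ e)  = ≤-trans (*-monoʳ-≤ L (cost-bound e)) (≤-reflexive (trans (cong (λ u → L * (coefficient e * u)) (unit≡ i))
    (trans (lem L (coefficient e) (M * K) (L ^ i)) (cong (coefficient e *_) (sym (unit≡ (suc i)))))))
    where
    lem : ∀ a b c d → a * (b * (c * d)) ≡ b * (c * (a * d))
    lem = solve-∀
  cost-bound {suc i} (↑ e)   = ≤-trans (cost-bound e) (*-monoʳ-≤ (coefficient e) (unit-up i))

  length-H : length H ≡ 2 * length es
  length-H = trans (halves-length (reverse es)) (cong (2 *_) (length-reverse es))
    where open import Data.List.Properties using (length-reverse)

  H≤ : length H ≤ 2 * M
  H≤ = ≤-trans (≤-reflexive length-H) (*-monoʳ-≤ 2 (m≤m⊔n (length es) 1))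

  unit-0 : unit 0 ≡ M * K
  unit-0 = trans (unit≡ 0) (*-identityʳ (M * K))

  mC KC hC : Cost 0
  mC = var (length es) 1 (≤-trans (≤-trans (m≤m⊔n (length es) 1) (m≤m*n M K {{>-nonZero 1≤K}})) (≤-reflexive (trans (sym unit-0) (sym (*-identityˡ (unit 0))))))
  KC = var K 1 (≤-trans (m≤n*m K M {{>-nonZero (m≤n⊔m (length es) 1)}}) (≤-reflexive (trans (sym unit-0) (sym (*-identityˡ (unit 0))))))
  hC = var HK 2 (≤-trans (*-monoˡ-≤ K H≤) (≤-reflexive (trans (*-assoc 2 M K) (cong (2 *_) (sym unit-0)))))

  selectC : ∀ {i} → Cost i → Cost i → Cost (suc i)
  selectC a b = ↑ (con 8 ⊕ a ⊗ 17 ⊕ 22 ⊙ b) ⊕ L⊙ (con 4 ⊕ a ⊗ 11 ⊕ b ⊗ 9)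

  initC : Cost 0
  initC = con 5 ⊕ mC ⊗ 12 ⊕ KC ⊗ 2

  roundsC : Cost 2
  roundsC = con 1 ⊕ L⊙ (con 1 ⊕ (selectC hC hC ⊕ (con 2 ⊕ ↑ hC ⊗ 6) ⊕ (con 2 ⊕ ↑ hC ⊗ 12) ⊕ con 2))

  leftC : Cost 0
  leftC = con 2 ⊕ hC ⊗ 5

  A₁C : Cost 2
  A₁C = ↑ ↑ hC ⊕ L⊙ (L⊙ (2 ⊙ hC))

  secondC : Cost 3
  secondC = con 3 ⊕ (selectC A₁C (↑ ↑ hC) ⊕ (con 2 ⊕ ↑ ↑ ↑ hC ⊗ 12))

  module _ {c} (c≤ : c ≤ 14 * (K * L ^ 3)) where

    cC HcC thirdC : Cost 3
    cC = var c 14 (≤-trans c≤ (*-monoʳ-≤ 14 (≤-trans (m≤n*m (K * L ^ 3) M {{>-nonZero (m≤n⊔m (length es) 1)}})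
           (≤-reflexive (trans (sym (*-assoc M K (L ^ 3))) (sym (unit≡ 3)))))))
    HcC = var (length H * (c + 1)) 30 Hc≤
      where
      open ≤-Reasoning
      1≤KL : 1 ≤ K * L ^ 3
      1≤KL = *-mono-≤ {1} {K} {1} {L ^ 3} 1≤K (^-monoʳ-≤ L {{>-nonZero 1≤L}} {0} {3} z≤n)
      lem : ∀ a b c → 2 * a * (14 * (b * c) + b * c) ≡ 30 * (a * b * c)
      lem = solve-∀
      Hc≤ : length H * (c + 1) ≤ 30 * unit 3
      Hc≤ = begin
        length H * (c + 1)                               ≤⟨ *-mono-≤ H≤ (+-mono-≤ c≤ 1≤KL) ⟩
        2 * M * (14 * (K * L ^ 3) + K * L ^ 3)           ≡⟨ lem M K (L ^ 3) ⟩
        30 * (M * K * L ^ 3)                             ≡⟨ cong (30 *_) (unit≡ 3) ⟨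
        30 * unit 3                                      ∎
    thirdC = con 2 ⊕ ((con 6 ⊕ cC ⊗ 17 ⊕ 22 ⊙ HcC) ⊕ (con 2 ⊕ HcC ⊗ 12))

  -- The hitting set bounds are chained: |A₂| K² is at most 2 L |A₁| K, hence at most 14 L³ n and at
  -- most 14 L³ K³. The 14 is 2 (1 + 6), with the 1 for the last W.
  A₂-bound : ∀ {a₁ a₂} → a₂ * K ≤ 2 * a₁ * L → a₁ * K ≤ n + L * (6 * L * n) → a₂ ≤ 14 * (K * L ^ 3)
  A₂-bound {a₁} {a₂} h₂ h₁ = *-cancelʳ-≤ a₂ (14 * (K * L ^ 3)) (K * K) {{>-nonZero (*-mono-≤ 1≤K 1≤K)}} (begin
    a₂ * (K * K)                               ≡⟨ *-assoc a₂ K K ⟨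
    a₂ * K * K                                 ≤⟨ *-monoˡ-≤ K h₂ ⟩
    2 * a₁ * L * K                             ≡⟨ lem₁ a₁ L K ⟩
    2 * L * (a₁ * K)                           ≤⟨ *-monoʳ-≤ (2 * L) h₁ ⟩
    2 * L * (n + L * (6 * L * n))              ≤⟨ *-monoʳ-≤ (2 * L) (+-monoˡ-≤ _ (≤-trans (m≤n*m n (L * L) {{>-nonZero (*-mono-≤ 1≤L 1≤L)}}) ≤-refl)) ⟩
    2 * L * (L * L * n + L * (6 * L * n))      ≡⟨ lem₂ L n ⟩
    14 * (L * L * L) * n                       ≤⟨ *-monoʳ-≤ (14 * (L * L * L)) n≤K³ ⟩
    14 * (L * L * L) * (K * K * K)             ≡⟨ lem₃ L K ⟩
    14 * (K * L ^ 3) * (K * K)                 ∎)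
    where
    open ≤-Reasoning
    lem₁ : ∀ a b c → 2 * a * b * c ≡ 2 * b * (a * c)
    lem₁ = solve-∀
    lem₂ : ∀ a n → 2 * a * (a * a * n + a * (6 * a * n)) ≡ 14 * (a * a * a) * n
    lem₂ = solve-∀
    lem₃ : ∀ l k → 14 * (l * l * l) * (k * k * k) ≡ 14 * (k * (l * (l * (l * 1)))) * (k * k)
    lem₃ = solve-∀

  Built : Store → Set
  Built τ = ∃[ c ] c ≤ 14 * (K * L ^ 3) × (∃[ Lab ] Oracle c Lab τ)

  start-phase1 : ∀ τ → InitSpec.Init-post n es τ → Phase1 0 3 K V [] (λ _ → []) τ
  start-phase1 τ P = record
    { r≡ = r≡ ; k≡ = k≡ ; out≡ = out≡ ; n≡ = n≡ ; K≡ = K≡ ; adj = adj ; row = row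
    ; rowA = rows 0 (λ ())
    ; empty = λ key e → rows key (ne key e)
    ; fresh = λ r _ → fresh r
    ; label = record { n≤tail = ≤-reflexive (sym tail≡) ; chain = λ x _ → subst (λ p → Chain (arrays τ $D) n (regs τ #tail) p []) (sym (D≡ x)) end }
    ; 3≤r = ≤-refl ; k≤K = ≤-refl ; W⊆ = λ w w∈ → w∈ ; A⊆ = λ w ()
    ; sound = λ () ; inward = λ u u∈ → inj₁ u∈
    ; labels≤ = λ x → z≤n ; tail≤ = ≤-reflexive (trans tail≡ (sym (+-identityʳ n))) ; A*K≤ = z≤n ; A≤ = z≤n
    ; W*K≤ = inj₁ refl ; W≤ = ≤-trans (≤-reflexive (length-map proj₁ H)) (m≤m*n (length H) K {{>-nonZero 1≤K}}) }
    where
    open InitSpec.Init-post P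
    ne : ∀ key → key ≡ 1 ⊎ 3 < key → key ≢ 3
    ne .1 (inj₁ refl) ()
    ne .3 (inj₂ l) refl = <-irrefl refl l

  -- The coefficient is 2 + (6 + 14 · 17 + 22 · 30) + (2 + 30 · 12), computed from `thirdC`. As a
  -- multiple of the unit the bound no longer depends on the size of A₂.
  third-cost : ℕ
  third-cost = 1268 * unit 3

  cost-bound′ : ∀ {i p} (e : Cost i) → coefficient e ≡ p → value e ≤ p * unit i
  cost-bound′ {i} e eq = subst (λ p → value e ≤ p * unit i) eq (cost-bound e)

  third≤ : ∀ c → c ≤ 14 * (K * L ^ 3) → 2 + ((6 + c * 17 + 22 * (length H * (c + 1))) + (2 + length H * (c + 1) * 12)) ≤ third-cost
  third≤ c c≤ = cost-bound′ {p = 1268} (thirdC c≤) refl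

  allC : Cost 3
  allC = ↑ ↑ ↑ initC ⊕ (↑ roundsC ⊕ (↑ ↑ ↑ leftC ⊕ (secondC ⊕ var third-cost 1268 ≤-refl)))

  ex-last : ∀ {A₁ A₂ Lab} τ → length A₂ ≤ 14 * (K * L ^ 3) → Outer A₁ A₂ Lab τ → Ex thirdP τ third-cost Built
  ex-last {A₁} {A₂} τ c≤ O = ex-weaken (third≤ (length A₂) c≤) found (ex-third τ O)
    where
    found : ∀ υ → (∃[ Lab′ ] Oracle (length A₂) Lab′ υ) → Built υ
    found υ (Lab , P) = length A₂ , c≤ , Lab , P

  After : Store → Set
  After υ = ∃[ R′ ] ∃[ r′ ] ∃[ W′ ] ∃[ A′ ] ∃[ Lab′ ] R′ ≤ L × Phase1 R′ r′ 0 W′ A′ Lab′ υ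
  ex-after : ∀ υ → After υ → Ex (leftP ++ secondP ++ thirdP) υ (value leftC + (value secondC + third-cost)) Built
  ex-after υ (R , r , W , A , Lab , R≤ , P) = ex-++ {p = leftP} {secondP ++ thirdP} {T = value leftC} {value secondC + third-cost} {Q = Built}
    (ex-frame (ex-weaken (+-monoʳ-≤ 2 (*-monoˡ-≤ 5 W≤)) (λ _ z → z) (ex-left υ r W A r≡ r≢0 row rowA (empty 1 (inj₁ refl))))) λ τ₁ ((row₀ , row₁) , fr) →
      ex-++ {p = secondP} {thirdP} {T = value secondC} {third-cost} {Q = Built} (ex-weaken second≤ (λ _ z → z)
        (ex-second {R} {W ++ A} {Lab} R≤ τ₁ (trans (reg≡ fr #n refl) n≡) (trans (reg≡ fr #K refl) K≡)
          (λ v → row-cong (arr≡ fr $deg refl) (arr≡ fr $adj refl) (adj v)) row₀ row₁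
          (fresh-frame leftP refl refl fr (fresh 0 (inj₁ (s≤s z≤n)))) (fresh-frame leftP refl refl fr (fresh 1 (inj₁ (s≤s (s≤s z≤n)))))
          (labelled-cong (reg≡ fr #tail refl) (arr≡ fr $D refl) label) A₁⊆ sound inward₁ labels≤
          (≤-trans (≤-reflexive (reg≡ fr #tail refl)) tail≤)))
      λ τ₂ (A₂ , Lab₂ , O) → ex-last τ₂ (A₂≤ A₂ (Outer.A₂*K≤ O)) O
    where
    open Phase1 P
    open import Data.List.Properties using (length-++)
    r≢0 : r ≢ 0
    r≢0 refl with 3≤r
    ... | ()
    A₁≤ : length (W ++ A) ≤ HK + L * (2 * L * HK)
    A₁≤ = ≤-trans (≤-reflexive (length-++ W)) (+-mono-≤ W≤ (≤-trans A≤ (*-monoˡ-≤ _ R≤)))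
    second≤ : 3 + (select-cost (length (W ++ A)) HK + (2 + HK * 12)) ≤ value secondC
    second≤ = +-monoʳ-≤ 3 (+-monoˡ-≤ (2 + HK * 12) (+-mono-≤ (+-monoˡ-≤ (22 * HK) (+-monoʳ-≤ 8 (*-monoˡ-≤ 17 A₁≤′)))
      (*-monoʳ-≤ L (+-monoˡ-≤ (HK * 9) (+-monoʳ-≤ 4 (*-monoˡ-≤ 11 A₁≤′))))))
      where
      lem : ∀ a b → a * (2 * a * b) ≡ a * (a * (2 * b))
      lem = solve-∀
      A₁≤′ : length (W ++ A) ≤ HK + L * (L * (2 * HK))
      A₁≤′ = ≤-trans A₁≤ (≤-reflexive (cong (HK +_) (lem L HK)))
    -- At the end k = 0, so the bound n (2k + 1) has become n; the alternative k = K is ruled out by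
    -- K ≥ 1.
    W*K≤n : length W * K ≤ n
    W*K≤n with W*K≤
    ... | inj₁ e = ⊥-elim (1+n≰n (≤-trans 1≤K (≤-reflexive (sym e))))
    ... | inj₂ h = ≤-trans h (≤-reflexive (*-identityʳ n))
    A₁*K≤ : length (W ++ A) * K ≤ n + L * (6 * L * n)
    A₁*K≤ = ≤-trans (≤-reflexive (trans (cong (_* K) (length-++ W)) (*-distribʳ-+ K (length W) (length A))))
      (+-mono-≤ W*K≤n (≤-trans A*K≤ (*-monoˡ-≤ (6 * L * n) R≤)))
    A₂≤ : ∀ A₂ → length A₂ * K ≤ 2 * length (W ++ A) * L → length A₂ ≤ 14 * (K * L ^ 3)
    A₂≤ A₂ h = A₂-bound {length (W ++ A)} {length A₂} h A₁*K≤
    A₁⊆ : ∀ w → w ∈ W ++ A → w ∈ V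
    A₁⊆ w w∈ = pick (∈-++⁻ W w∈)
      where
      pick : w ∈ W ⊎ w ∈ A → w ∈ V
      pick (inj₁ i) = W⊆ w i
      pick (inj₂ i) = A⊆ w i
    -- A vertex u of the last W belongs to A₁, so A₁ is as close to w as u is.
    inward₁ : ∀ u → u ∈ V → Inward (W ++ A) Lab u
    inward₁ u u∈ with inward u u∈
    ... | inj₁ u∈W = λ w ℓ p → inj₂ (u , ∈-++⁺ˡ u∈W , ℓ , ≤-refl , p)
    ... | inj₂ g   = inward-mono {Lab = Lab} {Lab} (∈-++⁺ʳ W) (λ i → i) g

  ex-preprocess : Ex preprocessP (initial n (length es) (ends es)) (1744 * unit 3) Built
  ex-preprocess = ex-weaken (cost-bound′ {p = 1744} allC refl) (λ _ z → z) (ex-++ {p = initP} (InitSpec.ex-init n es) λ τ P →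
    ex-++ {p = while (reg #k) roundBody ∷ []} (ex-rounds L τ (≤-<-trans K≤n n<2^L) (start-phase1 τ P)) ex-after)

-- The query program: mark the hubs of u, then scan those of v.  The best sum
-- found so far is kept as its two summands, so that no stored value is large.

labelBody scanBody searchP queryP : Program
labelBody =
  -- A mark is a distance plus 1, so that 0 means unmarked. Register 3 inherits the extra 1, and the
  -- final sum is then already the code of a finite answer.
  setCell 2 (cell 0 (reg 2)) (cell 0 (reg 2 ⟪ add ⟫ const 1) ⟪ add ⟫ const 1) ∷
  setReg 2 (cell 0 (reg 2 ⟪ add ⟫ const 2)) ∷ []
scanBody =
  ite (cell 2 (cell 0 (reg 2)))
    -- Adding the two tests gives their disjunction. Register 3 is 0 until a common hub has been
    -- found, since marks are positive.
    (ite ((reg 3 ⟪ equal ⟫ const 0) ⟪ add ⟫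
          ((cell 2 (cell 0 (reg 2)) ⟪ add ⟫ cell 0 (reg 2 ⟪ add ⟫ const 1)) ⟪ less ⟫ (reg 3 ⟪ add ⟫ reg 4)))
      (setReg 3 (cell 2 (cell 0 (reg 2))) ∷
       setReg 4 (cell 0 (reg 2 ⟪ add ⟫ const 1)) ∷ [])
      [] ∷ [])
    [] ∷
  setReg 2 (cell 0 (reg 2 ⟪ add ⟫ const 2)) ∷ []
searchP =
  ite (reg 0 ⟪ equal ⟫ reg 1)
    -- The code of distance 0. The case u = v is separate because an isolated vertex has no labels,
    -- hence no hub in common even with itself.
    (setReg 3 (const 1) ∷ [])
    (setReg 2 (cell 0 (reg 0)) ∷
     while (reg 2) labelBody ∷
     setReg 2 (cell 0 (reg 1)) ∷
     while (reg 2) scanBody ∷ []) ∷ []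
queryP = searchP ++ setReg 0 (reg 3 ⟪ add ⟫ reg 4) ∷ []

module Query (f : ℕ → ℕ) (lo hi : ℕ) (1≤lo : 1 ≤ lo) (LU LV : List (ℕ × ℕ))
             (functional : ∀ {h a b} → (h , a) ∈ LU → (h , b) ∈ LU → a ≡ b) where

  record Marked (σ : Store) (rest : List (ℕ × ℕ)) : Set where
    field
      only : ∀ h → arrays σ 2 h ≢ 0 → ∃[ d ] arrays σ 2 h ≡ suc d × (h , d) ∈ LU
      all  : ∀ {h d} → (h , d) ∈ LU → arrays σ 2 h ≢ 0 ⊎ (h , d) ∈ rest
  open Marked

  chain-pos : ∀ {p l ls} → Chain f lo hi p (l ∷ ls) → p ≢ 0
  chain-pos (link lo≤ _ _ _ _) refl = 1+n≰n (≤-trans 1≤lo lo≤)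

  ex-mark : ∀ ls {p} σ → (∀ {l} → l ∈ ls → l ∈ LU) → arrays σ 0 ≡ f → regs σ 2 ≡ p → Chain f lo hi p ls → Marked σ ls →
            Ex (while (reg 2) labelBody ∷ []) σ (1 + length ls * 3) (λ τ → Marked τ [])
  ex-mark [] σ incl refl e end M = ex-exit e M
  ex-mark ((h , d) ∷ ls) {p} σ incl refl refl c@(link {p} _ _ fh fd rest) M =
    ex-again (chain-pos c) (ex-setA (ex-setR (ex-halt {T = 0} {Q = λ τ → τ ≡ σ′} refl))) λ { τ refl →
      ex-mark ls σ′ (λ i → incl (there i)) refl refl rest M′ }
    where
    x = arrays σ 0 (regs σ 2)
    v = arrays σ 0 (regs σ 2 + 1) + 1
    σ′ = setR (setA σ 2 x v) 2 (arrays σ 0 (regs σ 2 + 2))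
    v≡ : v ≡ suc d
    v≡ = trans (cong (_+ 1) fd) (+-comm d 1)
    here≡ : (arrays σ 2 [ x ↦ v ]) h ≡ suc d
    here≡ = trans (cong (arrays σ 2 [ x ↦ v ]) (sym fh)) (trans (upd-same (arrays σ 2) x v) v≡)
    M′ : Marked σ′ ls
    M′ = record { only = only′ ; all = all′ }
      where
      only′ : ∀ z → (arrays σ 2 [ x ↦ v ]) z ≢ 0 → ∃[ d ] (arrays σ 2 [ x ↦ v ]) z ≡ suc d × (z , d) ∈ LU
      only′ z ne with z ≟ h
      ... | yes refl = d , here≡ , incl (here refl)
      ... | no z≢h with only M z (λ e → ne (trans off e))
        where
        off : (arrays σ 2 [ x ↦ v ]) z ≡ arrays σ 2 z
        off = upd-other (arrays σ 2) v λ e → z≢h (trans (sym e) fh)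
      ...   | d′ , e , i = d′ , trans (upd-other (arrays σ 2) v λ e → z≢h (trans (sym e) fh)) e , i
      all′ : ∀ {z e} → (z , e) ∈ LU → (arrays σ 2 [ x ↦ v ]) z ≢ 0 ⊎ (z , e) ∈ ls
      all′ {z} {e} i with z ≟ h
      ... | yes refl = inj₁ λ e → 0≢1+n (trans (sym e) here≡)
      ... | no z≢h with all M i
      ...   | inj₁ ne = inj₁ λ e → ne (trans (sym (upd-other (arrays σ 2) v λ e → z≢h (trans (sym e) fh))) e)
      ...   | inj₂ (here refl) = ⊥-elim (z≢h refl)
      ...   | inj₂ (there j) = inj₂ j

  record Best (σ : Store) (rest : List (ℕ × ℕ)) : Set where
    field
      found : (regs σ 3 ≡ 0 × regs σ 4 ≡ 0) ⊎ (∃[ h ] ∃[ a ] regs σ 3 ≡ suc a × (h , a) ∈ LU × (h , regs σ 4) ∈ LV)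
      least : ∀ {h a b} → (h , a) ∈ LU → (h , b) ∈ LV → (h , b) ∈ rest ⊎ (regs σ 3 ≢ 0 × regs σ 3 + regs σ 4 ≤ suc a + b)
  open Best

  ex-scan : ∀ ls {p} σ → (∀ {l} → l ∈ ls → l ∈ LV) → arrays σ 0 ≡ f → regs σ 2 ≡ p → Chain f lo hi p ls → Marked σ [] → Best σ ls →
            Ex (while (reg 2) scanBody ∷ []) σ (1 + length ls * 6) (λ τ → Best τ [])
  ex-scan [] σ incl refl e end M B = ex-exit e B
  ex-scan ((h , d) ∷ ls) {p} σ incl refl refl c@(link {p} _ _ fh fd rest) M B =
    ex-again {P = λ τ → arrays τ ≡ arrays σ × regs τ 2 ≡ arrays σ 0 (p + 2) × Best τ ls} (chain-pos c) step′
      λ τ (e , p≡ , B′) → ex-scan ls τ (λ i → incl (there i)) (cong (λ a → a 0) e) p≡ rest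
        (record { only = λ z ne → subst (λ a → ∃[ d ] a 2 z ≡ suc d × (z , d) ∈ LU) (sym e) (only M z λ q → ne (trans (cong (λ a → a 2 z) e) q))
                ; all = λ i → subst (λ a → a 2 _ ≢ 0 ⊎ _) (sym e) (all M i) }) B′
    where
    mark = arrays σ 2 (arrays σ 0 p)
    b = arrays σ 0 (p + 1)
    mark≡ : mark ≡ arrays σ 2 h
    mark≡ = cong (arrays σ 2) fh
    After : Store → Set
    After τ = arrays τ ≡ arrays σ × regs τ 2 ≡ p × Best τ ls
    last : ∀ τ → After τ → Ex (setReg 2 (cell 0 (reg 2 ⟪ add ⟫ const 2)) ∷ []) τ 1 (λ τ → arrays τ ≡ arrays σ × regs τ 2 ≡ arrays σ 0 (p + 2) × Best τ ls)
    last τ (e , p≡ , B′) = ex-setR (ex-halt (e , cong₂ (λ a q → a 0 (q + 2)) e p≡ , record { found = found B′ ; least = least B′ }))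
    better : ℕ
    better = ⟦ equal ⟧ (regs σ 3) 0 + ⟦ less ⟧ (mark + b) (regs σ 3 + regs σ 4)
    step′ : Ex scanBody σ 5 (λ τ → arrays τ ≡ arrays σ × regs τ 2 ≡ arrays σ 0 (p + 2) × Best τ ls)
    step′ with mark ≟ 0
    ... | yes m0 = ex-weaken (m≤m+n 2 3) (λ _ z → z) (ex-ite₀ {P = After} m0 (ex-halt {T = 0} (refl , refl , record { found = found B ; least = lst })) last)
      where
      lst : ∀ {z a e} → (z , a) ∈ LU → (z , e) ∈ LV → (z , e) ∈ ls ⊎ (regs σ 3 ≢ 0 × regs σ 3 + regs σ 4 ≤ suc a + e)
      lst i j with least B i j
      ... | inj₂ q = inj₂ q
      ... | inj₁ (there k) = inj₁ k
      ... | inj₁ (here refl) with all M i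
      ...   | inj₁ ne = ⊥-elim (ne (trans (sym mark≡) m0))
      ...   | inj₂ ()
    ... | no m≢0 with only M h (λ e → m≢0 (trans mark≡ e))
    ...   | a , m≡ , h∈ with better ≟ 0
    ...     | yes b0 = ex-weaken (m≤m+n 3 2) (λ _ z → z) (ex-ite₁ {P = After} m≢0
                (ex-ite₀ {P = After} b0 (ex-halt {T = 0} (refl , refl , record { found = found B ; least = lst })) (λ τ q → ex-halt {T = 0} q)) last)
      where
      r3≢0 : regs σ 3 ≢ 0
      r3≢0 e = 1+n≢0 (m+n≡0⇒m≡0 1 (trans (cong (λ z → ⟦ equal ⟧ z 0 + ⟦ less ⟧ (mark + b) (regs σ 3 + regs σ 4)) (sym e)) b0))
      small : regs σ 3 + regs σ 4 ≤ mark + b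
      small with mark + b <? regs σ 3 + regs σ 4
      ... | no ≮ = ≮⇒≥ ≮
      ... | yes lt = ⊥-elim (less-true lt (m+n≡0⇒n≡0 (⟦ equal ⟧ (regs σ 3) 0) b0))
      lst : ∀ {z a e} → (z , a) ∈ LU → (z , e) ∈ LV → (z , e) ∈ ls ⊎ (regs σ 3 ≢ 0 × regs σ 3 + regs σ 4 ≤ suc a + e)
      lst i j with least B i j
      ... | inj₂ q = inj₂ q
      ... | inj₁ (there k) = inj₁ k
      ... | inj₁ (here refl) = inj₂ (r3≢0 , ≤-trans small (≤-reflexive (cong₂ _+_ (trans mark≡ (trans m≡ (cong suc (functional h∈ i)))) fd)))
    ...     | no b≢0 = ex-ite₁ {P = After} m≢0
                (ex-ite₁ {P = After} b≢0 (ex-setR (ex-setR (ex-halt {T = 0} (refl , refl , record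
                  { found = inj₂ (h , a , trans mark≡ m≡ , h∈ , subst (λ z → (h , z) ∈ LV) (sym fd) (incl (here refl)))
                  ; least = lst })))) (λ τ q → ex-halt {T = 0} q)) last
      where
      mark+b : mark + b ≡ suc a + d
      mark+b = cong₂ _+_ (trans mark≡ m≡) fd
      lst : ∀ {z a e} → (z , a) ∈ LU → (z , e) ∈ LV → (z , e) ∈ ls ⊎ (mark ≢ 0 × mark + b ≤ suc a + e)
      lst i j with least B i j
      ... | inj₁ (there k) = inj₁ k
      ... | inj₁ (here refl) = inj₂ (m≢0 , ≤-reflexive (trans mark+b (cong (λ z → suc z + d) (functional h∈ i))))
      ... | inj₂ (r≢0 , le) = inj₂ (m≢0 , ≤-trans lt le)
        where
        lt : mark + b ≤ regs σ 3 + regs σ 4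
        lt with mark + b <? regs σ 3 + regs σ 4
        ... | yes lt = <⇒≤ lt
        ... | no ≮ = ⊥-elim (b≢0 (cong₂ _+_ (same-≢ r≢0) (less-false (≮⇒≥ ≮))))

  NoCommon : Set
  NoCommon = ∀ {h a b} → (h , a) ∈ LU → (h , b) ∈ LV → ⊥

  data Answer (u v : ℕ) : ℕ → Set where
    same-vertex : u ≡ v → Answer u v 1
    infinite    : u ≢ v → NoCommon → Answer u v 0
    finite      : ∀ {h a b} → u ≢ v → (h , a) ∈ LU → (h , b) ∈ LV →
                  (∀ {h′ a′ b′} → (h′ , a′) ∈ LU → (h′ , b′) ∈ LV → a + b ≤ a′ + b′) → Answer u v (suc (a + b))

  ex-search : ∀ u v xs → f ≡ nth xs → Chain f lo hi (f u) LU → Chain f lo hi (f v) LV →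
              Ex searchP (initial u v xs) (6 + length LU * 3 + length LV * 6) (λ τ → Answer u v (regs τ 3 + regs τ 4))
  ex-search u v xs refl cu cv with u ≟ v
  ... | yes refl = ex-weaken (m≤m+n 2 _) (λ _ z → z)
        (ex-ite₁ {T′ = 0} {P = λ τ → regs τ 3 ≡ 1 × regs τ 4 ≡ 0} (λ e → 0≢1+n (trans (sym e) (same-refl u))) (ex-setR (ex-halt {T = 0} (refl , refl)))
          λ τ (e₁ , e₂) → ex-halt (subst (Answer u u) (sym (cong₂ _+_ e₁ e₂)) (same-vertex refl)))
  ... | no u≢v = ex-weaken time (λ _ z → z)
        (ex-ite₀ {T′ = 0} {P = λ τ → Answer u v (regs τ 3 + regs τ 4)} (same-≢ u≢v)
          (ex-setR (ex-++ {p = while (reg 2) labelBody ∷ []}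
            (ex-frame (ex-mark LU (setR (initial u v xs) 2 (nth xs u)) (λ i → i) refl refl cu (record { only = λ h ne → ⊥-elim (ne refl) ; all = λ i → inj₂ i })))
            λ τ (M , fr) → ex-setR (ex-weaken ≤-refl answer
              (ex-scan LV (setR τ 2 (arrays τ 0 (regs τ 1))) (λ i → i) (arr≡ fr 0 refl) (cong₂ (λ a i → a i) (arr≡ fr 0 refl) (reg≡ fr 1 refl)) cv
                (record { only = only M ; all = all M })
                (record { found = inj₁ (reg≡ fr 3 refl , reg≡ fr 4 refl) ; least = λ i j → inj₁ j })))))
          λ τ a → ex-halt a)
    where
    answer : ∀ τ → Best τ [] → Answer u v (regs τ 3 + regs τ 4)
    answer τ B with found B
    ... | inj₁ (e₁ , e₂) = subst (Answer u v) (sym (cong₂ _+_ e₁ e₂)) (infinite u≢v none)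
      where
      none : NoCommon
      none i j with least B i j
      ... | inj₁ ()
      ... | inj₂ (ne , _) = ne e₁
    ... | inj₂ (h , a , e , i , j) = subst (λ z → Answer u v (z + regs τ 4)) (sym e) (finite u≢v i j best)
      where
      best : ∀ {h′ a′ b′} → (h′ , a′) ∈ LU → (h′ , b′) ∈ LV → a + regs τ 4 ≤ a′ + b′
      best i′ j′ with least B i′ j′
      ... | inj₁ ()
      ... | inj₂ (_ , le) = ≤-pred (subst (λ z → z + regs τ 4 ≤ _) e le)
    lem : ∀ a b → suc (suc (1 + a + suc (1 + b)) + 0) ≡ 5 + a + b
    lem = solve-∀
    time : suc (suc (1 + length LU * 3 + suc (1 + length LV * 6)) + 0) ≤ 6 + length LU * 3 + length LV * 6
    time = ≤-trans (≤-reflexive (lem (length LU * 3) (length LV * 6))) (n≤1+n _)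

-- Graphs on Fin n as lists of half-edges on ℕ.

toℕ² : ∀ {n} → Fin n × Fin n → ℕ × ℕ
toℕ² e = toℕ (proj₁ e) , toℕ (proj₂ e)

pairs : ∀ {n} → Graph n → List (ℕ × ℕ)
pairs G = map toℕ² (edges G)

endpoints≡ : ∀ {n} (G : Graph n) → endpoints G ≡ ends (pairs G)
endpoints≡ G = go (edges G)
  where
  go : ∀ {n} (es : List (Fin n × Fin n)) →
       concatMap (λ e → toℕ (proj₁ e) ∷ toℕ (proj₂ e) ∷ []) es ≡ ends (map toℕ² es)
  go []       = refl
  go (e ∷ es) = cong (λ l → toℕ (proj₁ e) ∷ toℕ (proj₂ e) ∷ l) (go es)

∈-halves : ∀ es {a b} → (a , b) ∈ halves es → (a , b) ∈ es ⊎ (b , a) ∈ es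
∈-halves (e ∷ es) (here refl)         = inj₂ (here refl)
∈-halves (e ∷ es) (there (here refl)) = inj₁ (here refl)
∈-halves (e ∷ es) (there (there i)) with ∈-halves es i
... | inj₁ j = inj₁ (there j)
... | inj₂ j = inj₂ (there j)

halves-∈ : ∀ {es a b} → (a , b) ∈ es → (a , b) ∈ halves es
halves-∈ (here refl) = there (here refl)
halves-∈ (there i)   = there (there (halves-∈ i))

module _ {n : ℕ} (G : Graph n) where

  private
    H = halves (reverse (pairs G))

  adjacent-half : ∀ {u v} → Adjacent G u v → (toℕ u , toℕ v) ∈ H
  adjacent-half (inj₁ i) = halves-∈ (reverse⁺ (∈-map⁺ toℕ² i))
  adjacent-half (inj₂ i) = halves-symmetric (reverse (pairs G)) (halves-∈ (reverse⁺ (∈-map⁺ toℕ² i)))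

  half-adjacent : ∀ {a b} → (a , b) ∈ H → ∃[ u ] ∃[ v ] a ≡ toℕ u × b ≡ toℕ v × Adjacent G u v
  half-adjacent i with ∈-halves (reverse (pairs G)) i
  ... | inj₁ j with ∈-map⁻ toℕ² (reverse⁻ {xs = pairs G} j)
  ...   | (u , v) , e∈ , refl = u , v , refl , refl , inj₁ e∈
  half-adjacent i | inj₂ j with ∈-map⁻ toℕ² (reverse⁻ {xs = pairs G} j)
  ...   | (v , u) , e∈ , refl = u , v , refl , refl , inj₂ e∈

  half-bounded : ∀ {a b} → (a , b) ∈ H → a < n
  half-bounded i with half-adjacent i
  ... | u , v , refl , _ = toℕ<n u

  path⇒walk : ∀ {u v ℓ} → Path G u v ℓ → Walk H (toℕ u) (toℕ v) ℓ
  path⇒walk stop       = nil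
  path⇒walk (step a p) = walk-cons (adjacent-half a) (path⇒walk p)

  path-snoc : ∀ {u v w ℓ} → Path G u v ℓ → Adjacent G v w → Path G u w (suc ℓ)
  path-snoc stop       a = step a stop
  path-snoc (step b p) a = step b (path-snoc p a)

  walk⇒path : ∀ {u a ℓ} → Walk H (toℕ u) a ℓ → ∃[ v ] a ≡ toℕ v × Path G u v ℓ
  walk⇒path {u} nil = u , refl , stop
  walk⇒path (snoc w e) with walk⇒path w | half-adjacent e
  ... | v , refl , p | v′ , x , v≡ , refl , a with toℕ-injective v≡
  ...   | refl = x , refl , path-snoc p a

  path? : ∀ u v ℓ → Dec (Path G u v ℓ)
  path? u v zero with u Fin.≟ v
  ... | yes refl = yes stop
  ... | no u≢v   = no λ { stop → u≢v refl }
  path? u v (suc ℓ) with any? (λ w → adjacent? u w ×-dec path? w v ℓ)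
    where
    open import Relation.Nullary.Decidable using (_×-dec_; _⊎-dec_)
    open import Data.List.Membership.DecPropositional (≡-dec Fin._≟_ Fin._≟_) using (_∈?_)
    adjacent? : ∀ u v → Dec (Adjacent G u v)
    adjacent? u v = ((u , v) ∈? edges G) ⊎-dec ((v , u) ∈? edges G)
  ... | yes (w , a , p) = yes (step a p)
  ... | no ∄ = no λ { (step {v = w} a p) → ∄ (w , a , p) }

  -- A common hub yields some path, while the specification asks for the exact distance, which is
  -- found by testing all lengths up to that of the path.
  distance : ∀ {u v ℓ} → Path G u v ℓ → ∃[ d ] IsDistance G u v d
  distance {u} {v} {ℓ} p with search (suc ℓ)
    where
    search : ∀ ℓ → (∃[ d ] IsDistance G u v d) ⊎ (∀ k → k < ℓ → ¬ Path G u v k)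
    search zero = inj₂ λ k ()
    search (suc ℓ) with search ℓ
    ... | inj₁ d = inj₁ d
    ... | inj₂ none with path? u v ℓ
    ...   | yes q = inj₁ (ℓ , q , λ k r → ≮⇒≥ λ k<ℓ → none k k<ℓ r)
    ...   | no ¬q = inj₂ λ k k< r → further k k< r
      where
      further : ∀ k → k < suc ℓ → ¬ Path G u v k
      further k k< r with k ≟ ℓ
      ... | yes refl = ¬q r
      ... | no ne    = none k (≤∧≢⇒< (≤-pred k<) ne) r
  ... | inj₁ d    = d
  ... | inj₂ none = ⊥-elim (none ℓ ≤-refl p)

  -- The pairing sends the edges injectively below (2n)². The bound serves only to fit the running
  -- time into a word, so a crude polynomial is enough.
  edges≤ : ∣E G ∣ ≤ 4 * (n * n)
  edges≤ = ≤-trans (≤-reflexive (sym (length-map code (edges G))))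
    (distinct-length≤ (4 * (n * n)) (map code (edges G)) (unique⇒distinct (Uniqueₚ.map⁺ code-injective (distinct G))) bound)
    where
    open import Data.List.Relation.Unary.AllPairs using (AllPairs; []; _∷_)
    open import Data.List.Relation.Unary.Unique.Propositional using (Unique)
    import Data.List.Relation.Unary.Unique.Propositional.Properties as Uniqueₚ
    code : Fin n × Fin n → ℕ
    code e = pair (toℕ (proj₁ e)) (toℕ (proj₂ e))
    code-injective : ∀ {e f} → code e ≡ code f → e ≡ f
    code-injective {a , b} {c , d} eq with pair-injective {toℕ a} {toℕ b} {toℕ c} {toℕ d} eq
    ... | p , q = cong₂ _,_ (toℕ-injective p) (toℕ-injective q)
    unique⇒distinct : ∀ {xs : List ℕ} → Unique xs → Distinct xs
    unique⇒distinct []       z = z≤n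
    unique⇒distinct {x ∷ xs} (x∉ ∷ u) = Distinct-∷ {x} {xs} (mult-∉ xs λ y y∈ → lookup x∉ y∈) (unique⇒distinct u)
    bound : ∀ x → x ∈ map code (edges G) → x < 4 * (n * n)
    bound x x∈ with ∈-map⁻ code x∈
    ... | (a , b) , _ , refl = begin-strict
      (toℕ a + toℕ b) * (toℕ a + toℕ b) + toℕ b                     ≤⟨ +-monoʳ-≤ _ (m≤n+m (toℕ b) (toℕ a)) ⟩
      (toℕ a + toℕ b) * (toℕ a + toℕ b) + (toℕ a + toℕ b)           <⟨ m≤m+n _ (toℕ a + toℕ b) ⟩
      suc ((toℕ a + toℕ b) * (toℕ a + toℕ b) + (toℕ a + toℕ b)) + (toℕ a + toℕ b) ≡⟨ lem (toℕ a + toℕ b) ⟩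
      suc (toℕ a + toℕ b) * suc (toℕ a + toℕ b)                     ≤⟨ *-mono-≤ sum≤ sum≤ ⟩
      (n + n) * (n + n)                                             ≡⟨ lem′ n ⟩
      4 * (n * n)                                                   ∎
      where
      open ≤-Reasoning
      sum≤ : suc (toℕ a + toℕ b) ≤ n + n
      sum≤ = +-mono-≤ (toℕ<n a) (<⇒≤ (toℕ<n b))
      lem : ∀ z → suc (z * z + z) + z ≡ suc z * suc z
      lem = solve-∀
      lem′ : ∀ z → (z + z) * (z + z) ≡ 4 * (z * z)
      lem′ = solve-∀

-- Logarithms and powers of two.

n≤2^⌈log₂n⌉ : ∀ n → 1 ≤ n → n ≤ 2 ^ ⌈log₂ n ⌉
n≤2^⌈log₂n⌉ = <-rec (λ n → 1 ≤ n → n ≤ 2 ^ ⌈log₂ n ⌉) go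
  where
  open import Data.Nat.Induction using (<-rec)
  go : ∀ n → (∀ {m} → m < n → 1 ≤ m → m ≤ 2 ^ ⌈log₂ m ⌉) → 1 ≤ n → n ≤ 2 ^ ⌈log₂ n ⌉
  go (suc zero) rec _ = s≤s z≤n
  go n@(suc (suc k)) rec _ = begin
    n                                        ≡⟨ ⌊n/2⌋+⌈n/2⌉≡n n ⟨
    ⌊ n /2⌋ + ⌈ n /2⌉                        ≤⟨ +-monoˡ-≤ ⌈ n /2⌉ (⌊n/2⌋≤⌈n/2⌉ n) ⟩
    ⌈ n /2⌉ + ⌈ n /2⌉                        ≡⟨ cong (⌈ n /2⌉ +_) (+-identityʳ ⌈ n /2⌉) ⟨
    2 * ⌈ n /2⌉                              ≤⟨ *-monoʳ-≤ 2 (rec (⌈n/2⌉<n k) (s≤s z≤n)) ⟩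
    2 * 2 ^ ⌈log₂ ⌈ n /2⌉ ⌉                  ≡⟨ cong (λ e → 2 * 2 ^ e) (⌈log₂⌈n/2⌉⌉≡⌈log₂n⌉∸1 n) ⟩
    2 ^ suc (⌈log₂ n ⌉ ∸ 1)                  ≡⟨ cong (2 ^_) (m+[n∸m]≡n (⌈log₂⌉-mono-≤ (s≤s (s≤s (z≤n {k}))))) ⟩
    2 ^ ⌈log₂ n ⌉                            ∎
    where open ≤-Reasoning

n<2^log : ∀ n → n < 2 ^ log n
n<2^log n = ≤-trans (n≤1+n (suc n)) (n≤2^⌈log₂n⌉ (2 + n) (s≤s z≤n))

-- From idealised execution to the word RAM.

module Machine (w Z : ℕ) where

  exec⇒run : ∀ {p σ t τ b B} → Exec p σ t τ → tame Z p ≡ true → Bounded b σ → b + t * 3 ≤ B → (B + 3) ^ Z < 2 ^ w →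
             iter w t (p , σ) ≡ ([] , τ) × Bounded B τ
  exec⇒run {p} {σ} {t} {B = B} d tm bd ≤B fit with Simulation.exec⇒iter w Z B fit d tm bd ≤B
  ... | r , bd′ = trans (cong (λ q → iter w t (q , σ)) (sym (++-identityʳ p))) (r []) , bounded-mono ≤B bd′
    where open import Data.List.Properties using (++-identityʳ)

  -- `Builds` admits any coin sequence of any length. The program ignores the coins and a halted
  -- configuration is a fixed point, so both runs can be prolonged to a common length and compared.
  run-unique : ∀ {t t′ p σ τ υ} (ω : Vec Bool t′) → coinFree p ≡ true → iter w t (p , σ) ≡ ([] , τ) → run w ω (p , σ) ≡ ([] , υ) → υ ≡ τ
  run-unique {t} {t′} {p} {σ} {τ} {υ} ω cf e r = cong proj₂ (begin
    ([] , υ)                         ≡⟨ iter-halted w t υ ⟨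
    iter w t ([] , υ)                ≡⟨ cong (iter w t) (trans (sym r) (run≡iter w ω p σ cf)) ⟩
    iter w t (iter w t′ (p , σ))     ≡⟨ iter-+ w t′ t (p , σ) ⟨
    iter w (t′ + t) (p , σ)          ≡⟨ cong (λ s → iter w s (p , σ)) (+-comm t′ t) ⟩
    iter w (t + t′) (p , σ)          ≡⟨ iter-+ w t t′ (p , σ) ⟩
    iter w t′ (iter w t (p , σ))     ≡⟨ cong (iter w t′) e ⟩
    iter w t′ ([] , τ)               ≡⟨ iter-halted w t′ τ ⟩
    ([] , τ)                         ∎)
    where open ≡-Reasoning

∑≤ : ∀ t (f : Vec Bool t → ℕ) c → (∀ ω → f ω ≤ c) → ∑ t f ≤ 2 ^ t * c
∑≤ zero    f c h = ≤-trans (h []) (≤-reflexive (sym (+-identityʳ c)))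
∑≤ (suc t) f c h = ≤-trans (+-mono-≤ (∑≤ t _ c λ ω → h (false ∷ ω)) (∑≤ t _ c λ ω → h (true ∷ ω)))
  (≤-reflexive (lem (2 ^ t) c))
  where
  lem : ∀ a c → a * c + a * c ≡ 2 * a * c
  lem = solve-∀

-- The oracle, its constants and its word length.

space time build : Polylog
-- The bounds in terms of K have the constants 52, 160 and 1744. They double because K is at most
-- twice the cube root of n.
space = record { constant = 104 ; exponent = 3 }
time  = record { constant = 320 ; exponent = 3 }
build = record { constant = 3488 ; exponent = 3 }

oracle : DistanceOracle
-- The word factor becomes 902, which exceeds 21 · 41: stored values are below (2 ^ L) ^ 21, and no
-- simulated expression has more than 41 leaves.
oracle = record { preprocessing = preprocessP ; query = queryP ; extraFactor = 900 }

n<2^n : ∀ n → n < 2 ^ n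
n<2^n zero    = s≤s z≤n
n<2^n (suc n) = begin
  suc (suc n)          ≤⟨ s≤s (n<2^n n) ⟩
  1 + 2 ^ n            ≤⟨ +-monoˡ-≤ (2 ^ n) (≤-trans (s≤s z≤n) (n<2^n n)) ⟩
  2 ^ n + 2 ^ n        ≡⟨ cong (2 ^ n +_) (+-identityʳ (2 ^ n)) ⟨
  2 ^ suc n            ∎
  where open ≤-Reasoning

word-fits : ∀ L a z c x → 1 ≤ L → x ≤ (2 ^ L) ^ a → a * z < c → x ^ z < 2 ^ (c * L)
word-fits L a z c x 1≤L x≤ az<c = begin-strict
  x ^ z                    ≤⟨ ^-monoˡ-≤ z x≤ ⟩
  ((2 ^ L) ^ a) ^ z        ≡⟨ ^-*-assoc (2 ^ L) a z ⟩
  (2 ^ L) ^ (a * z)        ≡⟨ ^-*-assoc 2 L (a * z) ⟩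
  2 ^ (L * (a * z))        <⟨ ^-monoʳ-< 2 (s≤s (s≤s z≤n)) (<-≤-trans (*-monoʳ-< L {{>-nonZero 1≤L}} az<c) (≤-reflexive (*-comm L c))) ⟩
  2 ^ (c * L)              ∎
  where open ≤-Reasoning

nth-≤ : ∀ {b} xs → (∀ x → x ∈ xs → x ≤ b) → ∀ i → nth xs i ≤ b
nth-≤ []       h i       = z≤n
nth-≤ (x ∷ xs) h zero    = h x (here refl)
nth-≤ (x ∷ xs) h (suc i) = nth-≤ xs (λ y y∈ → h y (there y∈)) i

nth-applyUpTo : ∀ (f : ℕ → ℕ) N {i} → i < N → nth (applyUpTo f N) i ≡ f i
nth-applyUpTo f (suc N) {zero}  _        = refl
nth-applyUpTo f (suc N) {suc i} (s≤s lt) = nth-applyUpTo (λ j → f (suc j)) N lt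

nth-applyUpTo-≤ : ∀ {b} (f : ℕ → ℕ) N i → (∀ j → f j ≤ b) → nth (applyUpTo f N) i ≤ b
nth-applyUpTo-≤ f zero    i       h = z≤n
nth-applyUpTo-≤ f (suc N) zero    h = h 0
nth-applyUpTo-≤ f (suc N) (suc i) h = nth-applyUpTo-≤ (λ j → f (suc j)) N i (λ j → h (suc j))

initial-bounded : ∀ {b} x y xs → x ≤ b → y ≤ b → (∀ i → nth xs i ≤ b) → Bounded b (initial x y xs)
initial-bounded {b} x y xs x≤ y≤ h = bounded
  (λ r → upd-≤ ((λ _ → 0) [ 0 ↦ x ]) 1 y r (λ j → upd-≤ (λ _ → 0) 0 x j (λ _ → z≤n) x≤) y≤) arr
  where
  arr : ∀ a i → arrays (initial x y xs) a i ≤ b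
  arr zero    i = h i
  arr (suc a) i = z≤n

ends-∈ : ∀ es {x} → x ∈ ends es → ∃[ e ] e ∈ es × (x ≡ proj₁ e ⊎ x ≡ proj₂ e)
ends-∈ (e ∷ es) (here refl)         = e , here refl , inj₁ refl
ends-∈ (e ∷ es) (there (here refl)) = e , here refl , inj₂ refl
ends-∈ (e ∷ es) (there (there i)) with ends-∈ es i
... | f , f∈ , eq = f , there f∈ , eq

record Halts (w : ℕ) (p : Program) (σ : Store) (T B : ℕ) (Post : Store → Set) : Set where
  field
    t     : ℕ
    τ     : Store
    halts : iter w t (p , σ) ≡ ([] , τ)
    t≤T   : t ≤ T
    bound : Bounded B τ
    post  : Post τ

-- Assembly for a fixed graph: word length, space, time and stretch.

module Final (n : ℕ) (1≤n : 1 ≤ n) (G : Graph n) where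

  es : List (ℕ × ℕ)
  es = pairs G

  L : ℕ
  L = log n

  open Cost n 1≤n es (half-bounded G) L (n<2^log n)

  P U : ℕ
  P = 2 ^ L
  U = P ^ 6

  2≤P : 2 ≤ P
  2≤P = ≤-trans (s≤s 1≤n) (n<2^log n)

  instance
    P-nonZero : NonZero P
    P-nonZero = >-nonZero (≤-trans (s≤s z≤n) 2≤P)

  K≤P : K ≤ P
  K≤P = ≤-trans K≤n (<⇒≤ (n<2^log n))

  L≤P : L ≤ P
  L≤P = <⇒≤ (n<2^n L)

  power≤U : ∀ {a} → a ≤ 6 → P ^ a ≤ U
  power≤U a≤ = ^-monoʳ-≤ P a≤

  n≤U : n ≤ U
  n≤U = ≤-trans (≤-trans (<⇒≤ (n<2^log n)) (≤-reflexive (sym (*-identityʳ P)))) (power≤U {1} (s≤s z≤n))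

  es≤P : length es ≤ 4 * P ^ 2
  es≤P = begin
    length es             ≡⟨ length-map toℕ² (edges G) ⟩
    ∣E G ∣                ≤⟨ edges≤ G ⟩
    4 * (n * n)           ≤⟨ *-monoʳ-≤ 4 (*-mono-≤ (<⇒≤ (n<2^log n)) (<⇒≤ (n<2^log n))) ⟩
    4 * (P * P)           ≡⟨ cong (λ z → 4 * (P * z)) (*-identityʳ P) ⟨
    4 * P ^ 2             ∎
    where open ≤-Reasoning

  es≤U : length es ≤ 4 * U
  es≤U = ≤-trans es≤P (*-monoʳ-≤ 4 (power≤U {2} (s≤s (s≤s z≤n))))

  M≤P : M ≤ 4 * P ^ 2
  M≤P = ⊔-lub es≤P (≤-trans (≤-trans (s≤s z≤n) (m≤m*n 4 (P ^ 2) {{m^n≢0 P 2}})) ≤-refl)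

  KL≤P : K * L ^ 3 ≤ P ^ 4
  KL≤P = *-mono-≤ K≤P (^-monoˡ-≤ 3 L≤P)

  unit≤U : unit 3 ≤ 4 * U
  unit≤U = begin
    unit 3                    ≡⟨ trans (unit≡ 3) (*-assoc M K (L ^ 3)) ⟩
    M * (K * L ^ 3)           ≤⟨ *-mono-≤ M≤P KL≤P ⟩
    4 * P ^ 2 * P ^ 4         ≡⟨ *-assoc 4 (P ^ 2) (P ^ 4) ⟩
    4 * (P ^ 2 * P ^ 4)       ≡⟨ cong (4 *_) (^-distribˡ-+-* P 2 4) ⟨
    4 * U                     ∎
    where open ≤-Reasoning

  T₀ B label-cap query-cost B₂ : ℕ
  T₀ = 1744 * unit 3
  B = n + length es + T₀ * 3
  label-cap = 17 * (K * L ^ 3)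
  query-cost = 6 + label-cap * 9
  B₂ = B + query-cost * 3

  -- Each term is at most a multiple of P⁶: the unit contributes P² for the edges, P for K and P³
  -- for L³. The factors add up to 21413, which is below 2 ^ 15, hence at most P ^ 15.
  B₂≤ : B₂ + 3 ≤ P ^ 21
  B₂≤ = begin
    B₂ + 3                                               ≤⟨ +-mono-≤ (+-mono-≤ (+-mono-≤ (+-mono-≤ n≤U es≤U) (*-monoˡ-≤ 3 (*-monoʳ-≤ 1744 unit≤U)))
                                                              (*-monoˡ-≤ 3 (+-mono-≤ (m≤m*n 6 U {{m^n≢0 P 6}}) (*-monoˡ-≤ 9 (*-monoʳ-≤ 17 KL≤U))))) (m≤m*n 3 U {{m^n≢0 P 6}}) ⟩
    U + 4 * U + 1744 * (4 * U) * 3 + (6 * U + 17 * U * 9) * 3 + 3 * U ≡⟨ lem U ⟩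
    21413 * U                                            ≤⟨ *-monoˡ-≤ U (≤-trans (m≤m+n 21413 11355) (^-monoˡ-≤ 15 2≤P)) ⟩
    P ^ 15 * U                                           ≡⟨ ^-distribˡ-+-* P 15 6 ⟨
    P ^ 21                                               ∎
    where
    open ≤-Reasoning
    KL≤U : K * L ^ 3 ≤ U
    KL≤U = ≤-trans KL≤P (power≤U {4} (s≤s (s≤s (s≤s (s≤s z≤n)))))
    lem : ∀ u → u + 4 * u + 1744 * (4 * u) * 3 + (6 * u + 17 * u * 9) * 3 + 3 * u ≡ 21413 * u
    lem = solve-∀

  w : ℕ
  w = DistanceOracle.wordLength oracle n

  fit₂ : (B₂ + 3) ^ 41 < 2 ^ w
  -- `pairE e f` has two copies of `e` and three of `f`. The index in `markBody` pairs a register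
  -- with a cell whose own index has 2 · 5 + 3 = 13 leaves, which gives 2 + 3 · 13 = 41, the maximum
  -- over both programs.
  fit₂ = word-fits L 21 41 902 (B₂ + 3) 1≤L B₂≤ (m≤m+n 862 40)

  fit₁ : (B + 3) ^ 41 < 2 ^ w
  fit₁ = ≤-<-trans (^-monoˡ-≤ 41 (+-monoˡ-≤ 3 (m≤m+n B _))) fit₂

  σ₀ : Store
  σ₀ = initial n ∣E G ∣ (endpoints G)

  σ₀≡ : initial n (length es) (ends es) ≡ σ₀
  σ₀≡ = cong₂ (initial n) (length-map toℕ² (edges G)) (sym (endpoints≡ G))

  σ₀-bounded : Bounded (n + length es) (initial n (length es) (ends es))
  σ₀-bounded = initial-bounded n (length es) (ends es) (m≤m+n n _) (m≤n+m _ n) (nth-≤ (ends es) λ x x∈ → small (ends-∈ es x∈))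
    where
    small : ∀ {x} → (∃[ e ] e ∈ es × (x ≡ proj₁ e ⊎ x ≡ proj₂ e)) → x ≤ n + length es
    small (e , e∈ , inj₁ refl) = ≤-trans (<⇒≤ (half-bounded G (halves-∈ (reverse⁺ e∈)))) (m≤m+n n _)
    small (e , e∈ , inj₂ refl) = ≤-trans (<⇒≤ (half-bounded G (halves-symmetric (reverse es) (halves-∈ (reverse⁺ e∈))))) (m≤m+n n _)

  -- Opaque, so that the run of the whole program is never unfolded; the properties in `Halts` are
  -- all that the rest uses.
  abstract

    preprocessed : Halts w preprocessP σ₀ T₀ B Built
    preprocessed = from ex-preprocess
      where
      from : Ex preprocessP (initial n (length es) (ends es)) T₀ Built → Halts w preprocessP σ₀ T₀ B Built
      from (t , τ , d , t≤ , b) = record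
        { t = t ; τ = τ ; t≤T = t≤ ; post = b
        ; halts = subst (λ σ → iter w t (preprocessP , σ) ≡ ([] , τ)) σ₀≡ (proj₁ r)
        ; bound = proj₂ r }
        where
        r : iter w t (preprocessP , initial n (length es) (ends es)) ≡ ([] , τ) × Bounded B τ
        r = Machine.exec⇒run w 41 {preprocessP} {b = n + length es} {B} d refl σ₀-bounded (+-monoʳ-≤ (n + length es) (*-monoˡ-≤ 3 t≤)) fit₁

  open Halts preprocessed renaming (post to built)

  data-structure : List ℕ
  data-structure = applyUpTo (arrays τ 1) (regs τ 0)

  builds-unique : ∀ D → Builds oracle G D → D ≡ data-structure
  builds-unique D (t′ , ω , σ , r , D≡) = trans D≡ (cong (λ ρ → applyUpTo (arrays ρ 1) (regs ρ 0)) (Machine.run-unique w 41 {t} {t′} {preprocessP} {σ₀} {τ} {σ} ω refl halts r))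

  -- The cube of K - 1 is below n, and K is at most 2 (K - 1) as soon as K ≥ 2.
  K³≤8n : K * K * K ≤ 8 * n
  K³≤8n = go K (below (cube-root n))
    where
    lem : ∀ x → (x + x) * (x + x) * (x + x) ≡ 8 * (x * x * x)
    lem = solve-∀
    go : ∀ K → (∀ j → j < K → j * j * j < n) → K * K * K ≤ 8 * n
    go zero b = z≤n
    go (suc zero) b = ≤-trans 1≤n (m≤n*m n 8)
    go (suc j@(suc i)) b = ≤-trans (*-mono-≤ (*-mono-≤ le le) le) (≤-trans (≤-reflexive (lem j)) (*-monoʳ-≤ 8 (<⇒≤ (b j ≤-refl))))
      where
      le : suc j ≤ j + j
      le = s≤s (≤-trans (≤-reflexive (+-comm 1 i)) (+-monoʳ-≤ i (s≤s z≤n)))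

  cube : ∀ {x} a → x ≤ a * K → x ^ 3 ≤ (2 * a) ^ 3 * n
  cube {x} a x≤ = begin
    x ^ 3                   ≤⟨ ^-monoˡ-≤ 3 x≤ ⟩
    (a * K) ^ 3             ≡⟨ lem₁ a K ⟩
    a ^ 3 * (K * K * K)     ≤⟨ *-monoʳ-≤ (a ^ 3) K³≤8n ⟩
    a ^ 3 * (8 * n)         ≡⟨ lem₂ a n ⟩
    (2 * a) ^ 3 * n         ∎
    where
    open ≤-Reasoning
    lem₁ : ∀ a k → a * k * (a * k * (a * k * 1)) ≡ a * (a * (a * 1)) * (k * k * k)
    lem₁ = solve-∀
    lem₂ : ∀ a n → a * (a * (a * 1)) * (8 * n) ≡ 2 * a * (2 * a * (2 * a * 1)) * n
    lem₂ = solve-∀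

  -- The halting time has the same bound for every coin sequence, so the sum over the 2 ^ s
  -- sequences is at most 2 ^ s times that bound.
  expected-time : ExpectedTime preprocess oracle G ≤ build ⟨ n ⟩ * (∣E G ∣ ⊔ 1) · n ^[ 1 /3]
  expected-time s = subst₂ (λ x y → ∑ s (λ ω → steps w ω (preprocessP , σ₀)) ^ 3 ≤ x ^ 3 * y) coefficient≡ (sym (*-identityʳ n))
    (cube (2 ^ s * (1744 * (L ^ 3 * M))) (≤-trans (∑≤ s _ T₀ (λ ω → ≤-trans (steps≤ w ω t preprocessP σ₀ refl (cong proj₁ halts)) t≤T))
      (≤-reflexive (trans (cong (λ u → 2 ^ s * (1744 * u)) (unit≡ 3)) (lem (2 ^ s) M K (L ^ 3))))))
    where
    lem : ∀ a b c d → a * (1744 * (b * c * d)) ≡ a * (1744 * (d * b)) * c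
    lem = solve-∀
    lem′ : ∀ a b c → 2 * (a * (1744 * (b * c))) ≡ a * (3488 * b * c)
    lem′ = solve-∀
    coefficient≡ : 2 * (2 ^ s * (1744 * (L ^ 3 * M))) ≡ 2 ^ s * (3488 * L ^ 3 * (∣E G ∣ ⊔ 1))
    coefficient≡ = trans (lem′ (2 ^ s) (L ^ 3) M) (cong (λ m → 2 ^ s * (3488 * L ^ 3 * (m ⊔ 1))) (length-map toℕ² (edges G)))

  c : ℕ
  c = proj₁ built

  c≤ : c ≤ 14 * (K * L ^ 3)
  c≤ = proj₁ (proj₂ built)

  Lab : Labels
  Lab = proj₁ (proj₂ (proj₂ built))

  open Oracle (proj₂ (proj₂ (proj₂ built)))

  1≤L³ : 1 ≤ L ^ 3
  1≤L³ = ^-monoʳ-≤ L {{>-nonZero 1≤L}} {0} {3} z≤n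

  L≤L³ : L ≤ L ^ 3
  L≤L³ = ≤-trans (≤-reflexive (sym (*-identityʳ L))) (^-monoʳ-≤ L {{>-nonZero 1≤L}} {1} {3} (s≤s z≤n))

  K≤KL : K ≤ K * L ^ 3
  K≤KL = m≤m*n K (L ^ 3) {{>-nonZero 1≤L³}}

  LK≤KL : L * K ≤ K * L ^ 3
  LK≤KL = ≤-trans (*-monoˡ-≤ K L≤L³) (≤-reflexive (*-comm (L ^ 3) K))

  1≤KL : 1 ≤ K * L ^ 3
  1≤KL = ≤-trans 1≤K K≤KL

  labels≤cap : ∀ x → length (Lab x) ≤ label-cap
  labels≤cap x = ≤-trans (labels≤ x) (≤-trans (+-mono-≤ (+-mono-≤ LK≤KL K≤KL) (+-mono-≤ c≤ 1≤KL)) (≤-reflexive (lem (K * L ^ 3))))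
    where
    lem : ∀ u → u + u + (14 * u + u) ≡ 17 * u
    lem = solve-∀

  -- A factor n is counted as part of the coefficient in `cube`: n³ · n is the required n⁴.
  space-bound : length data-structure ≤ space ⟨ n ⟩ · n ^[ 4 /3]
  space-bound = ≤-trans (cube {length data-structure} (52 * L ^ 3 * n) linear) (≤-reflexive (lem (L ^ 3) n))
    where
    open ≤-Reasoning
    lem : ∀ a n → 2 * (52 * a * n) * (2 * (52 * a * n) * (2 * (52 * a * n) * 1)) * n ≡ 104 * a * (104 * a * (104 * a * 1)) * (n * (n * (n * (n * 1))))
    lem = solve-∀
    lem₁ : ∀ n l k → n + l * (n * k * 3) + n * k * 3 ≡ n * 1 + n * (l * k) * 3 + n * k * 3
    lem₁ = solve-∀
    lem₂ : ∀ n u → n * u + n * u * 3 + n * u * 3 + n * (14 * u + u) * 3 ≡ 52 * (n * u)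
    lem₂ = solve-∀
    lem₃ : ∀ n k l → 52 * (n * (k * l)) ≡ 52 * l * n * k
    lem₃ = solve-∀
    linear : length data-structure ≤ 52 * L ^ 3 * n * K
    linear = begin
      length data-structure                                          ≡⟨ length-applyUpTo (arrays τ 1) (regs τ 0) ⟩
      regs τ 0                                                       ≤⟨ tail≤ ⟩
      n + L * (n * K * 3) + n * K * 3 + n * (c + 1) * 3              ≡⟨ cong (_+ n * (c + 1) * 3) (lem₁ n L K) ⟩
      n * 1 + n * (L * K) * 3 + n * K * 3 + n * (c + 1) * 3          ≤⟨ +-mono-≤ (+-mono-≤ (+-mono-≤ (*-monoʳ-≤ n 1≤KL) (*-monoˡ-≤ 3 (*-monoʳ-≤ n LK≤KL)))
                                                                          (*-monoˡ-≤ 3 (*-monoʳ-≤ n K≤KL))) (*-monoˡ-≤ 3 (*-monoʳ-≤ n (+-mono-≤ c≤ 1≤KL))) ⟩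
      n * (K * L ^ 3) + n * (K * L ^ 3) * 3 + n * (K * L ^ 3) * 3 + n * (14 * (K * L ^ 3) + K * L ^ 3) * 3 ≡⟨ lem₂ n (K * L ^ 3) ⟩
      52 * (n * (K * L ^ 3))                                         ≡⟨ lem₃ n K (L ^ 3) ⟩
      52 * L ^ 3 * n * K                                             ∎
      where open import Data.List.Properties using (length-applyUpTo)

  functional : ∀ x {h a b} → (h , a) ∈ Lab x → (h , b) ∈ Lab x → a ≡ b
  functional x i j = ≤-antisym (proj₂ (sound i) _ (proj₁ (sound j))) (proj₂ (sound j) _ (proj₁ (sound i)))

  f : ℕ → ℕ
  f = nth data-structure

  label-chain : ∀ (u : Fin n) → Chain f n (regs τ 0) (f (toℕ u)) (Lab (toℕ u))
  label-chain u = subst (λ p → Chain f n (regs τ 0) p (Lab (toℕ u)))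
    (sym (nth-applyUpTo (arrays τ 1) (regs τ 0) (<-≤-trans (toℕ<n u) (n≤tail label))))
    (chain-mono (λ i _ i< → nth-applyUpTo (arrays τ 1) (regs τ 0) i<) ≤-refl (chain label (toℕ u) (toℕ<n u)))

  module _ (u v : Fin n) where

    open Query f n (regs τ 0) 1≤n (Lab (toℕ u)) (Lab (toℕ v)) (functional (toℕ u))

    positive : ∀ {d} → toℕ u ≢ toℕ v → Path G u v d → 1 ≤ d
    positive {zero}  ne stop = ⊥-elim (ne refl)
    positive {suc d} ne _    = s≤s z≤n

    -- The answer is the length of a walk through a hub, hence at least the distance, and by
    -- minimality at most the sum at the common hub of a shortest path. If no hub is common there is
    -- no path, because any path provides one.
    estimate : ∀ {ans} → Answer (toℕ u) (toℕ v) ans → GoodEstimate G u v (decode oracle ans)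
    estimate (same-vertex e) with toℕ-injective e
    ... | refl = 0 , (stop , λ _ _ → z≤n) , z≤n , z≤n
    estimate (infinite ne none) ℓ p with common (positive ne p) (path⇒walk G p)
    ... | h , a , b , i , j , _ = none i j
    estimate (finite {h} {a} {b} ne i j best) with walk⇒path G (walk-++ (walk-sym (halves-symmetric (reverse es)) (proj₁ (sound i))) (proj₁ (sound j)))
    ... | v′ , v≡ , p with toℕ-injective v≡
    ...   | refl with distance G p
    ...     | d , q , least with common (positive ne q) (path⇒walk G q)
    ...       | h′ , a′ , b′ , i′ , j′ , le = d , (q , least) , ≤-trans (least (b + a) p) (≤-reflexive (+-comm b a)) , ≤-trans (best i′ j′) le

    Answered : Set
    Answered = ∃[ t ] ∃[ d̂ ] (t ≤ time ⟨ n ⟩ · n ^[ 1 /3]) ×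
                 Answers oracle data-structure u v t d̂ × GoodEstimate G u v d̂

    start : Store
    start = initial (toℕ u) (toℕ v) data-structure

    start-bounded : Bounded B start
    start-bounded = initial-bounded (toℕ u) (toℕ v) data-structure (u≤ u) (u≤ v)
      (λ i → nth-applyUpTo-≤ (arrays τ 1) (regs τ 0) i (arr≤ bound 1))
      where
      u≤ : ∀ (u : Fin n) → toℕ u ≤ B
      u≤ u = ≤-trans (<⇒≤ (toℕ<n u)) (≤-trans (m≤m+n n (length es)) (m≤m+n (n + length es) (T₀ * 3)))

    answered : Ex searchP start (6 + length (Lab (toℕ u)) * 3 + length (Lab (toℕ v)) * 6) (λ ρ → Answer (toℕ u) (toℕ v) (regs ρ 3 + regs ρ 4)) → Answered
    answered (s , ρ , d , s≤ , ans) = s + 1 , decode oracle (regs ρ 3 + regs ρ 4) , time≤ , answers , estimate ans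
      where
      s≤cost : s ≤ query-cost
      s≤cost = ≤-trans s≤ (≤-trans (+-mono-≤ (+-monoʳ-≤ 6 (*-monoˡ-≤ 3 (labels≤cap (toℕ u)))) (*-monoˡ-≤ 6 (labels≤cap (toℕ v)))) (≤-reflexive (lem label-cap)))
        where
        lem : ∀ z → 6 + z * 3 + z * 6 ≡ 6 + z * 9
        lem = solve-∀
      time≤ : (s + 1) ^ 3 ≤ (320 * L ^ 3) ^ 3 * n ^ 1
      time≤ = subst₂ (λ x y → (s + 1) ^ 3 ≤ x ^ 3 * y) (sym (*-assoc 2 160 (L ^ 3))) (sym (*-identityʳ n)) (cube (160 * L ^ 3) (begin
        s + 1                                       ≤⟨ +-monoˡ-≤ 1 s≤cost ⟩
        6 + 17 * (K * L ^ 3) * 9 + 1                ≤⟨ +-mono-≤ (+-monoˡ-≤ _ (*-monoʳ-≤ 6 1≤KL)) 1≤KL ⟩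
        6 * (K * L ^ 3) + 17 * (K * L ^ 3) * 9 + K * L ^ 3 ≡⟨ lem K (L ^ 3) ⟩
        160 * L ^ 3 * K                             ∎))
        where
        open ≤-Reasoning
        lem : ∀ k l → 6 * (k * l) + 17 * (k * l) * 9 + k * l ≡ 160 * l * k
        lem = solve-∀
      simulated : (∀ cs → iter w s (searchP ++ cs , start) ≡ (cs , ρ)) × Bounded (B + s * 3) ρ
      simulated = Simulation.exec⇒iter w 41 B₂ fit₂ {searchP} {b = B} d refl start-bounded (+-monoʳ-≤ B (*-monoˡ-≤ 3 s≤cost))
      total : Expr
      total = reg 3 ⟪ add ⟫ reg 4
      end-store : Store
      end-store = setR ρ 0 (regs ρ 3 + regs ρ 4)
      -- The last assignment adds two registers, which `storable` forbids. It is executed on its own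
      -- after the simulated part, when the sum still fits in a word.
      halted : iter w (s + 1) (queryP , start) ≡ ([] , end-store)
      halted = trans (iter-+ w s 1 (queryP , start)) (trans (cong (iter w 1) (proj₁ simulated (setReg 0 total ∷ [])))
        (cong (λ x → [] , setR ρ 0 x) (Simulation.eval-ok w 41 B₂ fit₂ total (bounded-mono (+-monoʳ-≤ B (*-monoˡ-≤ 3 s≤cost)) (proj₂ simulated)) refl)))
      answers : Answers oracle data-structure u v (s + 1) (decode oracle (regs ρ 3 + regs ρ 4))
      answers ω = end-store , trans (run≡iter w ω queryP start refl) halted , refl

    query : Answered
    query = answered (ex-search (toℕ u) (toℕ v) data-structure refl (label-chain u) (label-chain v))

theorem4 : Σ[ O ∈ DistanceOracle ] Σ[ space ∈ Polylog ] Σ[ time ∈ Polylog ] Σ[ build ∈ Polylog ]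
    ∀ (n : ℕ) → 1 ≤ n → (G : Graph n) →
    (∀ (D : List ℕ) → Builds O G D →
    (length D ≤ space ⟨ n ⟩ · n ^[ 4 /3]) ×
    (∀ (u v : Fin n) → ∃[ t ] ∃[ d̂ ]
    (t ≤ time ⟨ n ⟩ · n ^[ 1 /3]) ×
    Answers O D u v t d̂ ×
    GoodEstimate G u v d̂)) ×
    (ExpectedTime (preprocess O G) ≤ build ⟨ n ⟩ * (∣E G ∣ ⊔ 1) · n ^[ 1 /3])
theorem4 = oracle , space , time , build , λ n 1≤n G →
  (λ D b → guarantee n 1≤n G D (Final.builds-unique n 1≤n G D b)) , Final.expected-time n 1≤n G
  where
  guarantee : ∀ n 1≤n (G : Graph n) D → D ≡ Final.data-structure n 1≤n G →
    (length D ≤ space ⟨ n ⟩ · n ^[ 4 /3]) ×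
    (∀ (u v : Fin n) → ∃[ t ] ∃[ d̂ ] (t ≤ time ⟨ n ⟩ · n ^[ 1 /3]) × Answers oracle D u v t d̂ × GoodEstimate G u v d̂)
  guarantee n 1≤n G D refl = Final.space-bound n 1≤n G , Final.query n 1≤n G
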